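{- Let $n\ge 1$ and let $T_1$ and $T_2$ be trees on $n$ vertices such that $T_2$ covers $T_1$ in the poset $\mathsf{GTS}_n$. Let $\mathcal{L}_{T_1}^q$ and $\mathcal{L}_{T_2}^q$ be their $q$-Laplacians. For $\lambda\vdash n$ and $j=1,2$ write $$d_{m_\lambda}(xI-\mathcal{L}_{T_j}^q)=\sum_{r=0}^n (-1)^r c_{m_\lambda,r}^{\mathcal{L}_{T_j}^q}(q)\,x^{n-r}.$$ Then for every $\lambda\vdash n$ and every $r=0,1,\ldots,n$, $$c_{m_\lambda,r}^{\mathcal{L}_{T_1}^q}(q)-c_{m_\lambda,r}^{\mathcal{L}_{T_2}^q}(q)\in\mathbb{R}^+[q^2].$$ Moreover, if $\lambda$ is not of the form $2^k,1^{n-2k}$ for any $k$, then $d_{m_\lambda}(xI-\mathcal{L}_{T_1}^q)=d_{m_\lambda}(xI-\mathcal{L}_{T_2}^q)=0$.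
   Context: Partitions are written in exponential notation: $2^k,1^{n-2k}$ denotes the partition of $n$ with $k$ parts equal to $2$ and $n-2k$ parts equal to $1$. $\mathbb{R}^+$ is the set of non-negative reals and $\mathbb{R}^+[q^2]$ the set of polynomials in $q^2$ with coefficients in $\mathbb{R}^+$. $q$-Laplacian: for a graph $G$ with degree diagonal matrix $D$ and adjacency matrix $A$, $\mathcal{L}_G^q=I+q^2(D-I)-qA$, where $q$ is a variable. Generalized matrix function: let $\Lambda^n_{\mathbb{Q}}$ be the space of homogeneous degree-$n$ symmetric functions over $\mathbb{Q}$, and let $\mathsf{ch}$ be the Frobenius characteristic map from class functions of the symmetric group $\mathfrak{S}_n$ to $\Lambda^n_{\mathbb{Q}}$, $\mathsf{ch}(g)=\sum_{\mu\vdash n} z_\mu^{ -1}g(\mu)p_\mu$ (with $p_\mu$ the power sum symmetric functions and $g(\mu)$ the value of $g$ on permutations of cycle type $\mu$). For $\gamma\in\Lambda^n_{\mathbb{Q}}$ let $\Gamma_\gamma=\mathsf{ch}^{ -1}(\gamma)$, and for an $n\times n$ matrix $A=(a_{i,j})$ define $d_\gamma(A)=\sum_{\psi\in\mathfrak{S}_n}\Gamma_\gamma(\psi)\prod_{i=1}^n a_{i,\psi(i)}$. Here $m_\lambda$ is the monomial symmetric function indexed by $\lambda$. Generalized tree shift (Csikvári): let $T$ be a tree and $x,y$ vertices such that all interior vertices of the $x$–$y$ path $P$ (if any) have degree $2$ in $T$; let $z$ be the neighbour of $y$ on $P$. The tree $T'$ obtained from $T$ by deleting all edges between $y$ and its neighbours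 other than $z$, and adding edges between $x$ and these same vertices, is a generalized tree shift of $T$. $\mathsf{GTS}_n$ is the partial order on isomorphism classes of trees on $n$ vertices given by the reflexive–transitive closure of the relation $T\le T'$ whenever $T'$ is a generalized tree shift of $T$ (the path is its minimum and the star its maximum). "$T_2$ covers $T_1$" means $T_1<T_2$ and there is no $T$ with $T_1<T<T_2$. -}

module Defs where

open import Data.Bool using (Bool; true; false; if_then_else_; _∧_; _∨_; not)
open import Data.Nat as ℕ using (ℕ; zero; suc; _∸_; _^_; _!)
open import Data.Fin as Fin using (Fin; toℕ)
open import Data.Fin.Permutation using (Permutation′; _⟨$⟩ʳ_)
open import Data.Integer using (+_)
open import Data.Rational as ℚ using (ℚ; 0ℚ; 1ℚ)
open import Data.List using (List; []; _∷_; _++_; map; foldr; length; upTo; allFin; concatMap; replicate)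
open import Data.List.Relation.Unary.All using (All)
open import Data.List.Relation.Unary.Linked using (Linked)
open import Data.List.Relation.Unary.Unique.Propositional using (Unique)
open import Data.List.Properties using (≡-dec)
open import Data.Product using (Σ; ∃; _×_)
open import Data.Sum using (_⊎_)
open import Relation.Nullary using (¬_)
open import Relation.Nullary.Decidable using (⌊_⌋)
open import Relation.Binary.PropositionalEquality using (_≡_)
open import Relation.Binary.Construct.Closure.ReflexiveTransitive using (Star)

_==F_ : ∀ {n} → Fin n → Fin n → Bool
i ==F j = ⌊ i Fin.≟ j ⌋

_==L_ : List ℕ → List ℕ → Bool
a ==L b = ⌊ ≡-dec ℕ._≟_ a b ⌋

allB : ∀ {A : Set} → (A → Bool) → List A → Bool
allB p [] = true
allB p (a ∷ as) = p a ∧ allB p as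

sum : List ℕ → ℕ
sum = foldr ℕ._+_ 0

product : List ℕ → ℕ
product = foldr ℕ._*_ 1

signQ : ℕ → ℚ
signQ zero = 1ℚ
signQ (suc r) = ℚ.- signQ r

filterB : ∀ {A : Set} → (A → Bool) → List A → List A
filterB p [] = []
filterB p (a ∷ as) = if p a then a ∷ filterB p as else filterB p as

countB : ∀ {A : Set} → (A → Bool) → List A → ℕ
countB p as = length (filterB p as)

ℕtoℚ : ℕ → ℚ
ℕtoℚ k = + k ℚ./ 1

-- 1/k for k ≥ 1 (only ever applied to positive k)
recipℕ : ℕ → ℚ
recipℕ zero = 0ℚ
recipℕ (suc k) = + 1 ℚ./ suc k

-- Polynomials as coefficient lists (constant term first)

module PolyOps {A : Set} (z : A) (_⊕_ _⊗_ : A → A → A) where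
  addP : List A → List A → List A
  addP [] q = q
  addP (a ∷ p) [] = a ∷ p
  addP (a ∷ p) (b ∷ q) = (a ⊕ b) ∷ addP p q

  scaleP : A → List A → List A
  scaleP a = map (a ⊗_)

  mulP : List A → List A → List A
  mulP [] q = []
  mulP (a ∷ p) q = addP (scaleP a q) (z ∷ mulP p q)

  coeff : List A → ℕ → A
  coeff [] _ = z
  coeff (a ∷ p) zero = a
  coeff (a ∷ p) (suc k) = coeff p k

QPoly : Set
QPoly = List ℚ

open PolyOps 0ℚ ℚ._+_ ℚ._*_ public
  renaming (addP to addQ; scaleP to scaleQ; mulP to mulQ; coeff to coeffQ)

negQ : QPoly → QPoly
negQ = map (λ a → ℚ.- a)

subQ : QPoly → QPoly → QPoly
subQ p r = addQ p (negQ r)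

XPoly : Set
XPoly = List QPoly

open PolyOps [] addQ mulQ public
  renaming (addP to addX; scaleP to scaleX; mulP to mulX; coeff to coeffX)

InRplusQ2 : QPoly → Set
InRplusQ2 p = (k : ℕ) → (0ℚ ℚ.≤ coeffQ p (2 ℕ.* k)) × (coeffQ p (suc (2 ℕ.* k)) ≡ 0ℚ)

IsZeroX : XPoly → Set
IsZeroX p = (a b : ℕ) → coeffQ (coeffX p a) b ≡ 0ℚ

Graph : ℕ → Set
Graph n = Fin n → Fin n → Bool

module _ {n : ℕ} where

  deg : Graph n → Fin n → ℕ
  deg G i = countB (λ j → G i j) (allFin n)

  edgeCount : Graph n → ℕ
  edgeCount G = sum (map (λ i → countB (λ j → G i j ∧ (toℕ i ℕ.<ᵇ toℕ j)) (allFin n)) (allFin n))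

  Connected : Graph n → Set
  Connected G = (i j : Fin n) → Star (λ u v → G u v ≡ true) i j

  IsTree : Graph n → Set
  IsTree G = ((i j : Fin n) → G i j ≡ G j i) × ((i : Fin n) → G i i ≡ false)
             × Connected G × (edgeCount G ≡ n ∸ 1)

  Iso : Graph n → Graph n → Set
  Iso G H = Σ (Permutation′ n) λ σ → (i j : Fin n) → H (σ ⟨$⟩ʳ i) (σ ⟨$⟩ʳ j) ≡ G i j

  Chain : Graph n → Fin n → List (Fin n) → Fin n → Set
  Chain G x [] y = G x y ≡ true
  Chain G x (m ∷ ms) y = (G x m ≡ true) × Chain G m ms y

  lastOf : Fin n → List (Fin n) → Fin n
  lastOf x [] = x
  lastOf x (m ∷ ms) = lastOf m ms

  shift : Graph n → Fin n → Fin n → Fin n → Graph n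
  shift G x y z u v =
    let moved : Fin n → Bool
        moved w = G y w ∧ not (w ==F z)
    in if (u ==F y ∧ moved v) ∨ (v ==F y ∧ moved u) then false
       else ((u ==F x ∧ moved v) ∨ (v ==F x ∧ moved u) ∨ G u v)

  IsGTS : Graph n → Graph n → Set
  IsGTS T T' = Σ (Fin n) λ x → Σ (Fin n) λ y → Σ (List (Fin n)) λ ms →
    Chain T x ms y × Unique (x ∷ ms ++ y ∷ []) × All (λ m → deg T m ≡ 2) ms
    × ((u v : Fin n) → T' u v ≡ shift T x y (lastOf x ms) u v)

  -- the order GTS_n on isomorphism classes
  GTSStep : Graph n → Graph n → Set
  GTSStep T T' = Iso T T' ⊎ (Σ (Graph n) λ T'' → IsGTS T T'' × Iso T'' T')

  _≤GTS_ : Graph n → Graph n → Set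
  _≤GTS_ = Star GTSStep

  _<GTS_ : Graph n → Graph n → Set
  T <GTS T' = (T ≤GTS T') × ¬ Iso T T'

  Covers : Graph n → Graph n → Set   -- Covers T₁ T₂ : T₂ covers T₁
  Covers T₁ T₂ = (T₁ <GTS T₂) × ¬ (Σ (Graph n) λ T → IsTree T × (T₁ <GTS T) × (T <GTS T₂))

IsPartition : ℕ → List ℕ → Set
IsPartition n μ = (sum μ ≡ n) × All (λ k → 1 ℕ.≤ k) μ × Linked ℕ._≥_ μ

-- partitions of r with parts ≤ m (fuel f ≥ r)
partsB : ℕ → ℕ → ℕ → List (List ℕ)
partsB zero zero m = [] ∷ []
partsB zero (suc r) m = []
partsB (suc f) zero m = [] ∷ []
partsB (suc f) (suc r) m =
  concatMap (λ k → map (k ∷_) (partsB f (suc r ∸ k) k)) (map suc (upTo (m ℕ.⊓ suc r)))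

parts : ℕ → List (List ℕ)
parts n = partsB n n n

zee : List ℕ → ℕ
zee μ = product (map (λ i → let c = countB (λ k → k ℕ.≡ᵇ i) μ in (i ^ c) ℕ.* (c !))
                     (map suc (upTo (sum μ))))

lookupL : List ℕ → ℕ → ℕ
lookupL [] _ = 0
lookupL (a ∷ v) zero = a
lookupL (a ∷ v) (suc i) = lookupL v i

subAt : List ℕ → ℕ → ℕ → List ℕ
subAt [] _ m = []
subAt (a ∷ v) zero m = (a ∸ m) ∷ v
subAt (a ∷ v) (suc i) m = a ∷ subAt v i m

-- number of maps f from parts of μ to positions of v with Σ_{f(j)=i} μ_j = v_i
countA : List ℕ → List ℕ → ℕ
countA [] v = if allB (λ a → a ℕ.≡ᵇ 0) v then 1 else 0
countA (m ∷ μ) v =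
  sum (map (λ i → if m ℕ.≤ᵇ lookupL v i then countA μ (subAt v i m) else 0) (upTo (length v)))

-- coefficient of p_μ on the monomial x^ν (ν a partition)
pCoeff : List ℕ → List ℕ → ℕ
pCoeff = countA

-- coefficient of m_ν in ch(g) = Σ_{μ ⊢ n} z_μ⁻¹ g(μ) p_μ
chCoeff : ℕ → (List ℕ → ℚ) → List ℕ → ℚ
chCoeff n g ν = foldr ℚ._+_ 0ℚ
  (map (λ μ → recipℕ (zee μ) ℚ.* g μ ℚ.* ℕtoℚ (pCoeff μ ν)) (parts n))

-- Γ = ch⁻¹(m_λ), i.e. ch(Γ) = m_λ (compare coefficients in the monomial basis)
IsChInvMono : ℕ → List ℕ → (List ℕ → ℚ) → Set
IsChInvMono n λ' Γ = (ν : List ℕ) → IsPartition n ν →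
  chCoeff n Γ ν ≡ (if ν ==L λ' then 1ℚ else 0ℚ)

module _ {n : ℕ} where

  consF : ∀ {m} → Fin n → (Fin m → Fin n) → Fin (suc m) → Fin n
  consF a f Fin.zero = a
  consF a f (Fin.suc i) = f i

  funs : (m : ℕ) → List (Fin m → Fin n)
  funs zero = (λ ()) ∷ []
  funs (suc m) = concatMap (λ a → map (consF a) (funs m)) (allFin n)

  isInj : (Fin n → Fin n) → Bool
  isInj f = allB (λ i → allB (λ j → not (f i ==F f j) ∨ (i ==F j)) (allFin n)) (allFin n)

  perms : List (Fin n → Fin n)
  perms = filterB isInj (funs n)

  iter : (Fin n → Fin n) → ℕ → Fin n → Fin n
  iter ψ zero i = i
  iter ψ (suc k) i = ψ (iter ψ k i)

  firstHit : (Fin n → Fin n) → Fin n → List ℕ → ℕ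
  firstHit ψ i [] = n
  firstHit ψ i (k ∷ ks) = if iter ψ k i ==F i then k else firstHit ψ i ks

  orbitLen : (Fin n → Fin n) → Fin n → ℕ
  orbitLen ψ i = firstHit ψ i (map suc (upTo n))

  isMinRep : (Fin n → Fin n) → Fin n → Bool
  isMinRep ψ i = allB (λ k → toℕ i ℕ.≤ᵇ toℕ (iter ψ k i)) (upTo n)

  insertD : ℕ → List ℕ → List ℕ
  insertD x [] = x ∷ []
  insertD x (y ∷ ys) = if y ℕ.≤ᵇ x then x ∷ y ∷ ys else y ∷ insertD x ys

  sortD : List ℕ → List ℕ
  sortD = foldr insertD []

  cycleType : (Fin n → Fin n) → List ℕ
  cycleType ψ = sortD (map (orbitLen ψ) (filterB (isMinRep ψ) (allFin n)))

module _ {n : ℕ} where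

  -- L^q_G = I + q²(D - I) - qA, entries in ℚ[q]
  qLap : Graph n → Fin n → Fin n → QPoly
  qLap G i j =
    let δ = if i ==F j then 1ℚ else 0ℚ
        a = if G i j then 1ℚ else 0ℚ
        d = if i ==F j then ℕtoℚ (deg G i) else 0ℚ
    in δ ∷ ℚ.- a ∷ (d ℚ.- δ) ∷ []

  xIminus : Graph n → Fin n → Fin n → XPoly
  xIminus G i j = addX (negQ (qLap G i j) ∷ [])
                       (if i ==F j then ([] ∷ (1ℚ ∷ []) ∷ []) else [])

  dfun : (List ℕ → ℚ) → (Fin n → Fin n → XPoly) → XPoly
  dfun Γ M = foldr addX []
    (map (λ ψ → mulX ((Γ (cycleType ψ) ∷ []) ∷ [])
                     (foldr (λ i acc → mulX (M i (ψ i)) acc) ((1ℚ ∷ []) ∷ []) (allFin n)))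
         perms)

  -- c_{γ,r}(q) : d_γ(xI - L) = Σ_r (-1)^r c_r x^{n-r}
  cCoef : (List ℕ → ℚ) → Graph n → ℕ → QPoly
  cCoef Γ G r = scaleQ (signQ r) (coeffX (dfun Γ (xIminus G)) (n ∸ r))

-- In a tree T only the permutations that swap the ends of the edges of a matching contribute
-- to d_γ(xI - L), and ch⁻¹(m_λ) takes the value 2^k [u^k] (u-1)^a on the cycle type
-- 2^a,1^(n-2a) if λ = 2^k,1^(n-2k), and 0 if λ has no such form. With y = -x and s = q² this
-- makes c_r(q) equal to 2^k times the coefficient of u^k y^(n-r) in
--   P_T = Σ_M (s(u-1))^|M| Π_{v ∉ M} (y + 1 - s + s deg v),   M a matching of T.
-- Let P(S) be the sum over matchings inside a vertex set S, with the degrees of T. If v ∈ S has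
-- a neighbour outside S, expanding P(S) at v shows by induction that P(S) and P(S) - P(S∖v)
-- have nonnegative coefficients: the term s of the missing neighbour cancels the -s. The same
-- induction treats P(S) - P(S∖c) - P(S∖d) + P(S∖{c,d}) when c and d lie in different components
-- of S. If T′ is the shift of T along a path from x to y and W is the complement of {x,y}, then,
-- with c and d running over the neighbours of x and of y off the path,
--   P_T - P_T′ = s² Σ_{c,d} (P(W) + (u-1)(P(W∖c) + P(W∖d)) + (u-1)² P(W∖{c,d})),
-- and each summand is a nonnegative combination of these differences.
module Submission where

open import Algebra.Bundles using (CommutativeMonoid; CommutativeRing; RawRing)
open import Algebra.Solver.Ring.AlmostCommutativeRing using (fromCommutativeRing; _-Raw-AlmostCommutative⟶_)
open import Data.Bool using (Bool; true; false; if_then_else_; _∧_; _∨_; not)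
import Data.Bool.Properties as Bool
open import Data.Empty using (⊥; ⊥-elim)
open import Data.Fin.Base as Fin using (Fin; zero; suc; toℕ)
open import Data.Fin.Permutation as Perm using (Permutation′; permutation; _⟨$⟩ʳ_; _⟨$⟩ˡ_)
import Data.Fin.Properties as Fin
import Data.Integer as ℤ
import Data.Integer.Properties as ℤ
open import Data.List.Base using
  ( List; []; _∷_; _++_; [_]; length; map; foldr; concatMap; upTo; applyUpTo; allFin; tabulate;
    replicate )
open import Data.List.Membership.Propositional using (_∈_)
import Data.List.Membership.Propositional.Properties as ∈
import Data.List.Properties as List
open import Data.List.Relation.Unary.All as All using (All; []; _∷_)
open import Data.List.Relation.Unary.AllPairs using ([]; _∷_)
open import Data.List.Relation.Unary.Any using (Any; here; there)
open import Data.List.Relation.Unary.Linked using (Linked; []; [-]; _∷_)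
open import Data.List.Relation.Unary.Unique.Propositional using (Unique)
open import Data.Maybe.Base using (Maybe; just; nothing)
open import Data.Nat.Base as ℕ using (ℕ; zero; suc; s≤s; z≤n)
import Data.Nat.Properties as ℕ
open import Data.Nat.Tactic.RingSolver using (solve-∀)
open import Data.Product using (_×_; _,_; proj₁; proj₂; ∃; ∃₂)
open import Data.Rational as ℚ using (ℚ; 0ℚ; 1ℚ)
import Data.Rational.Properties as ℚ
import Data.Rational.Unnormalised as ℚᵘ
import Data.Rational.Unnormalised.Properties as ℚᵘ
open import Data.Sum using (_⊎_; inj₁; inj₂)
open import Data.Unit using (⊤; tt)
open import Function using (_∘_; id)
open import Level using (Level; 0ℓ; _⊔_) renaming (suc to lsuc)
open import Relation.Binary.Construct.Closure.ReflexiveTransitive as Star using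
  ( Star; ε; _◅_; _◅◅_; reverse; gmap )
open import Relation.Binary.PropositionalEquality as ≡ using (_≡_; _≢_; _≗_)
open import Relation.Nullary using (¬_; Dec; yes; no)
open import Relation.Nullary.Decidable using (_⊎-dec_)
import Defs
open Defs using
  ( _==F_; _==L_; Graph; Connected; IsTree; Iso; IsGTS; _≤GTS_; Chain; lastOf; edgeCount; deg;
    consF; funs; isInj; iter; firstHit; orbitLen; isMinRep; insertD; cycleType; allB; filterB;
    countB; lookupL; subAt; countA; zee; partsB; parts; recipℕ; ℕtoℚ; chCoeff; IsPartition;
    IsChInvMono; XPoly; addQ; scaleQ; mulQ; negQ; subQ; coeffQ; addX; scaleX; mulX; coeffX; xIminus;
    dfun; cCoef; signQ; InRplusQ2; IsZeroX )

-- "Nonnegative" is an abstract predicate closed under sums and products, and the variables live in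
-- nested power series: in q over the rationals, in x over these, in u over both. The layers differ
-- in the condition on the k-th coefficient: it is positive for u, positive after k sign changes for
-- x, since y = -x, and zero at odd k for q. The variable u serves all λ at once. The functional
-- that sends u^k to 2^k if λ = 2^k,1^(n-2k) and to 0 otherwise preserves nonnegativity, and it
-- sends (u-1)^a to an a-th finite difference. That this is the class function at 2^a,1^(n-2a) is
-- binomial inversion: up to the factor 2^j, the coefficients of ch(Γ) at 2^j,1^(n-2j) are the
-- binomial transform of those values. The induction lives on proper vertex subsets, where
-- connectedness supplies the outside neighbour; P_T itself can have negative coefficients, as y + 1
-- - s for one vertex shows. The double sum over c and d arises because T and T′ differ only in the
-- end of the path that carries the d's. Without the c's the two ends are interchangeable, so only
-- terms containing both a c and a d survive.

-- Formal power series over a commutative ring, and a ring solver.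

module PowerSeries {c ℓ} (R : CommutativeRing c ℓ) where
  open CommutativeRing R
  open import Relation.Binary.Reasoning.Setoid setoid
  open import Algebra.Properties.CommutativeSemigroup +-commutativeSemigroup using (interchange)
  open import Algebra.Properties.AbelianGroup +-abelianGroup using (ε⁻¹≈ε)

  Series : Set c
  Series = ℕ → Carrier

  tl : Series → Series
  tl f k = f (suc k)

  infixl 7 _⊛_ _·_
  infixl 6 _⊞_
  infix 4 _≃_

  _≃_ : Series → Series → Set ℓ
  f ≃ g = ∀ k → f k ≈ g k

  _⊞_ : Series → Series → Series
  (f ⊞ g) k = f k + g k

  ⊟_ : Series → Series
  (⊟ f) k = - f k

  constant : Carrier → Series
  constant a zero    = a
  constant a (suc _) = 0#

  _·_ : Carrier → Series → Series
  (a · f) k = a * f k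

  -- The Cauchy product, read off from f = f 0 + X · tl f. Recursion on the coefficient replaces
  -- sums over pairs of exponents.
  _⊛_ : Series → Series → Series
  (f ⊛ g) zero    = f 0 * g 0
  (f ⊛ g) (suc k) = f 0 * g (suc k) + (tl f ⊛ g) k

  ⊛-cong : ∀ {f f′ g g′} → f ≃ f′ → g ≃ g′ → f ⊛ g ≃ f′ ⊛ g′
  ⊛-cong p q zero    = *-cong (p 0) (q 0)
  ⊛-cong p q (suc k) = +-cong (*-cong (p 0) (q (suc k))) (⊛-cong (λ i → p (suc i)) q k)

  -- The definition peels the first factor and this recursion peels the second; commutativity
  -- follows by comparing the two.
  ⊛-suc : ∀ f g k → (f ⊛ g) (suc k) ≈ (f ⊛ tl g) k + f (suc k) * g 0
  ⊛-suc f g zero    = refl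
  ⊛-suc f g (suc k) = trans (+-congˡ (⊛-suc (tl f) g k)) (sym (+-assoc _ _ _))

  ⊛-comm : ∀ f g → f ⊛ g ≃ g ⊛ f
  ⊛-comm f g zero    = *-comm _ _
  ⊛-comm f g (suc k) = begin
    f 0 * g (suc k) + (tl f ⊛ g) k  ≈⟨ +-cong (*-comm _ _) (⊛-comm (tl f) g k) ⟩
    g (suc k) * f 0 + (g ⊛ tl f) k  ≈⟨ +-comm _ _ ⟩
    (g ⊛ tl f) k + g (suc k) * f 0  ≈⟨ ⊛-suc g f k ⟨
    (g ⊛ f) (suc k)                 ∎

  ⊛-distribʳ : ∀ h f g → (f ⊞ g) ⊛ h ≃ f ⊛ h ⊞ g ⊛ h
  ⊛-distribʳ h f g zero    = distribʳ _ _ _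
  ⊛-distribʳ h f g (suc k) =
    trans (+-cong (distribʳ _ _ _) (⊛-distribʳ h (tl f) (tl g) k)) (interchange _ _ _ _)

  ·-⊛ : ∀ a f g → (a · f) ⊛ g ≃ a · (f ⊛ g)
  ·-⊛ a f g zero    = *-assoc _ _ _
  ·-⊛ a f g (suc k) = trans (+-cong (*-assoc _ _ _) (·-⊛ a (tl f) g k)) (sym (distribˡ _ _ _))

  ⊛-assoc : ∀ f g h → (f ⊛ g) ⊛ h ≃ f ⊛ (g ⊛ h)
  ⊛-assoc f g h zero    = *-assoc _ _ _
  ⊛-assoc f g h (suc k) = begin
    f 0 * g 0 * h (suc k) + ((f 0 · tl g ⊞ tl f ⊛ g) ⊛ h) k
      ≈⟨ +-cong (*-assoc _ _ _) (⊛-distribʳ h (f 0 · tl g) (tl f ⊛ g) k) ⟩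
    f 0 * (g 0 * h (suc k)) + (((f 0 · tl g) ⊛ h) k + ((tl f ⊛ g) ⊛ h) k)
      ≈⟨ +-congˡ (+-cong (·-⊛ (f 0) (tl g) h k) (⊛-assoc (tl f) g h k)) ⟩
    f 0 * (g 0 * h (suc k)) + (f 0 * (tl g ⊛ h) k + (tl f ⊛ (g ⊛ h)) k)
      ≈⟨ +-assoc _ _ _ ⟨
    f 0 * (g 0 * h (suc k)) + f 0 * (tl g ⊛ h) k + (tl f ⊛ (g ⊛ h)) k
      ≈⟨ +-congʳ (distribˡ _ _ _) ⟨
    (f ⊛ (g ⊛ h)) (suc k) ∎

  zero-⊛ : ∀ {f} g → (∀ k → f k ≈ 0#) → ∀ k → (f ⊛ g) k ≈ 0#
  zero-⊛ g z zero    = trans (*-congʳ (z 0)) (zeroˡ _)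
  zero-⊛ g z (suc k) =
    trans (+-cong (trans (*-congʳ (z 0)) (zeroˡ _)) (zero-⊛ g (λ i → z (suc i)) k)) (+-identityˡ _)

  constant-⊛ : ∀ a g → constant a ⊛ g ≃ a · g
  constant-⊛ a g zero    = refl
  constant-⊛ a g (suc k) = trans (+-congˡ (zero-⊛ g (λ _ → refl) k)) (+-identityʳ _)

  ⊛-identityˡ : ∀ g → constant 1# ⊛ g ≃ g
  ⊛-identityˡ g k = trans (constant-⊛ 1# g k) (*-identityˡ _)

  constant-cong : ∀ {a b} → a ≈ b → constant a ≃ constant b
  constant-cong p zero    = p
  constant-cong p (suc _) = refl

  constant-* : ∀ a b → constant (a * b) ≃ constant a ⊛ constant b
  constant-* a b zero    = refl
  constant-* a b (suc k) = sym (trans (constant-⊛ a (constant b) (suc k)) (zeroʳ a))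

  constant-+ : ∀ a b → constant (a + b) ≃ constant a ⊞ constant b
  constant-+ a b zero    = refl
  constant-+ a b (suc k) = sym (+-identityˡ 0#)

  constant-neg : ∀ a → constant (- a) ≃ ⊟ constant a
  constant-neg a zero    = refl
  constant-neg a (suc k) = sym ε⁻¹≈ε

  X : Series
  X zero          = 0#
  X (suc zero)    = 1#
  X (suc (suc _)) = 0#

  X-⊛-zero : ∀ f → (X ⊛ f) 0 ≈ 0#
  X-⊛-zero f = zeroˡ _

  X-⊛-suc : ∀ f k → (X ⊛ f) (suc k) ≈ f k
  X-⊛-suc f k = trans (+-cong (zeroˡ _) (trans (⊛-cong {tl X} {constant 1#} {f} tl-X (λ _ → refl) k) (⊛-identityˡ f k)))
    (+-identityˡ _)
    where
    tl-X : tl X ≃ constant 1#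
    tl-X zero    = refl
    tl-X (suc _) = refl

  series : CommutativeRing c ℓ
  series = record
    { Carrier = Series
    ; _≈_ = _≃_
    ; _+_ = _⊞_
    ; _*_ = _⊛_
    ; -_  = ⊟_
    ; 0#  = λ _ → 0#
    ; 1#  = constant 1#
    ; isCommutativeRing = record
      { isRing = record
        { +-isAbelianGroup = record
          { isGroup = record
            { isMonoid = record
              { isSemigroup = record
                { isMagma = record
                  { isEquivalence = record
                    { refl  = λ _ → refl
                    ; sym   = λ p k → sym (p k)
                    ; trans = λ p q k → trans (p k) (q k)
                    }
                  ; ∙-cong = λ p q k → +-cong (p k) (q k)
                  }
                ; assoc = λ _ _ _ _ → +-assoc _ _ _
                }
              ; identity = (λ _ _ → +-identityˡ _) , (λ _ _ → +-identityʳ _)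
              }
            ; inverse = (λ _ _ → -‿inverseˡ _) , (λ _ _ → -‿inverseʳ _)
            ; ⁻¹-cong = λ p k → -‿cong (p k)
            }
          ; comm = λ _ _ _ → +-comm _ _
          }
        ; *-cong = ⊛-cong
        ; *-assoc = ⊛-assoc
        ; *-identity = ⊛-identityˡ , λ f k → trans (⊛-comm f (constant 1#) k) (⊛-identityˡ f k)
        ; distrib = (λ h f g k → trans (⊛-comm h (f ⊞ g) k)
                      (trans (⊛-distribʳ h f g k) (+-cong (⊛-comm f h k) (⊛-comm g h k))))
                  , ⊛-distribʳ
        }
      ; *-comm = ⊛-comm
      }
    }

-- The ring solver needs coefficients with decidable equality; differences
-- (a , b) ↦ a · 1 - b · 1 of naturals serve for any commutative ring.
module DifferenceSolver {c ℓ} (R : CommutativeRing c ℓ) where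
  open CommutativeRing R hiding (zero)
  open import Algebra.Properties.Ring ring using (-‿distribˡ-*; -‿distribʳ-*; -‿involutive)
  open import Algebra.Properties.AbelianGroup +-abelianGroup using (⁻¹-∙-comm)
  open import Algebra.Properties.CommutativeSemigroup +-commutativeSemigroup using (interchange)
  open import Algebra.Properties.Semiring.Mult semiring using (×-homo-+; ×1-homo-*) renaming (_×_ to _∙_)
  open import Relation.Binary.Reasoning.Setoid setoid

  private
    -- Canonical representatives: `solve` is closed by `refl` on the two normal forms, so equal
    -- differences have to be the same pair.
    reduce : ℕ × ℕ → ℕ × ℕ
    reduce (a , b) = a ℕ.∸ b , b ℕ.∸ a

    reduce-balanced : ∀ a b → a ℕ.∸ b ℕ.+ b ≡ a ℕ.+ (b ℕ.∸ a)
    reduce-balanced a       ℕ.zero    = ≡.cong (a ℕ.+_) (≡.sym (ℕ.0∸n≡0 a))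
    reduce-balanced ℕ.zero  (ℕ.suc b) = ≡.refl
    reduce-balanced (ℕ.suc a) (ℕ.suc b) =
      ≡.trans (ℕ.+-suc (a ℕ.∸ b) b) (≡.cong ℕ.suc (reduce-balanced a b))

    coefficients : RawRing _ _
    coefficients = record
      { Carrier = ℕ × ℕ
      ; _≈_ = _≡_
      ; _+_ = λ { (a , b) (c , d) → reduce (a ℕ.+ c , b ℕ.+ d) }
      ; _*_ = λ { (a , b) (c , d) → reduce (a ℕ.* c ℕ.+ b ℕ.* d , a ℕ.* d ℕ.+ b ℕ.* c) }
      ; -_  = λ { (a , b) → b , a }
      ; 0#  = 0 , 0
      ; 1#  = 1 , 0
      }

    ⟪_⟫ : ℕ × ℕ → Carrier
    ⟪ a , b ⟫ = a ∙ 1# + - (b ∙ 1#)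

    *-expand : ∀ p q r s → (p * r + q * s) + - (p * s + q * r) ≈ (p + - q) * (r + - s)
    *-expand p q r s = sym (begin
      (p + - q) * (r + - s)                             ≈⟨ distribʳ _ _ _ ⟩
      p * (r + - s) + - q * (r + - s)                   ≈⟨ +-cong (distribˡ _ _ _) (distribˡ _ _ _) ⟩
      p * r + p * - s + (- q * r + - q * - s)           ≈⟨ +-congˡ (+-comm _ _) ⟩
      p * r + p * - s + (- q * - s + - q * r)           ≈⟨ interchange _ _ _ _ ⟩
      p * r + - q * - s + (p * - s + - q * r)           ≈⟨ +-cong (+-congˡ qs) (+-cong (sym (-‿distribʳ-* p s)) (sym (-‿distribˡ-* q r))) ⟩
      p * r + q * s + (- (p * s) + - (q * r))           ≈⟨ +-congˡ (⁻¹-∙-comm _ _) ⟩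
      p * r + q * s + - (p * s + q * r)                 ∎)
      where
      qs : - q * - s ≈ q * s
      qs = trans (sym (-‿distribˡ-* q (- s))) (trans (-‿cong (sym (-‿distribʳ-* q s))) (-‿involutive _))

    cancel : ∀ p q r s → p + s ≈ r + q → p + - q ≈ r + - s
    cancel p q r s eq = begin
      p + - q                    ≈⟨ +-congʳ (+-identityʳ p) ⟨
      p + 0# + - q               ≈⟨ +-congʳ (+-congˡ (-‿inverseʳ s)) ⟨
      p + (s + - s) + - q        ≈⟨ +-congʳ (+-assoc _ _ _) ⟨
      p + s + - s + - q          ≈⟨ +-congʳ (+-congʳ eq) ⟩
      r + q + - s + - q          ≈⟨ +-assoc _ _ _ ⟩
      r + q + (- s + - q)        ≈⟨ +-congˡ (+-comm _ _) ⟩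
      r + q + (- q + - s)        ≈⟨ +-assoc _ _ _ ⟩
      r + (q + (- q + - s))      ≈⟨ +-congˡ (+-assoc _ _ _) ⟨
      r + (q + - q + - s)        ≈⟨ +-congˡ (+-congʳ (-‿inverseʳ q)) ⟩
      r + (0# + - s)             ≈⟨ +-congˡ (+-identityˡ _) ⟩
      r + - s                    ∎

    balance : ∀ a b c d → a ℕ.+ d ≡ c ℕ.+ b → ⟪ a , b ⟫ ≈ ⟪ c , d ⟫
    balance a b c d eq = cancel _ _ _ _
      (trans (sym (×-homo-+ 1# a d)) (trans (reflexive (≡.cong (_∙ 1#) eq)) (×-homo-+ 1# c b)))

    reduce-≈ : ∀ p → ⟪ reduce p ⟫ ≈ ⟪ p ⟫
    reduce-≈ (a , b) = balance _ _ a b (reduce-balanced a b)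

    morphism : coefficients -Raw-AlmostCommutative⟶ fromCommutativeRing R
    morphism = record
      { ⟦_⟧ = ⟪_⟫
      ; +-homo = λ { (a , b) (c , d) → trans (reduce-≈ (a ℕ.+ c , b ℕ.+ d)) (trans (+-cong (×-homo-+ 1# a c) (trans (-‿cong (×-homo-+ 1# b d)) (sym (⁻¹-∙-comm _ _)))) (interchange _ _ _ _)) }
      ; *-homo = λ { (a , b) (c , d) → trans (reduce-≈ (a ℕ.* c ℕ.+ b ℕ.* d , a ℕ.* d ℕ.+ b ℕ.* c)) (trans
          (+-cong (trans (×-homo-+ 1# (a ℕ.* c) _) (+-cong (×1-homo-* a c) (×1-homo-* b d)))
            (-‿cong (trans (×-homo-+ 1# (a ℕ.* d) _) (+-cong (×1-homo-* a d) (×1-homo-* b c)))))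
          (*-expand _ _ _ _)) }
      ; -‿homo = λ { (a , b) → trans (trans (+-comm _ _) (+-congˡ (sym (-‿involutive _)))) (⁻¹-∙-comm _ _) }
      ; 0-homo = -‿inverseʳ _
      ; 1-homo = trans (+-cong (+-identityʳ _) (trans (sym (+-identityˡ _)) (-‿inverseʳ _))) (+-identityʳ _)
      }

    decide : ∀ m n → Maybe (⟪ m ⟫ ≈ ⟪ n ⟫)
    decide (a , b) (c , d) with a ℕ.+ d ℕ.≟ c ℕ.+ b
    ... | no _   = nothing
    ... | yes eq = just (balance a b c d eq)

  open import Algebra.Solver.Ring coefficients (fromCommutativeRing R) morphism decide public

-- Decidable subsets of a finite vertex set.

module FiniteSets where

  ==F-refl : ∀ {n} (i : Fin n) → (i ==F i) ≡ true
  ==F-refl i with i Fin.≟ i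
  ... | yes _ = ≡.refl
  ... | no ¬p = ⊥-elim (¬p ≡.refl)

  ≢⇒==F : ∀ {n} {i j : Fin n} → i ≢ j → (i ==F j) ≡ false
  ≢⇒==F {i = i} {j} i≢j with i Fin.≟ j
  ... | yes p = ⊥-elim (i≢j p)
  ... | no _  = ≡.refl

  ==F⇒≡ : ∀ {n} {i j : Fin n} → (i ==F j) ≡ true → i ≡ j
  ==F⇒≡ {i = i} {j} e with i Fin.≟ j
  ... | yes p = p

  ≡⇒==F : ∀ {n} {i j : Fin n} → i ≡ j → (i ==F j) ≡ true
  ≡⇒==F {i = i} ≡.refl = ==F-refl i

  suc-==F : ∀ {n} (i j : Fin n) → (suc i ==F suc j) ≡ (i ==F j)
  suc-==F i j with i Fin.≟ j
  ... | yes _ = ≡.refl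
  ... | no _  = ≡.refl

  ≡-bool : ∀ {a b : Bool} → (a ≡ true → b ≡ true) → (b ≡ true → a ≡ true) → a ≡ b
  ≡-bool {false} {false} f g = ≡.refl
  ≡-bool {false} {true}  f g = g ≡.refl
  ≡-bool {true}  {b}     f g = ≡.sym (f ≡.refl)

  ≢true⇒≡false : ∀ {a} → ¬ (a ≡ true) → a ≡ false
  ≢true⇒≡false {false} _ = ≡.refl
  ≢true⇒≡false {true}  p = ⊥-elim (p ≡.refl)

  true≢false : ∀ {ℓ} {A : Set ℓ} {b} → b ≡ true → b ≡ false → A
  true≢false ≡.refl ()

  ∧-trueˡ : ∀ {a b} → a ∧ b ≡ true → a ≡ true
  ∧-trueˡ {true} _ = ≡.refl

  ∧-trueʳ : ∀ {a b} → a ∧ b ≡ true → b ≡ true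
  ∧-trueʳ {true} p = p

  ∧-true : ∀ {a b} → a ≡ true → b ≡ true → a ∧ b ≡ true
  ∧-true ≡.refl ≡.refl = ≡.refl

  ∨-true : ∀ {a b} → a ∨ b ≡ true → a ≡ true ⊎ b ≡ true
  ∨-true {true}  _ = inj₁ ≡.refl
  ∨-true {false} p = inj₂ p

  ∨-true₁ : ∀ {a b} → a ≡ true → a ∨ b ≡ true
  ∨-true₁ ≡.refl = ≡.refl

  ∨-true₂ : ∀ {a b} → b ≡ true → a ∨ b ≡ true
  ∨-true₂ {true}  _ = ≡.refl
  ∨-true₂ {false} p = p

  not-true : ∀ {a} → not a ≡ true → a ≡ false
  not-true {false} _ = ≡.refl

  not-false : ∀ {a} → a ≡ false → not a ≡ true
  not-false ≡.refl = ≡.refl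

  Sub : ℕ → Set
  Sub n = Fin n → Bool

  infixl 20 _∖_
  _∖_ : ∀ {n} → Sub n → Fin n → Sub n
  (S ∖ v) i = not (i ==F v) ∧ S i

  ∖-self : ∀ {n} (S : Sub n) v → (S ∖ v) v ≡ false
  ∖-self S v rewrite ==F-refl v = ≡.refl

  ∖-other : ∀ {n} (S : Sub n) {v i} → i ≢ v → (S ∖ v) i ≡ S i
  ∖-other S i≢v rewrite ≢⇒==F i≢v = ≡.refl

  ∖-⊆ : ∀ {n} (S : Sub n) {v i} → (S ∖ v) i ≡ true → S i ≡ true
  ∖-⊆ S = ∧-trueʳ

  ∖-≢ : ∀ {n} (S : Sub n) {v i} → (S ∖ v) i ≡ true → i ≢ v
  ∖-≢ S {v} p ≡.refl = true≢false p (∖-self S v)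

  ∖-in : ∀ {n} (S : Sub n) {v i} → S i ≡ true → i ≢ v → (S ∖ v) i ≡ true
  ∖-in S p q = ≡.trans (∖-other S q) p

  ∖-out : ∀ {n} (S : Sub n) {v i} → S i ≡ false → (S ∖ v) i ≡ false
  ∖-out S {v} {i} p = ≡.trans (≡.cong (not (i ==F v) ∧_) p) (Bool.∧-zeroʳ _)

  ∖-cong : ∀ {n} {S T : Sub n} v → S ≗ T → S ∖ v ≗ T ∖ v
  ∖-cong v p i = ≡.cong (not (i ==F v) ∧_) (p i)

  ∖-comm : ∀ {n} (S : Sub n) u v → S ∖ u ∖ v ≗ S ∖ v ∖ u
  ∖-comm S u v i = Bool-swap (not (i ==F v)) (not (i ==F u)) (S i)
    where
    Bool-swap : ∀ a b c → a ∧ (b ∧ c) ≡ b ∧ (a ∧ c)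
    Bool-swap false false c = ≡.refl
    Bool-swap false true  c = ≡.refl
    Bool-swap true  false c = ≡.refl
    Bool-swap true  true  c = ≡.refl

  allF : ∀ {m} → (Fin m → Bool) → Bool
  allF {zero}  p = true
  allF {suc m} p = p zero ∧ allF (p ∘ suc)

  allF-true : ∀ {m} (p : Fin m → Bool) → (∀ i → p i ≡ true) → allF p ≡ true
  allF-true {zero}  p h = ≡.refl
  allF-true {suc m} p h = ∧-true (h zero) (allF-true (p ∘ suc) (h ∘ suc))

  allF-elim : ∀ {m} (p : Fin m → Bool) → allF p ≡ true → ∀ i → p i ≡ true
  allF-elim p h zero    = ∧-trueˡ h
  allF-elim p h (suc i) = allF-elim (p ∘ suc) (∧-trueʳ {p zero} h) i

open FiniteSets

-- Sums over finite index sets and over functions between them.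

module SumLemmas {c ℓ} (M : CommutativeMonoid c ℓ) where
  open CommutativeMonoid M renaming (ε to unit)
  open import Algebra.Properties.CommutativeMonoid.Sum M
  open import Algebra.Properties.CommutativeSemigroup commutativeSemigroup using (x∙yz≈y∙xz)

  sum-zero : ∀ {n} {f : Fin n → Carrier} → (∀ i → f i ≈ unit) → sum f ≈ unit
  sum-zero {n} p = trans (sum-cong-≋ p) (sum-replicate-zero n)

  -- `k` is `h` with the term at `v` erased. In the typical use this erasure comes from passing from
  -- a subset `S` to `S ∖ v`.
  sum-split : ∀ {n} {h k : Fin n → Carrier} v → k v ≈ unit → (∀ i → i ≢ v → h i ≈ k i) →
              sum h ≈ h v ∙ sum k
  sum-split {suc n} zero p q = ∙-congˡ (trans (sum-cong-≋ (λ i → q (suc i) λ ()))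
    (sym (trans (∙-congʳ p) (identityˡ _))))
  sum-split {suc n} (suc v) p q = trans
    (∙-cong (q zero λ ()) (sum-split v p (λ i i≢v → q (suc i) (i≢v ∘ Fin.suc-injective))))
    (x∙yz≈y∙xz _ _ _)

  sum-single : ∀ {n} {h : Fin n → Carrier} v → (∀ i → i ≢ v → h i ≈ unit) → sum h ≈ h v
  sum-single {n} v q = trans (sum-split {k = λ _ → unit} v refl q)
    (trans (∙-congˡ (sum-zero {n} (λ _ → refl))) (identityʳ _))

module FunctionSums {c ℓ} (R : CommutativeRing c ℓ) where
  open CommutativeRing R hiding (zero)
  open import Algebra.Properties.Semiring.Sum semiring
  open SumLemmas +-commutativeMonoid
  open import Relation.Binary.Reasoning.Setoid setoid

  ι : Bool → Carrier
  ι b = if b then 1# else 0#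

  ι-true : ∀ {b x} → b ≡ true → ι b * x ≈ x
  ι-true ≡.refl = *-identityˡ _

  ι-false : ∀ {b x} → b ≡ false → ι b * x ≈ 0#
  ι-false ≡.refl = zeroˡ _

  ι-cong : ∀ {b b′ x y} → b ≡ b′ → (b ≡ true → x ≈ y) → ι b * x ≈ ι b′ * y
  ι-cong {true}  ≡.refl p = *-congˡ (p ≡.refl)
  ι-cong {false} ≡.refl p = trans (zeroˡ _) (sym (zeroˡ _))

  module _ {n : ℕ} where

    -- The function used in funs 0; without extensionality it must be this one.
    empty : Fin 0 → Fin n
    empty = foldr (λ f _ → f) (λ ()) (funs 0)

    ∑F : ∀ m → ((Fin m → Fin n) → Carrier) → Carrier
    ∑F zero    F = F empty
    ∑F (suc m) F = ∑[ a < n ] ∑F m (λ f → F (consF a f))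

    Extensional : ∀ {m} → ((Fin m → Fin n) → Carrier) → Set _
    Extensional F = ∀ {f g} → f ≗ g → F f ≈ F g

    consF-cong : ∀ {m} a {f g : Fin m → Fin n} → f ≗ g → consF a f ≗ consF a g
    consF-cong a p zero    = ≡.refl
    consF-cong a p (suc i) = p i

    ∑F-cong : ∀ m {F G : (Fin m → Fin n) → Carrier} → (∀ f → F f ≈ G f) → ∑F m F ≈ ∑F m G
    ∑F-cong zero    p = p _
    ∑F-cong (suc m) p = sum-cong-≋ (λ a → ∑F-cong m (λ f → p (consF a f)))

    ∑F-*ˡ : ∀ m x (F : (Fin m → Fin n) → Carrier) → ∑F m (λ f → x * F f) ≈ x * ∑F m F
    ∑F-*ˡ zero    x F = refl
    ∑F-*ˡ (suc m) x F = trans (sum-cong-≋ (λ a → ∑F-*ˡ m x (F ∘ consF a)))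
      (sym (*-distribˡ-sum x (λ a → ∑F m (F ∘ consF a))))

    ∑F-zero : ∀ m {F : (Fin m → Fin n) → Carrier} → (∀ f → F f ≈ 0#) → ∑F m F ≈ 0#
    ∑F-zero zero    p = p _
    ∑F-zero (suc m) p = sum-zero (λ a → ∑F-zero m (λ f → p (consF a f)))

    ∑F-single : ∀ m {F : (Fin m → Fin n) → Carrier} (h : Fin m → Fin n) → Extensional F →
                (∀ f → ¬ (f ≗ h) → F f ≈ 0#) → ∑F m F ≈ F h
    ∑F-single zero    h ext q = ext (λ ())
    ∑F-single (suc m) {F} h ext q = begin
      ∑[ a < n ] ∑F m (F ∘ consF a)
        ≈⟨ sum-single (h zero) (λ a a≢ → ∑F-zero m (λ f → q (consF a f) (λ p → a≢ (p zero)))) ⟩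
      ∑F m (F ∘ consF (h zero))
        ≈⟨ ∑F-single m (h ∘ suc) (λ p → ext (consF-cong _ p))
             (λ f ¬p → q _ (λ p → ¬p (λ i → p (suc i)))) ⟩
      F (consF (h zero) (h ∘ suc))
        ≈⟨ ext (λ { zero → ≡.refl ; (suc i) → ≡.refl }) ⟩
      F h ∎

    set : ∀ {m} → (Fin m → Fin n) → Fin m → Fin n → Fin m → Fin n
    set f v a i = if i ==F v then a else f i

    set-same : ∀ {m} (f : Fin m → Fin n) v a → set f v a v ≡ a
    set-same f v a rewrite ==F-refl v = ≡.refl

    set-other : ∀ {m} (f : Fin m → Fin n) {v i} a → i ≢ v → set f v a i ≡ f i
    set-other f a i≢v rewrite ≢⇒==F i≢v = ≡.refl

    -- Every function is `set f v a` for exactly one value `a` and one `f` with the placeholder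
    -- value `c` at `v`, so the value at `v` can be summed out on its own.
    ∑F-resum : ∀ m {F : (Fin m → Fin n) → Carrier} v c → Extensional F →
               ∑F m F ≈ ∑[ a < n ] ∑F m (λ f → ι (f v ==F c) * F (set f v a))
    ∑F-resum (suc m) {F} zero c ext = sym (sum-cong-≋ λ a → begin
      ∑[ b < n ] ∑F m (λ f → ι (b ==F c) * F (set (consF b f) zero a))
        ≈⟨ sum-single c (λ b b≢c → ∑F-zero m (λ f → ι-false (≢⇒==F b≢c))) ⟩
      ∑F m (λ f → ι (c ==F c) * F (set (consF c f) zero a))
        ≈⟨ ∑F-cong m (λ f → trans (ι-true (==F-refl c)) (ext (λ { zero → ≡.refl ; (suc i) → ≡.refl }))) ⟩
      ∑F m (λ f → F (consF a f)) ∎)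
    ∑F-resum (suc m) {F} (suc v) c ext = begin
      ∑[ b < n ] ∑F m (F ∘ consF b)
        ≈⟨ sum-cong-≋ (λ b → ∑F-resum m v c (λ p → ext (consF-cong b p))) ⟩
      ∑[ b < n ] ∑[ a < n ] ∑F m (λ f → ι (f v ==F c) * F (consF b (set f v a)))
        ≈⟨ ∑-comm (λ b a → ∑F m (λ f → ι (f v ==F c) * F (consF b (set f v a)))) ⟩
      ∑[ a < n ] ∑[ b < n ] ∑F m (λ f → ι (f v ==F c) * F (consF b (set f v a)))
        ≈⟨ sum-cong-≋ {n} (λ a → sum-cong-≋ {n} (λ b → ∑F-cong m (λ f → *-congˡ (ext (same a b f))))) ⟩
      ∑[ a < n ] ∑[ b < n ] ∑F m (λ f → ι (f v ==F c) * F (set (consF b f) (suc v) a)) ∎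
      where
      same : ∀ a b f → consF b (set f v a) ≗ set (consF b f) (suc v) a
      same a b f zero    = ≡.refl
      same a b f (suc i) = ≡.cong (if_then a else f i) (≡.sym (suc-==F i v))

-- Matching sums and their vertex recurrence.

module Matchings {c ℓ} (R : CommutativeRing c ℓ) {n : ℕ} (N : Fin n → Fin n → CommutativeRing.Carrier R) where
  open CommutativeRing R hiding (zero)
  open import Algebra.Properties.Semiring.Sum semiring
  open import Algebra.Properties.CommutativeMonoid.Sum *-commutativeMonoid using ()
    renaming (sum to ∏; sum-cong-≋ to ∏-cong; sum-cong-≗ to ∏-cong-≗)
  open SumLemmas +-commutativeMonoid
  open SumLemmas *-commutativeMonoid using () renaming (sum-split to ∏-split; sum-zero to ∏-one)
  open FunctionSums R
  open import Relation.Binary.Reasoning.Setoid setoid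

  -- The functions with valid S f are the matchings inside S: f swaps the
  -- two ends of every matched pair and fixes everything else.
  valid : Sub n → (Fin n → Fin n) → Bool
  valid S f = allF (λ i → (f (f i) ==F i) ∧ (S i ∨ (f i ==F i)))

  factor : Sub n → Fin n → Fin n → Carrier
  factor S i j = if S i then N i j else 1#

  weight : Sub n → (Fin n → Fin n) → Carrier
  weight S f = ι (valid S f) * ∏ (λ i → factor S i (f i))

  matchingSum : Sub n → Carrier
  matchingSum S = ∑F n (weight S)

  valid-intro : ∀ S f → (∀ i → f (f i) ≡ i) → (∀ i → S i ≡ true ⊎ f i ≡ i) → valid S f ≡ true
  valid-intro S f p q = allF-true _ (λ i → ∧-true (≡⇒==F (p i)) (case (q i)))
    where
    case : ∀ {i} → S i ≡ true ⊎ f i ≡ i → (S i ∨ (f i ==F i)) ≡ true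
    case (inj₁ x) = ∨-true₁ x
    case {i} (inj₂ y) = ∨-true₂ {S i} (≡⇒==F y)

  valid-involutive : ∀ S f → valid S f ≡ true → ∀ i → f (f i) ≡ i
  valid-involutive S f p i = ==F⇒≡ (∧-trueˡ (allF-elim _ p i))

  valid-support : ∀ S f → valid S f ≡ true → ∀ i → S i ≡ true ⊎ f i ≡ i
  valid-support S f p i with ∨-true {S i} (∧-trueʳ {f (f i) ==F i} (allF-elim _ p i))
  ... | inj₁ x = inj₁ x
  ... | inj₂ y = inj₂ (==F⇒≡ y)

  invalid : ∀ S f → ¬ (valid S f ≡ true) → weight S f ≈ 0#
  invalid S f p = ι-false (≢true⇒≡false p)

  factor-in : ∀ S {i} j → S i ≡ true → factor S i j ≈ N i j
  factor-in S j p rewrite p = refl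

  factor-out : ∀ S {i} j → S i ≡ false → factor S i j ≈ 1#
  factor-out S j p rewrite p = refl

  valid-ext : ∀ {S T f g} → S ≗ T → f ≗ g → valid S f ≡ true → valid T g ≡ true
  valid-ext {S} {T} {f} {g} S≗T p v = valid-intro T g
    (λ i → ≡.trans (≡.trans (≡.cong g (≡.sym (p i))) (≡.sym (p (f i)))) (valid-involutive S f v i))
    (λ i → case (valid-support S f v i))
    where
    case : ∀ {i} → S i ≡ true ⊎ f i ≡ i → T i ≡ true ⊎ g i ≡ i
    case {i} (inj₁ x) = inj₁ (≡.trans (≡.sym (S≗T i)) x)
    case {i} (inj₂ x) = inj₂ (≡.trans (≡.sym (p i)) x)

  weight-cong : ∀ {S T f g} → S ≗ T → f ≗ g → weight S f ≈ weight T g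
  weight-cong {S} {T} {f} {g} S≗T p = *-cong
    (reflexive (≡.cong ι (≡-bool (valid-ext S≗T p) (valid-ext (≡.sym ∘ S≗T) (≡.sym ∘ p)))))
    (∏-cong (λ i → reflexive (≡.cong₂ (λ b j → if b then N i j else 1#) (S≗T i) (p i))))

  matchingSum-cong : ∀ {S T} → S ≗ T → matchingSum S ≈ matchingSum T
  matchingSum-cong p = ∑F-cong n (λ f → weight-cong p (λ _ → ≡.refl))

  matchingSum-empty : ∀ S → (∀ i → S i ≡ false) → matchingSum S ≈ 1#
  matchingSum-empty S empty = trans
    (∑F-single n (λ i → i) (weight-cong (λ _ → ≡.refl)) (λ f ¬id → invalid S f (λ v → ¬id (λ i → fix v i))))
    (trans (ι-true (valid-intro S (λ i → i) (λ _ → ≡.refl) (λ _ → inj₂ ≡.refl)))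
      (∏-one (λ i → factor-out S i (empty i))))
    where
    fix : ∀ {f} → valid S f ≡ true → ∀ i → f i ≡ i
    fix {f} v i with valid-support S f v i
    ... | inj₁ x = true≢false x (empty i)
    ... | inj₂ y = y

  private
    module Expansion (S : Sub n) (v : Fin n) (Sv : S v ≡ true) where

      -- The placeholder at `v` is `v` itself. Functions valid on `S ∖ v` fix `v`, so they are among
      -- those that the resummation keeps.
      unmatched : ∀ f → ι (f v ==F v) * weight S (set f v v) ≈ N v v * weight (S ∖ v) f
      unmatched f with f v Fin.≟ v
      ... | no fv≢v = trans (zeroˡ _) (sym (trans (*-congˡ (invalid (S ∖ v) f bad)) (zeroʳ _)))
        where
        bad : ¬ (valid (S ∖ v) f ≡ true)
        bad va with valid-support (S ∖ v) f va v
        ... | inj₁ x = true≢false x (∖-self S v)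
        ... | inj₂ y = fv≢v y
      ... | yes fv≡v = begin
        1# * weight S (set f v v)
          ≈⟨ *-identityˡ _ ⟩
        weight S (set f v v)
          ≈⟨ weight-cong (λ _ → ≡.refl) reset ⟩
        ι (valid S f) * ∏ (λ i → factor S i (f i))
          ≈⟨ *-cong (reflexive (≡.cong ι same)) product ⟩
        ι (valid (S ∖ v) f) * (N v v * ∏ (λ i → factor (S ∖ v) i (f i)))
          ≈⟨ trans (sym (*-assoc _ _ _)) (trans (*-congʳ (*-comm _ _)) (*-assoc _ _ _)) ⟩
        N v v * weight (S ∖ v) f ∎
        where
        reset : set f v v ≗ f
        reset i with i Fin.≟ v
        ... | yes ≡.refl = ≡.sym fv≡v
        ... | no _ = ≡.refl
        same : valid S f ≡ valid (S ∖ v) f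
        same = ≡-bool
          (λ va → valid-intro (S ∖ v) f (valid-involutive S f va) (λ i → to (i Fin.≟ v) (valid-support S f va i)))
          (λ va → valid-intro S f (valid-involutive (S ∖ v) f va) (λ i → from (valid-support (S ∖ v) f va i)))
          where
          to : ∀ {i} → Dec (i ≡ v) → S i ≡ true ⊎ f i ≡ i → (S ∖ v) i ≡ true ⊎ f i ≡ i
          to (yes ≡.refl) _ = inj₂ fv≡v
          to (no i≢v) (inj₁ x) = inj₁ (∖-in S x i≢v)
          to (no i≢v) (inj₂ y) = inj₂ y
          from : ∀ {i} → (S ∖ v) i ≡ true ⊎ f i ≡ i → S i ≡ true ⊎ f i ≡ i
          from (inj₁ x) = inj₁ (∖-⊆ S x)
          from (inj₂ y) = inj₂ y
        product : ∏ (λ i → factor S i (f i)) ≈ N v v * ∏ (λ i → factor (S ∖ v) i (f i))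
        product = trans
          (∏-split v (factor-out (S ∖ v) (f v) (∖-self S v))
            (λ i i≢v → reflexive (≡.cong (if_then N i (f i) else 1#) (≡.sym (∖-other S i≢v)))))
          (*-congʳ (trans (factor-in S (f v) Sv) (reflexive (≡.cong (N v) fv≡v))))

      module Matched (u : Fin n) (u≢v : u ≢ v) where

        swapped : (Fin n → Fin n) → Fin n → Fin n → Fin n
        swapped f b = set (set f u b) v u

        v≢u : v ≢ u
        v≢u = u≢v ∘ ≡.sym

        swapped-v : ∀ f b → swapped f b v ≡ u
        swapped-v f b = set-same (set f u b) v u

        swapped-u : ∀ f b → swapped f b u ≡ b
        swapped-u f b = ≡.trans (set-other (set f u b) u u≢v) (set-same f u b)

        swapped-other : ∀ f b {i} → i ≢ u → i ≢ v → swapped f b i ≡ f i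
        swapped-other f b i≢u i≢v = ≡.trans (set-other (set f u b) u i≢v) (set-other f b i≢u)

        T : Sub n
        T = S ∖ v ∖ u

        T-u : T u ≡ false
        T-u = ∖-self (S ∖ v) u

        T-v : T v ≡ false
        T-v = ∖-out (S ∖ v) (∖-self S v)

        fixed : ∀ f → valid T f ≡ true → ∀ {i} → T i ≡ false → f i ≡ i
        fixed f va {i} p with valid-support T f va i
        ... | inj₁ x = true≢false x p
        ... | inj₂ y = y

        wrong-partner : ∀ f b → b ≢ v → weight S (swapped f b) ≈ 0#
        wrong-partner f b b≢v = invalid S (swapped f b) (λ va → b≢v (≡.trans
          (≡.sym (≡.trans (≡.cong (swapped f b) (swapped-v f b)) (swapped-u f b)))
          (valid-involutive S (swapped f b) va v)))

        outside : ∀ f → S u ≡ false → weight S (swapped f v) ≈ 0#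
        outside f p = invalid S (swapped f v) bad
          where
          bad : ¬ (valid S (swapped f v) ≡ true)
          bad va with valid-support S (swapped f v) va u
          ... | inj₁ x = true≢false x p
          ... | inj₂ y = v≢u (≡.trans (≡.sym (swapped-u f v)) y)

        module _ (f : Fin n → Fin n) (fu : f u ≡ u) (fv : f v ≡ v) (Su : S u ≡ true) where

          g : Fin n → Fin n
          g = swapped f v

          to : valid S g ≡ true → valid T f ≡ true
          to va = valid-intro T f (λ i → inv i (i Fin.≟ u) (i Fin.≟ v)) (λ i → sup i (i Fin.≟ u) (i Fin.≟ v))
            where
            gg : ∀ i → g (g i) ≡ i
            gg = valid-involutive S g va
            inv : ∀ i → Dec (i ≡ u) → Dec (i ≡ v) → f (f i) ≡ i
            inv i (yes ≡.refl) _ = ≡.trans (≡.cong f fu) fu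
            inv i (no _) (yes ≡.refl) = ≡.trans (≡.cong f fv) fv
            inv i (no i≢u) (no i≢v) = ≡.trans (≡.sym (swapped-other f v fi≢u fi≢v)) ggi
              where
              gi : g i ≡ f i
              gi = swapped-other f v i≢u i≢v
              ggi : g (f i) ≡ i
              ggi = ≡.trans (≡.cong g (≡.sym gi)) (gg i)
              fi≢u : f i ≢ u
              fi≢u e = i≢v (≡.trans (≡.sym ggi) (≡.trans (≡.cong g e) (swapped-u f v)))
              fi≢v : f i ≢ v
              fi≢v e = i≢u (≡.trans (≡.sym ggi) (≡.trans (≡.cong g e) (swapped-v f v)))
            sup : ∀ i → Dec (i ≡ u) → Dec (i ≡ v) → T i ≡ true ⊎ f i ≡ i
            sup i (yes ≡.refl) _ = inj₂ fu
            sup i (no _) (yes ≡.refl) = inj₂ fv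
            sup i (no i≢u) (no i≢v) with valid-support S g va i
            ... | inj₁ x = inj₁ (∖-in (S ∖ v) (∖-in S x i≢v) i≢u)
            ... | inj₂ y = inj₂ (≡.trans (≡.sym (swapped-other f v i≢u i≢v)) y)

          from : valid T f ≡ true → valid S g ≡ true
          from va = valid-intro S g (λ i → inv i (i Fin.≟ u) (i Fin.≟ v)) (λ i → sup i (i Fin.≟ u) (i Fin.≟ v))
            where
            ff : ∀ i → f (f i) ≡ i
            ff = valid-involutive T f va
            inv : ∀ i → Dec (i ≡ u) → Dec (i ≡ v) → g (g i) ≡ i
            inv i (yes ≡.refl) _ = ≡.trans (≡.cong g (swapped-u f v)) (swapped-v f v)
            inv i (no _) (yes ≡.refl) = ≡.trans (≡.cong g (swapped-v f v)) (swapped-u f v)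
            inv i (no i≢u) (no i≢v) = ≡.trans (≡.cong g (swapped-other f v i≢u i≢v))
              (≡.trans (swapped-other f v fi≢u fi≢v) (ff i))
              where
              fi≢u : f i ≢ u
              fi≢u e = i≢u (≡.trans (≡.sym (ff i)) (≡.trans (≡.cong f e) fu))
              fi≢v : f i ≢ v
              fi≢v e = i≢v (≡.trans (≡.sym (ff i)) (≡.trans (≡.cong f e) fv))
            sup : ∀ i → Dec (i ≡ u) → Dec (i ≡ v) → S i ≡ true ⊎ g i ≡ i
            sup i (yes ≡.refl) _ = inj₁ Su
            sup i (no _) (yes ≡.refl) = inj₁ Sv
            sup i (no i≢u) (no i≢v) with valid-support T f va i
            ... | inj₁ x = inj₁ (∖-⊆ S (∖-⊆ (S ∖ v) x))
            ... | inj₂ y = inj₂ (≡.trans (swapped-other f v i≢u i≢v) y)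

          product : ∏ (λ i → factor S i (g i)) ≈ N v u * (N u v * ∏ (λ i → factor T i (f i)))
          product = begin
            ∏ (λ i → factor S i (g i))
              ≈⟨ ∏-split v (factor-out (S ∖ v) (g v) (∖-self S v))
                   (λ i i≢v → reflexive (≡.cong (if_then N i (g i) else 1#) (≡.sym (∖-other S i≢v)))) ⟩
            factor S v (g v) * ∏ (λ i → factor (S ∖ v) i (g i))
              ≈⟨ *-cong (trans (factor-in S (g v) Sv) (reflexive (≡.cong (N v) (swapped-v f v))))
                   (∏-split u (factor-out T (f u) T-u) (λ i i≢u → rest i i≢u (i Fin.≟ v))) ⟩
            N v u * (factor (S ∖ v) u (g u) * ∏ (λ i → factor T i (f i)))
              ≈⟨ *-congˡ (*-congʳ (trans (factor-in (S ∖ v) (g u) (∖-in S Su u≢v))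
                   (reflexive (≡.cong (N u) (swapped-u f v))))) ⟩
            N v u * (N u v * ∏ (λ i → factor T i (f i))) ∎
            where
            rest : ∀ i → i ≢ u → Dec (i ≡ v) → factor (S ∖ v) i (g i) ≈ factor T i (f i)
            rest i i≢u (yes ≡.refl) = trans (factor-out (S ∖ v) (g v) (∖-self S v)) (sym (factor-out T (f v) T-v))
            rest i i≢u (no i≢v) = reflexive (≡.cong₂ (λ b j → if b then N i j else 1#)
              (≡.sym (∖-other (S ∖ v) i≢u)) (swapped-other f v i≢u i≢v))

          weights : weight S g ≈ N v u * N u v * weight T f
          weights = trans (*-cong (reflexive (≡.cong ι (≡-bool to from))) product)
            (trans (*-congˡ (sym (*-assoc _ _ _)))
              (trans (sym (*-assoc _ _ _)) (trans (*-congʳ (*-comm _ _)) (*-assoc _ _ _))))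

        unfixed : ∀ f → ¬ (f u ≡ u × f v ≡ v) → weight T f ≈ 0#
        unfixed f p = invalid T f (λ va → p (fixed f va T-u , fixed f va T-v))

        pointwise : ∀ f → ι (f u ==F u) * (ι (set f u v v ==F v) * weight S (swapped f v))
                        ≈ ι ((S ∖ v) u) * (N v u * N u v * weight T f)
        pointwise f = go (f u Fin.≟ u) (f v Fin.≟ v) (S u) ≡.refl
          where
          fv-set : set f u v v ≡ f v
          fv-set = set-other f v v≢u
          go : Dec (f u ≡ u) → Dec (f v ≡ v) → ∀ b → S u ≡ b →
               ι (f u ==F u) * (ι (set f u v v ==F v) * weight S (swapped f v))
                 ≈ ι ((S ∖ v) u) * (N v u * N u v * weight T f)
          go (no ¬p) _ _ _ = trans (ι-false (≢⇒==F ¬p))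
            (sym (trans (*-congˡ (trans (*-congˡ (unfixed f (¬p ∘ proj₁))) (zeroʳ _))) (zeroʳ _)))
          go (yes _) (no ¬p) _ _ = trans (*-congˡ (ι-false (≢⇒==F (¬p ∘ ≡.trans (≡.sym fv-set)))))
            (trans (zeroʳ _) (sym (trans (*-congˡ (trans (*-congˡ (unfixed f (¬p ∘ proj₂))) (zeroʳ _))) (zeroʳ _))))
          go (yes fu) (yes fv) b e = trans (ι-true (≡⇒==F fu)) (trans (ι-true (≡⇒==F (≡.trans fv-set fv))) (inside b e))
            where
            inside : ∀ b → S u ≡ b → weight S (swapped f v) ≈ ι ((S ∖ v) u) * (N v u * N u v * weight T f)
            inside false e = trans (outside f e) (sym (ι-false (∖-out S e)))
            inside true  e = trans (weights f fu fv e) (sym (ι-true (∖-in S e u≢v)))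

        -- A second resummation, now at `u` with placeholder `u`. An involution that sends `v` to
        -- `u` must send `u` back to `v`, so only the term `b = v` survives.
        matched : ∑F n (λ f → ι (f v ==F v) * weight S (set f v u))
                ≈ ι ((S ∖ v) u) * (N v u * N u v * matchingSum T)
        matched = begin
          ∑F n (λ f → ι (f v ==F v) * weight S (set f v u))
            ≈⟨ ∑F-resum n u u (λ p → *-cong (reflexive (≡.cong (λ j → ι (j ==F v)) (p v)))
                 (weight-cong (λ _ → ≡.refl) (λ i → ≡.cong (if i ==F v then u else_) (p i)))) ⟩
          ∑[ b < n ] ∑F n (λ f → ι (f u ==F u) * (ι (set f u b v ==F v) * weight S (swapped f b)))
            ≈⟨ sum-single v (λ b b≢v → ∑F-zero n (λ f →
                 trans (*-congˡ (trans (*-congˡ (wrong-partner f b b≢v)) (zeroʳ _))) (zeroʳ _))) ⟩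
          ∑F n (λ f → ι (f u ==F u) * (ι (set f u v v ==F v) * weight S (swapped f v)))
            ≈⟨ ∑F-cong n pointwise ⟩
          ∑F n (λ f → ι ((S ∖ v) u) * (N v u * N u v * weight T f))
            ≈⟨ trans (∑F-*ˡ n _ _) (*-congˡ (∑F-*ˡ n _ _)) ⟩
          ι ((S ∖ v) u) * (N v u * N u v * matchingSum T) ∎

  -- The vertex recurrence of matching polynomials. The positivity argument uses matching sums only
  -- through it, through their value on the empty set and through invariance under `≗`.
  matchingSum-expand : ∀ S v → S v ≡ true → matchingSum S ≈
    N v v * matchingSum (S ∖ v) + ∑[ u < n ] (ι ((S ∖ v) u) * (N v u * N u v * matchingSum (S ∖ v ∖ u)))
  matchingSum-expand S v Sv = begin
    matchingSum S
      ≈⟨ ∑F-resum n v v (weight-cong (λ _ → ≡.refl)) ⟩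
    ∑[ u < n ] ∑F n (λ f → ι (f v ==F v) * weight S (set f v u))
      ≈⟨ sum-split v (ι-false (∖-self S v)) (λ u u≢v → Matched.matched u u≢v) ⟩
    ∑F n (λ f → ι (f v ==F v) * weight S (set f v v)) + _
      ≈⟨ +-congʳ (trans (∑F-cong n unmatched) (∑F-*ˡ n _ _)) ⟩
    _ ∎
    where open Expansion S v Sv

-- Induction on vertex sets, and induced paths.

module Cardinality where
  open import Algebra.Properties.CommutativeMonoid.Sum ℕ.+-0-commutativeMonoid using (sum; sum-cong-≗) public
  open SumLemmas ℕ.+-0-commutativeMonoid public

  ιℕ : Bool → ℕ
  ιℕ b = if b then 1 else 0

  size : ∀ {n} → Sub n → ℕ
  size S = sum (λ i → ιℕ (S i))

  size-remove : ∀ {n} (S : Sub n) v → S v ≡ true → size S ≡ suc (size (S ∖ v))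
  size-remove S v Sv = ≡.trans
    (sum-split v (≡.cong ιℕ (∖-self S v)) (λ i i≢v → ≡.cong ιℕ (≡.sym (∖-other S i≢v))))
    (≡.cong (ℕ._+ size (S ∖ v)) (≡.cong ιℕ Sv))

  element? : ∀ {n} (S : Sub n) → (∃ λ v → S v ≡ true) ⊎ (∀ v → S v ≡ false)
  element? S with Fin.any? (λ v → S v Bool.≟ true)
  ... | yes p = inj₁ p
  ... | no ¬p = inj₂ (λ v → ≢true⇒≡false (λ q → ¬p (v , q)))

  subset-induction : ∀ {n p} (Q : Sub n → Set p) → (∀ S → (∀ v → S v ≡ true → Q (S ∖ v)) → Q S) → ∀ S → Q S
  subset-induction {n} Q step S = go (size S) S ≡.refl
    where
    go : ∀ k S → size S ≡ k → Q S
    go zero    S e = step S (λ v Sv → ⊥-elim (ℕ.0≢1+n (≡.trans (≡.sym e) (size-remove S v Sv))))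
    go (suc k) S e = step S (λ v Sv → go k (S ∖ v) (ℕ.suc-injective (≡.trans (≡.sym (size-remove S v Sv)) e)))

  -- Expanding a matching sum removes one or two vertices at a time.
  subset-induction₂ : ∀ {n p} (Q : Sub n → Set p) → (∀ {S T} → S ≗ T → Q S → Q T) →
    (∀ S → (∀ v → S v ≡ true → Q (S ∖ v)) → (∀ v u → S v ≡ true → (S ∖ v) u ≡ true → Q (S ∖ v ∖ u)) → Q S) →
    ∀ S → Q S
  subset-induction₂ Q resp step S = proj₁ (subset-induction Q′ go S)
    where
    Q′ : Sub _ → Set _
    Q′ S = Q S × (∀ v → S v ≡ true → Q (S ∖ v))
    go : ∀ S → (∀ v → S v ≡ true → Q′ (S ∖ v)) → Q′ S
    go S h = step S (λ v Sv → proj₁ (h v Sv)) (λ v u Sv Su → proj₂ (h v Sv) u Su) , λ v Sv → proj₁ (h v Sv)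

open Cardinality using (ιℕ; size; element?; subset-induction; subset-induction₂)

module Segments {n : ℕ} where

  infixl 20 _∖∖_
  _∖∖_ : Sub n → List (Fin n) → Sub n
  S ∖∖ []      = S
  S ∖∖ (a ∷ l) = S ∖ a ∖∖ l

  ∖∖-cong : ∀ {S T} l → S ≗ T → S ∖∖ l ≗ T ∖∖ l
  ∖∖-cong []      p = p
  ∖∖-cong (a ∷ l) p = ∖∖-cong l (∖-cong a p)

  ∖∖-last : ∀ S l z → S ∖∖ (l ++ [ z ]) ≗ S ∖ z ∖∖ l
  ∖∖-last S []      z i = ≡.refl
  ∖∖-last S (a ∷ l) z i = ≡.trans (∖∖-last (S ∖ a) l z i) (∖∖-cong l (∖-comm S a z) i)

  -- An induced path of G inside S all of whose edges leaving it within S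
  -- end before its first vertex.
  Segment : Graph n → Sub n → List (Fin n) → Set
  Segment G S []      = ⊤
  Segment G S (a ∷ l) = S a ≡ true × (∀ u → G a u ≡ true → (S ∖ a) u ≡ true → ∃ λ l′ → l ≡ u ∷ l′)
    × (∀ b l′ → l ≡ b ∷ l′ → G a b ≡ true × (S ∖ a) b ≡ true) × Segment G (S ∖ a) l

  Segment-cong : ∀ {G S T} l → S ≗ T → Segment G S l → Segment G T l
  Segment-cong [] p _ = tt
  Segment-cong (a ∷ l) p (Sa , only , next , rest) =
    ≡.trans (≡.sym (p a)) Sa , (λ u g t → only u g (≡.trans (∖-cong a p u) t)) ,
    (λ b l′ e → proj₁ (next b l′ e) , ≡.trans (≡.sym (∖-cong a p b)) (proj₂ (next b l′ e))) ,
    Segment-cong l (∖-cong a p) rest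

  Segment-∈ : ∀ {G S} l z → Segment G S (l ++ [ z ]) → S z ≡ true
  Segment-∈ [] z (Sz , _) = Sz
  Segment-∈ {S = S} (a ∷ l) z (_ , _ , _ , rest) = ∖-⊆ S (Segment-∈ l z rest)

  -- Once `z` is taken out of the set as well, the vertex before it has no continuation left, so the
  -- shortened list is again a segment.
  Segment-init : ∀ {G S} l z → Segment G S (l ++ [ z ]) → Segment G (S ∖ z) l
  Segment-init [] z _ = tt
  Segment-init {G} {S} (a ∷ l) z (Sa , only , next , rest) =
    ∖-in S Sa a≢z , only′ , next′ , Segment-cong l (∖-comm S a z) (Segment-init l z rest)
    where
    z∈ : (S ∖ a) z ≡ true
    z∈ = Segment-∈ l z rest
    a≢z : a ≢ z
    a≢z ≡.refl = true≢false z∈ (∖-self S a)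
    head-of : ∀ l {u l′} → u ≢ z → l ++ [ z ] ≡ u ∷ l′ → ∃ λ l″ → l ≡ u ∷ l″
    head-of []       u≢z ≡.refl = ⊥-elim (u≢z ≡.refl)
    head-of (b ∷ l)  u≢z ≡.refl = l , ≡.refl
    only′ : ∀ u → G a u ≡ true → (S ∖ z ∖ a) u ≡ true → ∃ λ l′ → l ≡ u ∷ l′
    only′ u g t = head-of l (∖-≢ S (∖-⊆ (S ∖ z) t))
      (proj₂ (only u g (∖-in S (∖-⊆ S (∖-⊆ (S ∖ z) t)) (∖-≢ (S ∖ z) t))))
    next′ : ∀ b l′ → l ≡ b ∷ l′ → G a b ≡ true × (S ∖ z ∖ a) b ≡ true
    next′ b l′ ≡.refl with next b (l′ ++ [ z ]) ≡.refl
    ... | g , t = g , ∖-in (S ∖ z) (∖-in S (∖-⊆ S t) b≢z) (∖-≢ S t)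
      where
      b≢z : b ≢ z
      b≢z ≡.refl = true≢false (Segment-∈ l′ z (proj₂ (proj₂ (proj₂ rest)))) (∖-self (S ∖ a) z)

-- Weighted matching sums of a graph.

module WeightedMatchings {c ℓ} (R : CommutativeRing c ℓ) (α β : CommutativeRing.Carrier R) {n : ℕ} where
  open CommutativeRing R hiding (zero)
  open import Algebra.Properties.Semiring.Sum semiring public
  open SumLemmas +-commutativeMonoid public
  open FunctionSums R public
  open DifferenceSolver R
  open Segments {n} public
  open import Relation.Binary.Reasoning.Setoid setoid

  edge : Carrier
  edge = α * β

  -- A transposition uses one entry above the diagonal and one below. Weighting these by `α` and `β`
  -- gives a matched pair the weight `edge` without asking `edge` to be a square.
  matrix : Graph n → (Fin n → Carrier) → Fin n → Fin n → Carrier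
  matrix G w i j = if i ==F j then w i else ι (G i j) * (if toℕ i ℕ.<ᵇ toℕ j then α else β)

  P : Graph n → (Fin n → Carrier) → Sub n → Carrier
  P G w = Matchings.matchingSum R (matrix G w)

  P-cong : ∀ G w {S T} → S ≗ T → P G w S ≈ P G w T
  P-cong G w = Matchings.matchingSum-cong R (matrix G w)

  P-empty : ∀ G w {S} → (∀ i → S i ≡ false) → P G w S ≈ 1#
  P-empty G w = Matchings.matchingSum-empty R (matrix G w) _

  <ᵇ-irrefl-swap : ∀ a b → a ≢ b → (b ℕ.<ᵇ a) ≡ not (a ℕ.<ᵇ b)
  <ᵇ-irrefl-swap zero    zero    p = ⊥-elim (p ≡.refl)
  <ᵇ-irrefl-swap zero    (suc b) p = ≡.refl
  <ᵇ-irrefl-swap (suc a) zero    p = ≡.refl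
  <ᵇ-irrefl-swap (suc a) (suc b) p = <ᵇ-irrefl-swap a b (p ∘ ≡.cong suc)

  Symmetric : Graph n → Set
  Symmetric G = ∀ i j → G i j ≡ G j i

  matrix-diagonal : ∀ G w v → matrix G w v v ≈ w v
  matrix-diagonal G w v rewrite ==F-refl v = refl

  matrix-edge : ∀ {G w} → Symmetric G → ∀ {v u} → u ≢ v → matrix G w v u * matrix G w u v ≈ ι (G v u) * edge
  matrix-edge {G} {w} sym-G {v} {u} u≢v
    rewrite ≢⇒==F u≢v | ≢⇒==F (u≢v ∘ ≡.sym) | sym-G u v
          | <ᵇ-irrefl-swap (toℕ v) (toℕ u) (u≢v ∘ ≡.sym ∘ Fin.toℕ-injective)
    = pair (G v u) (toℕ v ℕ.<ᵇ toℕ u)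
    where
    pair : ∀ b t → ι b * (if t then α else β) * (ι b * (if not t then α else β)) ≈ ι b * edge
    pair false t = trans (*-congʳ (zeroˡ _)) (trans (zeroˡ _) (sym (zeroˡ _)))
    pair true true = trans (*-cong (*-identityˡ _) (*-identityˡ _)) (sym (*-identityˡ _))
    pair true false = trans (*-cong (*-identityˡ _) (*-identityˡ _)) (trans (*-comm β α) (sym (*-identityˡ _)))

  P-expand : ∀ {G} w → Symmetric G → ∀ {S} v → S v ≡ true →
    P G w S ≈ w v * P G w (S ∖ v) + ∑[ u < n ] (ι (G v u ∧ (S ∖ v) u) * (edge * P G w (S ∖ v ∖ u)))
  P-expand {G} w sym-G {S} v Sv = trans (Matchings.matchingSum-expand R (matrix G w) S v Sv)
    (+-cong (*-congʳ (matrix-diagonal G w v)) (sum-cong-≋ {n} (λ u → term u ((S ∖ v) u) ≡.refl)))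
    where
    term : ∀ u b → (S ∖ v) u ≡ b → ι b * (matrix G w v u * matrix G w u v * P G w (S ∖ v ∖ u))
             ≈ ι (G v u ∧ b) * (edge * P G w (S ∖ v ∖ u))
    term u false e = trans (zeroˡ _) (sym (ι-false (Bool.∧-zeroʳ (G v u))))
    term u true  e = trans (*-identityˡ _) (trans (*-congʳ (matrix-edge sym-G (∖-≢ S e)))
      (trans (*-assoc _ _ _) (reflexive (≡.cong (λ b → ι b * (edge * P G w (S ∖ v ∖ u))) (≡.sym (Bool.∧-identityʳ (G v u)))))))

  -- Both sides obey the same vertex recurrence, so induction on `S` replaces a bijection between
  -- matchings. The matrix depends on the order of the labels, but the recurrence sees only `edge`.
  relabel : ∀ {G G′ w w′} → Symmetric G → Symmetric G′ → (σ : Permutation′ n) → ∀ S S′ →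
    (∀ i → S′ (σ ⟨$⟩ʳ i) ≡ S i) → (∀ i → S i ≡ true → w′ (σ ⟨$⟩ʳ i) ≈ w i) →
    (∀ i j → S i ≡ true → S j ≡ true → G′ (σ ⟨$⟩ʳ i) (σ ⟨$⟩ʳ j) ≡ G i j) →
    P G′ w′ S′ ≈ P G w S
  relabel {G} {G′} {w} {w′} symG symG′ σ = subset-induction₂ Q resp step
    where
    Q : Sub n → Set _
    Q S = ∀ S′ → (∀ i → S′ (σ ⟨$⟩ʳ i) ≡ S i) → (∀ i → S i ≡ true → w′ (σ ⟨$⟩ʳ i) ≈ w i) →
      (∀ i j → S i ≡ true → S j ≡ true → G′ (σ ⟨$⟩ʳ i) (σ ⟨$⟩ʳ j) ≡ G i j) → P G′ w′ S′ ≈ P G w S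
    resp : ∀ {S T} → S ≗ T → Q S → Q T
    resp p q S′ hS hw hG = trans (q S′ (λ i → ≡.trans (hS i) (≡.sym (p i)))
      (λ i Si → hw i (≡.trans (≡.sym (p i)) Si))
      (λ i j Si Sj → hG i j (≡.trans (≡.sym (p i)) Si) (≡.trans (≡.sym (p j)) Sj))) (P-cong G w p)
    σ-==F : ∀ u v → ((σ ⟨$⟩ʳ u) ==F (σ ⟨$⟩ʳ v)) ≡ (u ==F v)
    σ-==F u v = ≡-bool (λ e → ≡⇒==F (≡.trans (≡.sym (Perm.inverseˡ σ))
      (≡.trans (≡.cong (Perm._⟨$⟩ˡ_ σ) (==F⇒≡ e)) (Perm.inverseˡ σ)))) (λ e → ≡⇒==F (≡.cong (σ ⟨$⟩ʳ_) (==F⇒≡ e)))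
    removed : ∀ (S S′ : Sub n) v → (∀ i → S′ (σ ⟨$⟩ʳ i) ≡ S i) → ∀ i → (S′ ∖ (σ ⟨$⟩ʳ v)) (σ ⟨$⟩ʳ i) ≡ (S ∖ v) i
    removed S S′ v h i = ≡.cong₂ (λ a b → not a ∧ b) (σ-==F i v) (h i)
    step : ∀ S → (∀ v → S v ≡ true → Q (S ∖ v)) → (∀ v u → S v ≡ true → (S ∖ v) u ≡ true → Q (S ∖ v ∖ u)) → Q S
    step S ih₁ ih₂ S′ hS hw hG with element? S
    ... | inj₂ none = trans (P-empty G′ w′ (λ i → ≡.trans (≡.cong S′ (≡.sym (Perm.inverseʳ σ)))
                        (≡.trans (hS (σ Perm.⟨$⟩ˡ i)) (none _)))) (sym (P-empty G w none))
    ... | inj₁ (v , Sv) = begin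
      P G′ w′ S′
        ≈⟨ P-expand w′ symG′ v′ (≡.trans (hS v) Sv) ⟩
      w′ v′ * P G′ w′ (S′ ∖ v′) + ∑[ u < n ] (ι (G′ v′ u ∧ (S′ ∖ v′) u) * (edge * P G′ w′ (S′ ∖ v′ ∖ u)))
        ≈⟨ +-cong (*-cong (hw v Sv) (ih₁ v Sv (S′ ∖ v′) (removed S S′ v hS)
             (λ i p → hw i (∖-⊆ S p)) (λ i j p q → hG i j (∖-⊆ S p) (∖-⊆ S q))))
             (sum-permute {n} {n} (λ u → ι (G′ v′ u ∧ (S′ ∖ v′) u) * (edge * P G′ w′ (S′ ∖ v′ ∖ u))) σ) ⟩
      w v * P G w (S ∖ v) + ∑[ u < n ] (ι (G′ v′ (σ ⟨$⟩ʳ u) ∧ (S′ ∖ v′) (σ ⟨$⟩ʳ u)) * (edge * P G′ w′ (S′ ∖ v′ ∖ (σ ⟨$⟩ʳ u))))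
        ≈⟨ +-congˡ (sum-cong-≋ {n} (λ u → term u ((S ∖ v) u) ≡.refl)) ⟩
      w v * P G w (S ∖ v) + ∑[ u < n ] (ι (G v u ∧ (S ∖ v) u) * (edge * P G w (S ∖ v ∖ u)))
        ≈⟨ P-expand w symG v Sv ⟨
      P G w S ∎
      where
      v′ : Fin n
      v′ = σ ⟨$⟩ʳ v
      term : ∀ u b → (S ∖ v) u ≡ b →
        ι (G′ v′ (σ ⟨$⟩ʳ u) ∧ (S′ ∖ v′) (σ ⟨$⟩ʳ u)) * (edge * P G′ w′ (S′ ∖ v′ ∖ (σ ⟨$⟩ʳ u)))
          ≈ ι (G v u ∧ b) * (edge * P G w (S ∖ v ∖ u))
      term u false e = trans (ι-false (≡.trans (≡.cong (G′ v′ (σ ⟨$⟩ʳ u) ∧_) (≡.trans (removed S S′ v hS u) e)) (Bool.∧-zeroʳ _)))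
        (sym (ι-false (Bool.∧-zeroʳ (G v u))))
      term u true  e = ι-cong (≡.cong₂ _∧_ (hG v u Sv (∖-⊆ S e)) (≡.trans (removed S S′ v hS u) e))
        (λ _ → *-congˡ (ih₂ v u Sv e (S′ ∖ v′ ∖ (σ ⟨$⟩ʳ u)) (removed (S ∖ v) (S′ ∖ v′) u (removed S S′ v hS))
          (λ i p → hw i (∖-⊆ S (∖-⊆ (S ∖ v) p)))
          (λ i j p q → hG i j (∖-⊆ S (∖-⊆ (S ∖ v) p)) (∖-⊆ S (∖-⊆ (S ∖ v) q)))))

  P-agree : ∀ {G G′ w w′} → Symmetric G → Symmetric G′ → ∀ S →
    (∀ i → S i ≡ true → w′ i ≈ w i) → (∀ i j → S i ≡ true → S j ≡ true → G′ i j ≡ G i j) →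
    P G′ w′ S ≈ P G w S
  P-agree symG symG′ S hw hG = relabel symG symG′ Perm.id S S (λ _ → ≡.refl) hw hG

  -- The contribution of making a vertex adjacent to one more neighbour: f is
  -- the sum without the vertex, g the sum without the vertex and the neighbour.
  module Peel (s : Carrier) where
    gain : Carrier → Carrier → Carrier
    gain f g = s * f + edge * g

    -- The expansion at `v` is linear in the weight and in the neighbours of `v`, and the remaining
    -- sums do not see `v`; hence the neighbours in `B` split off. Their own weights stay as they
    -- are, so `w′` need not be the Laplacian weight of `G′`.
    peel : ∀ {G G′ w w′} → Symmetric G → Symmetric G′ → ∀ v (B : Sub n) →
      (∀ i j → i ≢ v → j ≢ v → G i j ≡ G′ i j) → (∀ i → i ≢ v → w i ≈ w′ i) →
      (∀ u → G v u ≡ G′ v u ∨ B u) → (∀ u → B u ≡ true → G′ v u ≡ false) →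
      w v ≈ w′ v + ∑[ u < n ] (ι (B u) * s) →
      ∀ S → S v ≡ true → (∀ u → B u ≡ true → (S ∖ v) u ≡ true) →
      P G w S ≈ P G′ w′ S + ∑[ u < n ] (ι (B u) * gain (P G′ w′ (S ∖ v)) (P G′ w′ (S ∖ v ∖ u)))
    peel {G} {G′} {w} {w′} symG symG′ v B hG hw hB disjoint weight S Sv B⊆S = begin
      P G w S
        ≈⟨ P-expand w symG v Sv ⟩
      w v * P G w (S ∖ v) + ∑[ u < n ] (ι (G v u ∧ (S ∖ v) u) * (edge * P G w (S ∖ v ∖ u)))
        ≈⟨ +-cong (*-cong weight (agree (S ∖ v) (∖-≢ S)))
             (sum-cong-≋ {n} (λ u → *-congˡ (*-congˡ (agree (S ∖ v ∖ u) (∖-≢ S ∘ ∖-⊆ (S ∖ v)))))) ⟩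
      (w′ v + ∑[ u < n ] (ι (B u) * s)) * p + ∑[ u < n ] (ι (G v u ∧ (S ∖ v) u) * (edge * q u))
        ≈⟨ +-cong (distribʳ _ _ _) (trans (sum-cong-≋ {n} split) (∑-distrib-+ {n} _ _)) ⟩
      (w′ v * p + ∑[ u < n ] (ι (B u) * s) * p)
        + (∑[ u < n ] (ι (G′ v u ∧ (S ∖ v) u) * (edge * q u)) + ∑[ u < n ] (ι (B u) * (edge * q u)))
        ≈⟨ solve 4 (λ a b c d → (a :+ b) :+ (c :+ d) := (a :+ c) :+ (b :+ d)) refl _ _ _ _ ⟩
      (w′ v * p + ∑[ u < n ] (ι (G′ v u ∧ (S ∖ v) u) * (edge * q u)))
        + (∑[ u < n ] (ι (B u) * s) * p + ∑[ u < n ] (ι (B u) * (edge * q u)))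
        ≈⟨ +-cong (sym (P-expand w′ symG′ v Sv)) (begin
             ∑[ u < n ] (ι (B u) * s) * p + ∑[ u < n ] (ι (B u) * (edge * q u))
               ≈⟨ +-congʳ (*-distribʳ-sum {n} p _) ⟩
             ∑[ u < n ] (ι (B u) * s * p) + ∑[ u < n ] (ι (B u) * (edge * q u))
               ≈⟨ ∑-distrib-+ {n} _ _ ⟨
             ∑[ u < n ] (ι (B u) * s * p + ι (B u) * (edge * q u))
               ≈⟨ sum-cong-≋ {n} (λ u → trans (+-congʳ (*-assoc _ _ _)) (sym (distribˡ _ _ _))) ⟩
             ∑[ u < n ] (ι (B u) * gain p (q u)) ∎) ⟩
      P G′ w′ S + ∑[ u < n ] (ι (B u) * gain p (q u)) ∎
      where
      p = P G′ w′ (S ∖ v)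
      q = λ u → P G′ w′ (S ∖ v ∖ u)
      agree : ∀ T → (∀ {i} → T i ≡ true → i ≢ v) → P G w T ≈ P G′ w′ T
      agree T h = P-agree symG′ symG T (λ i Ti → hw i (h Ti)) (λ i j Ti Tj → hG i j (h Ti) (h Tj))
      split : ∀ u → ι (G v u ∧ (S ∖ v) u) * (edge * q u)
                  ≈ ι (G′ v u ∧ (S ∖ v) u) * (edge * q u) + ι (B u) * (edge * q u)
      split u = cases (B u) ≡.refl
        where
        cases : ∀ b → B u ≡ b → ι (G v u ∧ (S ∖ v) u) * (edge * q u)
                  ≈ ι (G′ v u ∧ (S ∖ v) u) * (edge * q u) + ι b * (edge * q u)
        cases false e = trans (reflexive (≡.cong (λ b → ι (b ∧ (S ∖ v) u) * (edge * q u))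
            (≡.trans (hB u) (≡.trans (≡.cong (G′ v u ∨_) e) (Bool.∨-identityʳ _)))))
          (sym (trans (+-congˡ (zeroˡ _)) (+-identityʳ _)))
        cases true e = trans (ι-true (∧-true (≡.trans (hB u) (∨-true₂ {G′ v u} e)) (B⊆S u e)))
          (sym (trans (+-cong (ι-false (≡.cong (_∧ (S ∖ v) u) (disjoint u e))) (*-identityˡ _)) (+-identityˡ _)))

  expand-pendant : ∀ {G} w → Symmetric G → ∀ S v b → S v ≡ true → G v b ≡ true → (S ∖ v) b ≡ true →
    (∀ u → G v u ≡ true → (S ∖ v) u ≡ true → u ≡ b) →
    P G w S ≈ w v * P G w (S ∖ v) + edge * P G w (S ∖ v ∖ b)
  expand-pendant {G} w symG S v b Sv Gvb Sb only = trans (P-expand w symG v Sv)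
    (+-congˡ (trans (sum-single {n} b (λ u u≢b → ι-false (≢true⇒≡false (λ e → u≢b
      (only u (∧-trueˡ e) (∧-trueʳ {G v u} e)))))) (ι-true (∧-true Gvb Sb))))

  expand-isolated : ∀ {G} w → Symmetric G → ∀ S v → S v ≡ true →
    (∀ u → G v u ≡ true → ¬ ((S ∖ v) u ≡ true)) → P G w S ≈ w v * P G w (S ∖ v)
  expand-isolated {G} w symG S v Sv none = trans (P-expand w symG v Sv)
    (trans (+-congˡ (sum-zero {n} (λ u → ι-false (≢true⇒≡false (λ e →
      none u (∧-trueˡ e) (∧-trueʳ {G v u} e)))))) (+-identityʳ _))

  segment-start : ∀ {G} w → Symmetric G → ∀ {S a b} l → Segment G S (a ∷ b ∷ l) →
    P G w S ≈ w a * P G w (S ∖ a) + edge * P G w (S ∖ a ∖ b)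
  segment-start w symG {S} {a} {b} l (Sa , only , next , _) = expand-pendant w symG S a b Sa
    (proj₁ (next b l ≡.refl)) (proj₂ (next b l ≡.refl)) (λ u g t → head-≡ (proj₂ (only u g t)))
    where
    head-≡ : ∀ {u l′} → b ∷ l ≡ u ∷ l′ → u ≡ b
    head-≡ ≡.refl = ≡.refl

  segment-end : ∀ {G} w → Symmetric G → ∀ {S a} → Segment G S (a ∷ []) → P G w S ≈ w a * P G w (S ∖ a)
  segment-end w symG {S} {a} (Sa , only , _) = expand-isolated w symG S a Sa (λ u g t → nil (proj₂ (only u g t)))
    where
    nil : ∀ {u l′} → ¬ (_≡_ {A = List (Fin n)} [] (u ∷ l′))
    nil ()

  -- Both sides satisfy the same two-term recurrence in the length.
  segment-length : ∀ {G} w → Symmetric G → ∀ ω l l′ {S S′} → (∀ {a} → a ∈ l → w a ≈ ω) → (∀ {a} → a ∈ l′ → w a ≈ ω) →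
    length l ≡ length l′ → Segment G S l → Segment G S′ l′ → S ∖∖ l ≗ S′ ∖∖ l′ → P G w S ≈ P G w S′
  segment-length {G} w symG ω [] [] _ _ _ _ _ p = P-cong G w p
  segment-length {G} w symG ω (a ∷ []) (a′ ∷ []) h h′ _ g g′ p = trans (segment-end w symG g)
    (trans (*-cong (trans (h (here ≡.refl)) (sym (h′ (here ≡.refl)))) (P-cong G w p)) (sym (segment-end {G} w symG g′)))
  segment-length {G} w symG ω (a ∷ b ∷ l) (a′ ∷ b′ ∷ l′) h h′ e g g′ p = trans (segment-start w symG l g)
    (trans (+-cong
      (*-cong (trans (h (here ≡.refl)) (sym (h′ (here ≡.refl))))
        (segment-length w symG ω (b ∷ l) (b′ ∷ l′) (h ∘ there) (h′ ∘ there) (ℕ.suc-injective e)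
          (proj₂ (proj₂ (proj₂ g))) (proj₂ (proj₂ (proj₂ g′))) p))
      (*-congˡ (segment-length w symG ω l l′ (h ∘ there ∘ there) (h′ ∘ there ∘ there)
        (ℕ.suc-injective (ℕ.suc-injective e)) (proj₂ (proj₂ (proj₂ (proj₂ (proj₂ (proj₂ g))))))
        (proj₂ (proj₂ (proj₂ (proj₂ (proj₂ (proj₂ g′)))))) p)))
    (sym (segment-start w symG l′ g′)))

-- Positivity of matching sums on proper vertex subsets.

-- The combinatorial argument adds and multiplies nonnegative quantities and otherwise uses ring
-- identities only, so any predicate with these closure properties will do. The instances are the
-- nonnegative rationals and cones of power series built on them.
record Cone {c ℓ} (R : CommutativeRing c ℓ) (p : Level) : Set (c ⊔ ℓ ⊔ lsuc p) where
  open CommutativeRing R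
  field
    Pos      : Carrier → Set p
    Pos-resp : ∀ {a b} → a ≈ b → Pos a → Pos b
    Pos-0    : Pos 0#
    Pos-1    : Pos 1#
    Pos-+    : ∀ {a b} → Pos a → Pos b → Pos (a + b)
    Pos-*    : ∀ {a b} → Pos a → Pos b → Pos (a * b)

module Boundary {n : ℕ} (G : Graph n) where
  boundary : ∀ (S : Sub n) {a p} → Star (λ u v → G u v ≡ true) a p → S a ≡ true → S p ≡ false →
    ∃₂ λ v q → S v ≡ true × S q ≡ false × G v q ≡ true
  boundary S ε Sa Sp = true≢false Sa Sp
  boundary S {a} (_◅_ {j = b} g walk) Sa Sp = go (S b) ≡.refl
    where
    go : ∀ x → S b ≡ x → ∃₂ λ v q → S v ≡ true × S q ≡ false × G v q ≡ true
    go false e = a , b , Sa , e , g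
    go true  e = boundary S walk e Sp

-- The weight of a vertex v of degree d is y + 1 - s + d s, and each matched edge
-- contributes α β = s (u - 1).
record Variables {c ℓ p} {R : CommutativeRing c ℓ} (cone : Cone R p) : Set (c ⊔ ℓ ⊔ p) where
  open CommutativeRing R
  open Cone cone
  field
    α β y# s# u# : Carrier
    edge≈ : α * β ≈ s# * u# - s#
    Pos-y : Pos y#
    Pos-s : Pos s#
    Pos-u : Pos u#

module Laplacian {c ℓ p} {R : CommutativeRing c ℓ} {cone : Cone R p} (vars : Variables cone) {n : ℕ} where
  open CommutativeRing R hiding (zero)
  open Variables vars
  open WeightedMatchings R α β {n}
  open Cardinality using (ιℕ; size)
  open import Algebra.Properties.Semiring.Mult semiring using (×-homo-+) renaming (_×_ to _∙_)

  κ : Carrier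
  κ = y# + 1# - s#

  degreeWeight : ℕ → Carrier
  degreeWeight d = κ + d ∙ s#

  laplacian : Graph n → Fin n → Carrier
  laplacian G v = degreeWeight (size (G v))

  sum-ι-size : ∀ {m} (B : Sub m) → sum (λ i → ι (B i) * s#) ≈ size B ∙ s#
  sum-ι-size {zero}  B = refl
  sum-ι-size {suc m} B = trans (+-cong (head (B zero)) (sum-ι-size (B ∘ suc))) (sym (×-homo-+ s# (ιℕ (B zero)) _))
    where
    head : ∀ b → ι b * s# ≈ ιℕ b ∙ s#
    head true  = trans (*-identityˡ _) (sym (+-identityʳ _))
    head false = zeroˡ _

  degreeWeight-+ : ∀ d B → degreeWeight (d ℕ.+ size B) ≈ degreeWeight d + ∑[ u < n ] (ι (B u) * s#)
  degreeWeight-+ d B = trans (+-congˡ (×-homo-+ s# d (size B)))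
    (trans (sym (+-assoc _ _ _)) (+-congˡ (sym (sum-ι-size B))))

  full : Sub n
  full _ = true

module Positivity {c ℓ p} {R : CommutativeRing c ℓ} {cone : Cone R p} (vars : Variables cone)
  {n : ℕ} (G : Graph n) (symG : ∀ i j → G i j ≡ G j i) (connected : Connected G) where

  open CommutativeRing R hiding (zero)
  open Cone cone
  open Variables vars renaming (y# to y; s# to s; u# to u)
  open Laplacian vars {n}
  open WeightedMatchings R α β {n}
  open DifferenceSolver R
  open import Relation.Binary.Reasoning.Setoid setoid
  open Boundary G

  w : Fin n → Carrier
  w = laplacian G

  w≈ : ∀ v → w v ≈ y + 1# - s + ∑[ i < n ] (ι (G v i) * s)
  w≈ v = +-congˡ (sym (sum-ι-size (G v)))

  Q : Sub n → Carrier
  Q = P G w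

  Q-cong : ∀ {S T} → S ≗ T → Q S ≈ Q T
  Q-cong = P-cong G w

  Δ : Sub n → Fin n → Carrier
  Δ S v = Q S - Q (S ∖ v)

  Δ-cong : ∀ {S T} v → S ≗ T → Δ S v ≈ Δ T v
  Δ-cong v p = +-cong (Q-cong p) (-‿cong (Q-cong (∖-cong v p)))

  Pos-sum : ∀ {m} {f : Fin m → Carrier} → (∀ i → Pos (f i)) → Pos (sum f)
  Pos-sum {zero}  h = Pos-0
  Pos-sum {suc m} h = Pos-+ (h zero) (Pos-sum (h ∘ suc))

  Pos-ι : ∀ b {x} → (b ≡ true → Pos x) → Pos (ι b * x)
  Pos-ι true  h = Pos-resp (sym (*-identityˡ _)) (h ≡.refl)
  Pos-ι false h = Pos-resp (sym (zeroˡ _)) Pos-0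

  sum-difference : ∀ {m} (f g : Fin m → Carrier) → sum f - sum g ≈ sum (λ i → f i - g i)
  sum-difference {zero}  f g = -‿inverseʳ _
  sum-difference {suc m} f g = trans (solve 4 (λ a b c d → (a :+ b) :- (c :+ d) := (a :- c) :+ (b :- d)) refl _ _ _ _)
    (+-congˡ (sum-difference (f ∘ suc) (g ∘ suc)))

  -- The share of a neighbour `i` of `v`. With `f` and `g` the sums without `v` and without both
  -- vertices, the degree term `s f` and, for `i` inside `S`, the matched edge `(s u - s) g` combine
  -- to `s ((f - g) + u g)`.
  growth : Sub n → Fin n → Fin n → Carrier
  growth S v i = if (S ∖ v) i then s * (Δ (S ∖ v) i + u * Q (S ∖ v ∖ i)) else s * Q (S ∖ v)

  -- The summand of an absent neighbour cancels the -s in the weight of v.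
  Δ-expand : ∀ S v q → S v ≡ true → S q ≡ false → G v q ≡ true →
    Δ S v ≈ y * Q (S ∖ v) + ∑[ i < n ] (ι ((G v ∖ q) i) * growth S v i)
  Δ-expand S v q Sv Sq Gvq = begin
    Q S - f
      ≈⟨ +-congʳ (P-expand w symG v Sv) ⟩
    w v * f + ∑[ i < n ] (ι (G v i ∧ (S ∖ v) i) * (edge * Q (S ∖ v ∖ i))) - f
      ≈⟨ +-congʳ (+-congʳ (trans (*-congʳ (w≈ v)) (trans (distribʳ _ _ _) (+-congˡ (*-distribʳ-sum {n} f _))))) ⟩
    (y + 1# - s) * f + ∑[ i < n ] (ι (G v i) * s * f) + ∑[ i < n ] (ι (G v i ∧ (S ∖ v) i) * (edge * Q (S ∖ v ∖ i))) - f
      ≈⟨ +-congʳ (trans (+-assoc _ _ _) (+-congˡ (trans (sym (∑-distrib-+ {n} _ _)) (sum-cong-≋ {n} (λ i → term i ((S ∖ v) i) ≡.refl))))) ⟩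
    (y + 1# - s) * f + ∑[ i < n ] (ι (G v i) * growth S v i) - f
      ≈⟨ +-congʳ (+-congˡ (sum-split {n} q (ι-false (∖-self (G v) q))
           (λ i i≢q → *-congʳ (reflexive (≡.cong ι (≡.sym (∖-other (G v) i≢q))))))) ⟩
    (y + 1# - s) * f + (ι (G v q) * growth S v q + rest) - f
      ≈⟨ +-congʳ (+-congˡ (+-congʳ (trans (ι-true Gvq) (reflexive (≡.cong (if_then s * (Δ (S ∖ v) q + u * Q (S ∖ v ∖ q)) else s * f) (∖-out S Sq)))))) ⟩
    (y + 1# - s) * f + (s * f + rest) - f
      ≈⟨ +-congˡ (-‿cong (sym (*-identityˡ f))) ⟩
    (y + 1# - s) * f + (s * f + rest) - 1# * f
      ≈⟨ solve 5 (λ y o s f r → (y :+ o :- s) :* f :+ (s :* f :+ r) :- o :* f := y :* f :+ r) refl y 1# s f rest ⟩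
    y * f + rest ∎
    where
    f = Q (S ∖ v)
    rest = ∑[ i < n ] (ι ((G v ∖ q) i) * growth S v i)
    term : ∀ i b → (S ∖ v) i ≡ b → ι (G v i) * s * f + ι (G v i ∧ b) * (edge * Q (S ∖ v ∖ i))
      ≈ ι (G v i) * (if b then s * (Δ (S ∖ v) i + u * Q (S ∖ v ∖ i)) else s * f)
    term i false e = trans (+-cong (*-assoc _ _ _) (ι-false (Bool.∧-zeroʳ (G v i)))) (+-identityʳ _)
    term i true  e = begin
      ι (G v i) * s * f + ι (G v i ∧ true) * (edge * g)
        ≈⟨ +-congˡ (*-cong (reflexive (≡.cong ι (Bool.∧-identityʳ (G v i)))) (*-congʳ edge≈)) ⟩
      ι (G v i) * s * f + ι (G v i) * ((s * u - s) * g)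
        ≈⟨ solve 5 (λ b s f u g → b :* s :* f :+ b :* ((s :* u :- s) :* g) := b :* (s :* ((f :- g) :+ u :* g))) refl _ s f u g ⟩
      ι (G v i) * (s * ((f - g) + u * g)) ∎
      where g = Q (S ∖ v ∖ i)

  Proper : Sub n → Set
  Proper S = ∃ λ q → S q ≡ false

  Positive : Sub n → Set _
  Positive S = Proper S → Pos (Q S) × (∀ v q → S v ≡ true → S q ≡ false → G v q ≡ true → Pos (Δ S v))

  -- The two claims feed each other. A removed vertex `v` is an outside neighbour of each of its
  -- neighbours `i`, so `Δ (S ∖ v) i` falls under the induction hypothesis. Conversely `Q S` is
  -- `Δ S v + Q (S ∖ v)`, where a walk that leaves `S` provides a suitable `v`.
  positive : ∀ S → Positive S
  positive = subset-induction₂ Positive resp step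
    where
    resp : ∀ {S T} → S ≗ T → Positive S → Positive T
    resp p h (q , Tq) with h (q , ≡.trans (p q) Tq)
    ... | a , b = Pos-resp (Q-cong p) a ,
      λ v q Tv Tq e → Pos-resp (Δ-cong v p) (b v q (≡.trans (p v) Tv) (≡.trans (p q) Tq) e)
    step : ∀ S → (∀ v → S v ≡ true → Positive (S ∖ v)) →
      (∀ v i → S v ≡ true → (S ∖ v) i ≡ true → Positive (S ∖ v ∖ i)) → Positive S
    step S ih₁ ih₂ (q₀ , Sq₀) = whole (element? S) , first
      where
      first : ∀ v q → S v ≡ true → S q ≡ false → G v q ≡ true → Pos (Δ S v)
      first v q Sv Sq Gvq = Pos-resp (sym (Δ-expand S v q Sv Sq Gvq))
        (Pos-+ (Pos-* Pos-y (proj₁ smaller))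
          (Pos-sum (λ i → Pos-ι _ (λ e → term i (∖-⊆ (G v) e) ((S ∖ v) i) ≡.refl))))
        where
        smaller = ih₁ v Sv (v , ∖-self S v)
        term : ∀ i → G v i ≡ true → ∀ b → (S ∖ v) i ≡ b →
          Pos (if b then s * (Δ (S ∖ v) i + u * Q (S ∖ v ∖ i)) else s * Q (S ∖ v))
        term i g false e = Pos-* Pos-s (proj₁ smaller)
        term i g true  e = Pos-* Pos-s (Pos-+ (proj₂ smaller i v e (∖-self S v) (≡.trans (symG i v) g))
          (Pos-* Pos-u (proj₁ (ih₂ v i Sv e (v , ∖-out (S ∖ v) (∖-self S v))))))
      whole : (∃ λ v → S v ≡ true) ⊎ (∀ v → S v ≡ false) → Pos (Q S)
      whole (inj₂ empty) = Pos-resp (sym (P-empty G w empty)) Pos-1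
      whole (inj₁ (a , Sa)) with boundary S (connected a q₀) Sa Sq₀
      ... | v , q , Sv , Sq , Gvq = Pos-resp (solve 2 (λ a b → ((a :- b) :+ b) := a) refl (Q S) (Q (S ∖ v)))
        (Pos-+ (first v q Sv Sq Gvq) (proj₁ (ih₁ v Sv (v , ∖-self S v))))

  Q-pos : ∀ S q → S q ≡ false → Pos (Q S)
  Q-pos S q e = proj₁ (positive S (q , e))

  Δ-pos : ∀ S v q → S v ≡ true → S q ≡ false → G v q ≡ true → Pos (Δ S v)
  Δ-pos S v q Sv Sq = proj₂ (positive S (q , Sq)) v q Sv Sq

  -- C marks the part of S that contains c and is not joined to d inside S.
  module _ (C : Fin n → Set) where

    Separated : Sub n → Set _
    Separated S = (∀ a b → S a ≡ true → S b ≡ true → C a → G a b ≡ true → C b) →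
      ∀ c q d q′ → S c ≡ true → C c → S q ≡ false → G c q ≡ true →
      S d ≡ true → ¬ C d → S q′ ≡ false → G d q′ ≡ true → Pos (Δ S c - Δ (S ∖ d) c)

    -- Both differences are expanded at `c`. The neighbours of `c` in `S` lie in `C`, hence differ
    -- from `d`, and they take over the role of `c` with `c` as their outside neighbour. What
    -- remains are first differences at `d`.
    second-difference-pos : ∀ S → Separated S
    second-difference-pos = subset-induction Separated step
      where
      step : ∀ S → (∀ v → S v ≡ true → Separated (S ∖ v)) → Separated S
      step S ih closed c q d q′ Sc Cc Sq Gcq Sd ¬Cd Sq′ Gdq′ = Pos-resp (sym (begin
        Δ S c - Δ (S ∖ d) c
          ≈⟨ +-cong (Δ-expand S c q Sc Sq Gcq) (-‿cong (Δ-expand (S ∖ d) c q (∖-in S Sc c≢d) (∖-out S Sq) Gcq)) ⟩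
        (y * Q (S ∖ c) + ∑[ i < n ] (ι ((G c ∖ q) i) * growth S c i))
          - (y * Q (S ∖ d ∖ c) + ∑[ i < n ] (ι ((G c ∖ q) i) * growth (S ∖ d) c i))
          ≈⟨ +-congˡ (-‿cong (+-congʳ (*-congˡ (Q-cong (∖-comm S d c))))) ⟩
        (y * Q (S ∖ c) + ∑[ i < n ] (ι ((G c ∖ q) i) * growth S c i))
          - (y * Q (S ∖ c ∖ d) + ∑[ i < n ] (ι ((G c ∖ q) i) * growth (S ∖ d) c i))
          ≈⟨ solve 5 (λ y a b x z → (y :* a :+ x) :- (y :* b :+ z) := y :* (a :- b) :+ (x :- z)) refl _ _ _ _ _ ⟩
        y * Δ (S ∖ c) d + (∑[ i < n ] (ι ((G c ∖ q) i) * growth S c i) - ∑[ i < n ] (ι ((G c ∖ q) i) * growth (S ∖ d) c i))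
          ≈⟨ +-congˡ (sum-difference {n} _ _) ⟩
        y * Δ (S ∖ c) d + ∑[ i < n ] (ι ((G c ∖ q) i) * growth S c i - ι ((G c ∖ q) i) * growth (S ∖ d) c i)
          ≈⟨ +-congˡ (sum-cong-≋ {n} (λ i → solve 3 (λ a b c → a :* b :- a :* c := a :* (b :- c)) refl _ _ _)) ⟩
        y * Δ (S ∖ c) d + ∑[ i < n ] (ι ((G c ∖ q) i) * (growth S c i - growth (S ∖ d) c i)) ∎))
        (Pos-+ (Pos-* Pos-y Δ-d) (Pos-sum (λ i → Pos-ι _ (λ e → term i (∖-⊆ (G c) e) ((S ∖ c) i) ≡.refl))))
        where
        c≢d : c ≢ d
        c≢d ≡.refl = ¬Cd Cc
        Δ-d : Pos (Δ (S ∖ c) d)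
        Δ-d = Δ-pos (S ∖ c) d q′ (∖-in S Sd (c≢d ∘ ≡.sym)) (∖-out S Sq′) Gdq′
        term : ∀ i → G c i ≡ true → ∀ b → (S ∖ c) i ≡ b →
          Pos ((if b then s * (Δ (S ∖ c) i + u * Q (S ∖ c ∖ i)) else s * Q (S ∖ c)) - growth (S ∖ d) c i)
        term i g false e = Pos-resp (begin
          s * Δ (S ∖ c) d
            ≈⟨ solve 3 (λ s a b → s :* (a :- b) := s :* a :- s :* b) refl s _ _ ⟩
          s * Q (S ∖ c) - s * Q (S ∖ c ∖ d)
            ≈⟨ +-congˡ (-‿cong (*-congˡ (Q-cong (∖-comm S c d)))) ⟩
          s * Q (S ∖ c) - s * Q (S ∖ d ∖ c)
            ≈⟨ +-congˡ (-‿cong (reflexive (≡.cong (if_then s * (Δ (S ∖ d ∖ c) i + u * Q (S ∖ d ∖ c ∖ i)) else s * Q (S ∖ d ∖ c))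
                 (≡.sym (≡.trans (∖-comm S d c i) (∖-out (S ∖ c) e)))))) ⟩
          s * Q (S ∖ c) - growth (S ∖ d) c i ∎)
          (Pos-* Pos-s Δ-d)
        term i g true e = Pos-resp (begin
          s * ((Δ (S ∖ c) i - Δ (S ∖ c ∖ d) i) + u * Δ (S ∖ c ∖ i) d)
            ≈⟨ solve 6 (λ s a b u f g → s :* ((a :- b) :+ u :* (f :- g)) := s :* (a :+ u :* f) :- s :* (b :+ u :* g)) refl s _ _ u _ _ ⟩
          s * (Δ (S ∖ c) i + u * Q (S ∖ c ∖ i)) - s * (Δ (S ∖ c ∖ d) i + u * Q (S ∖ c ∖ i ∖ d))
            ≈⟨ +-congˡ (-‿cong (*-congˡ (+-cong (Δ-cong i (∖-comm S c d))
                 (*-congˡ (Q-cong (λ j → ≡.trans (∖-comm (S ∖ c) i d j) (∖-cong i (∖-comm S c d) j))))))) ⟩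
          s * (Δ (S ∖ c) i + u * Q (S ∖ c ∖ i)) - s * (Δ (S ∖ d ∖ c) i + u * Q (S ∖ d ∖ c ∖ i))
            ≈⟨ +-congˡ (-‿cong (reflexive (≡.cong (if_then s * (Δ (S ∖ d ∖ c) i + u * Q (S ∖ d ∖ c ∖ i)) else s * Q (S ∖ d ∖ c))
                 (≡.sym (≡.trans (∖-comm S d c i) (∖-in (S ∖ c) e i≢d)))))) ⟩
          s * (Δ (S ∖ c) i + u * Q (S ∖ c ∖ i)) - growth (S ∖ d) c i ∎)
          (Pos-* Pos-s (Pos-+
            (ih c Sc (λ a b Ta Tb → closed a b (∖-⊆ S Ta) (∖-⊆ S Tb)) i c d q′ e Ci (∖-self S c)
              (≡.trans (symG i c) g) (∖-in S Sd (c≢d ∘ ≡.sym)) ¬Cd (∖-out S Sq′) Gdq′)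
            (Pos-* Pos-u (Δ-pos (S ∖ c ∖ i) d q′ (∖-in (S ∖ c) (∖-in S Sd (c≢d ∘ ≡.sym)) (i≢d ∘ ≡.sym))
              (∖-out (S ∖ c) (∖-out S Sq′)) Gdq′))))
          where
          Ci : C i
          Ci = closed c i Sc (∖-⊆ S e) Cc g
          i≢d : i ≢ d
          i≢d ≡.refl = ¬Cd Ci

-- Edge deletion, trees, and the shift as an operation on trees.

module EdgeRemoval {n : ℕ} where

  remove : Graph n → Fin n → Sub n → Graph n
  remove G v B i j = G i j ∧ not ((i ==F v ∧ B j) ∨ (j ==F v ∧ B i))

  remove-sym : ∀ {G} v B → (∀ i j → G i j ≡ G j i) → ∀ i j → remove G v B i j ≡ remove G v B j i
  remove-sym v B symG i j = ≡.cong₂ (λ a b → a ∧ not b) (symG i j) (Bool.∨-comm (i ==F v ∧ B j) _)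

  remove-⊆ : ∀ G v B {i j} → remove G v B i j ≡ true → G i j ≡ true
  remove-⊆ G v B = ∧-trueˡ

  remove-off : ∀ G v B {i j} → i ≢ v → j ≢ v → remove G v B i j ≡ G i j
  remove-off G v B {i} {j} i≢v j≢v rewrite ≢⇒==F i≢v | ≢⇒==F j≢v = Bool.∧-identityʳ (G i j)

  remove-keep : ∀ G v B {j} → j ≢ v → B j ≡ false → remove G v B v j ≡ G v j
  remove-keep G v B {j} j≢v Bj rewrite ≢⇒==F j≢v | Bj | ==F-refl v = Bool.∧-identityʳ (G v j)

  remove-gone : ∀ G v B {j} → B j ≡ true → remove G v B v j ≡ false
  remove-gone G v B {j} Bj rewrite Bj | ==F-refl v = Bool.∧-zeroʳ (G v j)

  remove-not : ∀ G v B {j} → remove G v B v j ≡ true → B j ≡ false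
  remove-not G v B {j} e = ≢true⇒≡false (λ Bj → true≢false e (remove-gone G v B Bj))

  remove-∨ : ∀ G v B → (∀ u → B u ≡ true → G v u ≡ true) → B v ≡ false → ∀ u → G v u ≡ remove G v B v u ∨ B u
  remove-∨ G v B B⊆ Bv u = ≡-bool to from
    where
    to : G v u ≡ true → remove G v B v u ∨ B u ≡ true
    to g = case (B u) ≡.refl
      where
      case : ∀ b → B u ≡ b → remove G v B v u ∨ b ≡ true
      case true  e = ∨-true₂ {remove G v B v u} ≡.refl
      case false e = ∨-true₁ (∧-true g (not-false (∨-false (≡.trans (≡.cong (u′ ∧_) e) (Bool.∧-zeroʳ u′))
        (≡.trans (≡.cong (u ==F v ∧_) Bv) (Bool.∧-zeroʳ _)))))
        where
        u′ = v ==F v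
        ∨-false : ∀ {a b} → a ≡ false → b ≡ false → a ∨ b ≡ false
        ∨-false ≡.refl ≡.refl = ≡.refl
    from : remove G v B v u ∨ B u ≡ true → G v u ≡ true
    from e with ∨-true {remove G v B v u} e
    ... | inj₁ r = remove-⊆ G v B r
    ... | inj₂ b = B⊆ u b

  shift-sym : ∀ {G : Graph n} → (∀ i j → G i j ≡ G j i) → ∀ x y z i j → Defs.shift G x y z i j ≡ Defs.shift G x y z j i
  shift-sym {G} symG x y z u v = swap ((u ==F y) ∧ moved v) ((v ==F y) ∧ moved u)
    ((u ==F x) ∧ moved v) ((v ==F x) ∧ moved u) (symG u v)
    where
    moved : Sub n
    moved w = G y w ∧ not (w ==F z)
    swap : ∀ a b p q {g h} → g ≡ h →
      (if a ∨ b then false else (p ∨ q ∨ g)) ≡ (if b ∨ a then false else (q ∨ p ∨ h))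
    swap true  true  p q _ = ≡.refl
    swap true  false p q _ = ≡.refl
    swap false true  p q _ = ≡.refl
    swap false false true true   ≡.refl = ≡.refl
    swap false false true false  ≡.refl = ≡.refl
    swap false false false true  ≡.refl = ≡.refl
    swap false false false false ≡.refl = ≡.refl

-- Ends ms f z: on a path x, ms, y the vertex after x is f and the one before y is z.
data Ends {n : ℕ} (x y : Fin n) : List (Fin n) → Fin n → Fin n → Set where
  direct  : Ends x y [] y x
  through : ∀ {a l l′ z} → a ∷ l ≡ l′ ++ [ z ] → Ends x y (a ∷ l) a z

module Counting where
  open import Data.Nat.Base using (_+_; _≤_)
  open Cardinality

  sum-mono : ∀ {n} {f g : Fin n → ℕ} → (∀ i → f i ≤ g i) → sum f ≤ sum g
  sum-mono {zero}  h = z≤n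
  sum-mono {suc n} h = ℕ.+-mono-≤ (h zero) (sum-mono (h ∘ suc))

  ιℕ-mono : ∀ {a b} → (a ≡ true → b ≡ true) → ιℕ a ≤ ιℕ b
  ιℕ-mono {false} h = z≤n
  ιℕ-mono {true}  h = ℕ.≤-reflexive (≡.cong ιℕ (≡.sym (h ≡.refl)))

  sum-point : ∀ {n} (a : Fin n) (f : Fin n → ℕ) → sum (λ i → if i ==F a then f i else 0) ≡ f a
  sum-point a f = ≡.trans (sum-single a (λ i i≢a → ≡.cong (if_then f i else 0) (≢⇒==F i≢a)))
    (≡.cong (if_then f a else 0) (==F-refl a))

  pair-count : ∀ {n} (a b : Fin n) → sum {n} (λ i → sum {n} (λ j → ιℕ ((i ==F a) ∧ (j ==F b)))) ≡ 1
  pair-count {n} a b = ≡.trans (sum-single {n} a (λ i i≢a → sum-zero {n} (λ j → ≡.cong (λ c → ιℕ (c ∧ (j ==F b))) (≢⇒==F i≢a))))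
    (≡.trans (sum-single {n} b (λ j j≢b → ≡.trans (≡.cong (λ c → ιℕ (c ∧ (j ==F b))) (==F-refl a)) (≡.cong ιℕ (≢⇒==F j≢b))))
      (≡.cong₂ (λ c d → ιℕ (c ∧ d)) (==F-refl a) (==F-refl b)))

  size-all : ∀ {n} (S : Sub n) → (∀ v → S v ≡ true) → size S ≡ n
  size-all {zero}  S h = ≡.refl
  size-all {suc n} S h = ≡.cong₂ _+_ (≡.cong ιℕ (h zero)) (size-all (S ∘ suc) (h ∘ suc))

  size-cong : ∀ {n} {S T : Sub n} → S ≗ T → size S ≡ size T
  size-cong p = sum-cong-≗ (≡.cong ιℕ ∘ p)

  listSum-tabulate : ∀ {n} {A : Set} (f : A → ℕ) (g : Fin n → A) → Defs.sum (map f (tabulate g)) ≡ sum (f ∘ g)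
  listSum-tabulate {zero}  f g = ≡.refl
  listSum-tabulate {suc n} f g = ≡.cong (f (g zero) +_) (listSum-tabulate f (g ∘ suc))

  countB-tabulate : ∀ {n} {A : Set} (p : A → Bool) (g : Fin n → A) → countB p (tabulate g) ≡ size (p ∘ g)
  countB-tabulate {zero}  p g = ≡.refl
  countB-tabulate {suc n} p g with p (g zero)
  ... | true  = ≡.cong suc (countB-tabulate p (g ∘ suc))
  ... | false = countB-tabulate p (g ∘ suc)

  deg-size : ∀ {n} (G : Graph n) v → deg G v ≡ size (G v)
  deg-size G v = countB-tabulate (G v) id

module Trees where
  open import Data.Nat.Base using (_+_; _*_; _∸_; _≤_; _<_; _<ᵇ_)
  open Cardinality
  open Counting
  open EdgeRemoval
  open import Algebra.Properties.CommutativeMonoid.Sum ℕ.+-0-commutativeMonoid using (∑-distrib-+; ∑-comm; sum-permute)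

  degreeSum : ∀ {n} → Graph n → ℕ
  degreeSum G = sum (λ v → size (G v))

  -- Edges are counted through the degree sum, which is visibly invariant under relabelling and easy
  -- to follow through a shift; `edgeCount` refers to the order of the vertices.
  record Tree {n : ℕ} (G : Graph n) : Set where
    field
      symmetric : ∀ i j → G i j ≡ G j i
      loopless  : ∀ i → G i i ≡ false
      connected : Connected G
      degrees   : degreeSum G ≡ 2 * (n ∸ 1)

  insert : ∀ {n} → Sub n → Fin n → Sub n
  insert S q i = (i ==F q) ∨ S i

  size-insert : ∀ {n} (S : Sub n) q → S q ≡ false → size (insert S q) ≡ suc (size S)
  size-insert S q Sq = ≡.trans (size-remove (insert S q) q (∨-true₁ (==F-refl q))) (≡.cong suc (size-cong same))
    where
    same : insert S q ∖ q ≗ S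
    same i = go (i Fin.≟ q)
      where
      go : Dec (i ≡ q) → (insert S q ∖ q) i ≡ S i
      go (yes ≡.refl) = ≡.trans (∖-self (insert S q) q) (≡.sym Sq)
      go (no i≢q)     = ≡.trans (∖-other (insert S q) i≢q) (≡.cong (_∨ S i) (≢⇒==F i≢q))

  module _ {n : ℕ} (G : Graph n) (symG : ∀ i j → G i j ≡ G j i) (connG : Connected G) where

    innerDegrees : Sub n → ℕ
    innerDegrees S = sum {n} (λ i → sum {n} (λ j → ιℕ (S i ∧ (S j ∧ G i j))))

    innerDegrees-insert : ∀ S v q → S v ≡ true → S q ≡ false → G v q ≡ true → 2 + innerDegrees S ≤ innerDegrees (insert S q)
    innerDegrees-insert S v q Sv Sq Gvq = ℕ.≤-trans (ℕ.≤-reflexive (≡.sym total)) (sum-mono {n} (λ i → sum-mono {n} (λ j → pointwise i j)))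
      where
      v≢q : v ≢ q
      v≢q ≡.refl = true≢false Sv Sq
      vq qv old term : Fin n → Fin n → ℕ
      vq i j = ιℕ ((i ==F v) ∧ (j ==F q))
      qv i j = ιℕ ((i ==F q) ∧ (j ==F v))
      old i j = ιℕ (S i ∧ (S j ∧ G i j))
      term i j = vq i j + (qv i j + old i j)
      total : sum {n} (λ i → sum {n} (λ j → term i j)) ≡ 2 + innerDegrees S
      total = ≡.trans (sum-cong-≗ {n} (λ i → ≡.trans (∑-distrib-+ {n} (vq i) (λ j → qv i j + old i j))
          (≡.cong (sum (vq i) +_) (∑-distrib-+ {n} (qv i) (old i)))))
        (≡.trans (∑-distrib-+ {n} (λ i → sum (vq i)) (λ i → sum (qv i) + sum (old i))) (≡.cong₂ _+_ (pair-count v q)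
          (≡.trans (∑-distrib-+ {n} (λ i → sum (qv i)) (λ i → sum (old i))) (≡.cong (_+ innerDegrees S) (pair-count q v)))))
      pointwise : ∀ i j → term i j ≤ ιℕ (insert S q i ∧ (insert S q j ∧ G i j))
      pointwise i j = go (i Fin.≟ q) (j Fin.≟ q)
        where
        go : Dec (i ≡ q) → Dec (j ≡ q) → term i j ≤ ιℕ (insert S q i ∧ (insert S q j ∧ G i j))
        go (yes ≡.refl) _ rewrite ≢⇒==F (v≢q ∘ ≡.sym) | Sq | ==F-refl i | ℕ.+-identityʳ (ιℕ (j ==F v)) = ιℕ-mono (λ e →
          ≡.subst (λ j → (insert S i j ∧ G i j) ≡ true) (≡.sym (==F⇒≡ e)) (∧-true (∨-true₂ {v ==F i} Sv) (≡.trans (symG i v) Gvq)))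
        go (no i≢q) (yes ≡.refl) rewrite ≢⇒==F i≢q | Sq | ==F-refl j | Bool.∧-zeroʳ (S i) | Bool.∧-identityʳ (i ==F v)
          | ℕ.+-identityʳ (ιℕ (i ==F v)) = ιℕ-mono (λ e → ≡.subst (λ i → (S i ∧ G i j) ≡ true) (≡.sym (==F⇒≡ e)) (∧-true Sv Gvq))
        go (no i≢q) (no j≢q) rewrite ≢⇒==F i≢q | ≢⇒==F j≢q | Bool.∧-zeroʳ (i ==F v) = ℕ.≤-refl

    -- A set grows from the vertex `zero` along edges that leave it. Each new vertex brings at least
    -- one edge, that is 2 in the inner degree sum; at `suc k = n` this is the lower bound for the
    -- edges of a connected graph.
    grow : ∀ k → k < n → ∃ λ S → size S ≡ suc k × 2 * k ≤ innerDegrees S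
    grow zero (s≤s _) = (λ i → i ==F zero) , sum-single {n} {λ i → ιℕ (i ==F zero)} zero (λ i i≢0 → ≡.cong ιℕ (≢⇒==F i≢0)) , z≤n
    grow (suc k) k<n with grow k (ℕ.<-trans (ℕ.n<1+n k) k<n)
    ... | S , sizeS , edges with element? S | element? (not ∘ S)
    ...   | inj₂ none | _ = ⊥-elim (ℕ.0≢1+n (≡.trans (≡.sym (sum-zero {n} (λ i → ≡.cong ιℕ (none i)))) sizeS))
    ...   | inj₁ _ | inj₂ all = ⊥-elim (ℕ.<-irrefl (≡.trans (≡.sym sizeS) (size-all S (λ v → Bool.not-injective (all v)))) k<n)
    ...   | inj₁ (a , Sa) | inj₁ (p , Sp) with Boundary.boundary G S (connG a p) Sa (not-true Sp)
    ...     | v , q , Sv , Sq , Gvq = insert S q , ≡.trans (size-insert S q Sq) (≡.cong suc sizeS) ,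
              ℕ.≤-trans (ℕ.≤-reflexive (ℕ.*-suc 2 k)) (ℕ.≤-trans (ℕ.+-monoʳ-≤ 2 edges) (innerDegrees-insert S v q Sv Sq Gvq))

    innerDegrees-≤ : ∀ S → innerDegrees S ≤ degreeSum G
    innerDegrees-≤ S = sum-mono {n} (λ i → sum-mono {n} (λ j → ιℕ-mono (λ e → ∧-trueʳ {S j} (∧-trueʳ {S i} e))))

    degreeSum-≥ : 2 * (n ∸ 1) ≤ degreeSum G
    degreeSum-≥ = go n ≡.refl
      where
      go : ∀ m → n ≡ m → 2 * (m ∸ 1) ≤ degreeSum G
      go zero    _ = z≤n
      go (suc m) e with grow m (≡.subst (m <_) (≡.sym e) (ℕ.n<1+n m))
      ... | S , _ , edges = ℕ.≤-trans edges (innerDegrees-≤ S)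

  Walk : ∀ {n} → Graph n → Fin n → Fin n → Set
  Walk G = Star (λ i j → G i j ≡ true)

  walk-reverse : ∀ {n} {G : Graph n} → (∀ i j → G i j ≡ G j i) → ∀ {i j} → Walk G i j → Walk G j i
  walk-reverse symG = reverse (λ {i} {j} e → ≡.trans (symG j i) e)

  cut : ∀ {n} → Graph n → Fin n → Fin n → Graph n
  cut G u v = remove G u (_==F v)

  -- Deleting a non-bridge would leave a connected graph with too few edges.
  bridge : ∀ {n} {G : Graph n} → Tree G → ∀ {u v} → G u v ≡ true → ¬ Walk (cut G u v) u v
  bridge {n} {G} tree {u} {v} Guv walk = ℕ.<-irrefl ≡.refl (ℕ.≤-trans fewer
    (ℕ.≤-trans (ℕ.≤-reflexive degrees) (degreeSum-≥ (cut G u v) sym-cut connected-cut)))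
    where
    open Tree tree
    sym-cut : ∀ i j → cut G u v i j ≡ cut G u v j i
    sym-cut = remove-sym u (_==F v) symmetric
    edge-walk : ∀ {i j} → G i j ≡ true → Walk (cut G u v) i j
    edge-walk {i} {j} g = go (cut G u v i j) ≡.refl
      where
      go : ∀ b → cut G u v i j ≡ b → Walk (cut G u v) i j
      go true  e = e ◅ ε
      go false e with ∨-true {(i ==F u) ∧ (j ==F v)} (Bool.not-injective (≡.trans (≡.cong (_∧ not _) (≡.sym g)) e))
      ... | inj₁ q with ≡.refl ← ==F⇒≡ {i = i} {u} (∧-trueˡ q) | ≡.refl ← ==F⇒≡ {i = j} {v} (∧-trueʳ {i ==F u} q) = walk
      ... | inj₂ q with ≡.refl ← ==F⇒≡ {i = j} {u} (∧-trueˡ q) | ≡.refl ← ==F⇒≡ {i = i} {v} (∧-trueʳ {j ==F u} q) = walk-reverse sym-cut walk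
    connected-cut : Connected (cut G u v)
    connected-cut i j = Star.concat (Star.map edge-walk (connected i j))
    fewer : suc (degreeSum (cut G u v)) ≤ degreeSum G
    fewer = ℕ.≤-trans (ℕ.≤-reflexive (≡.sym (≡.trans (sum-cong-≗ {n} (λ i → ∑-distrib-+ {n} _ _))
      (≡.trans (∑-distrib-+ {n} _ _) (≡.cong (_+ degreeSum (cut G u v)) (pair-count u v))))))
      (sum-mono {n} (λ i → sum-mono {n} (λ j → pointwise i j)))
      where
      pointwise : ∀ i j → ιℕ ((i ==F u) ∧ (j ==F v)) + ιℕ (cut G u v i j) ≤ ιℕ (G i j)
      pointwise i j = go ((i ==F u) ∧ (j ==F v)) ≡.refl
        where
        go : ∀ b → ((i ==F u) ∧ (j ==F v)) ≡ b → ιℕ b + ιℕ (cut G u v i j) ≤ ιℕ (G i j)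
        go false e = ιℕ-mono (remove-⊆ G u (_==F v))
        go true  e with ≡.refl ← ==F⇒≡ {i = i} {u} (∧-trueˡ e) | ≡.refl ← ==F⇒≡ {i = j} {v} (∧-trueʳ {i ==F u} e)
          = ≡.subst (λ k → 1 + ιℕ k ≤ ιℕ (G u v)) (≡.sym (remove-gone G u (_==F v) (==F-refl v))) (ℕ.≤-reflexive (≡.cong ιℕ (≡.sym Guv)))

  handshake : ∀ {n} (G : Graph n) → (∀ i j → G i j ≡ G j i) → (∀ i → G i i ≡ false) → degreeSum G ≡ 2 * edgeCount G
  handshake {n} G symG irrefl = begin
    degreeSum G
      ≡⟨ sum-cong-≗ {n} (λ i → ≡.trans (sum-cong-≗ {n} (λ j → split i j)) (∑-distrib-+ {n} _ _)) ⟩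
    sum (λ i → sum (λ j → ιℕ (below i j)) + sum (λ j → ιℕ (below j i)))
      ≡⟨ ∑-distrib-+ {n} _ _ ⟩
    sum (λ i → size (below i)) + sum (λ i → sum (λ j → ιℕ (below j i)))
      ≡⟨ ≡.cong (sum (λ i → size (below i)) +_) (∑-comm {n} {n} (λ i j → ιℕ (below j i))) ⟩
    sum (λ i → size (below i)) + sum (λ i → size (below i))
      ≡⟨ ≡.cong (sum (λ i → size (below i)) +_) (ℕ.+-identityʳ _) ⟨
    2 * sum (λ i → size (below i))
      ≡⟨ ≡.cong (2 *_) (≡.trans (listSum-tabulate (λ i → countB (below i) (allFin n)) id)
           (sum-cong-≗ {n} (λ i → countB-tabulate (below i) id))) ⟨
    2 * edgeCount G ∎
    where
    open ≡.≡-Reasoning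
    below : Fin n → Fin n → Bool
    below i j = G i j ∧ (toℕ i ℕ.<ᵇ toℕ j)
    total : ∀ a b → a ≢ b → ∀ g → ιℕ g ≡ ιℕ (g ∧ (a ℕ.<ᵇ b)) + ιℕ (g ∧ (b ℕ.<ᵇ a))
    total zero    zero    p g = ⊥-elim (p ≡.refl)
    total zero    (suc b) p false = ≡.refl
    total zero    (suc b) p true = ≡.refl
    total (suc a) zero    p false = ≡.refl
    total (suc a) zero    p true = ≡.refl
    total (suc a) (suc b) p g = total a b (p ∘ ≡.cong suc) g
    split : ∀ i j → ιℕ (G i j) ≡ ιℕ (below i j) + ιℕ (below j i)
    split i j = go (i Fin.≟ j)
      where
      go : Dec (i ≡ j) → ιℕ (G i j) ≡ ιℕ (below i j) + ιℕ (below j i)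
      go (yes ≡.refl) rewrite irrefl i = ≡.refl
      go (no i≢j) = ≡.trans (total (toℕ i) (toℕ j) (i≢j ∘ Fin.toℕ-injective) (G i j))
        (≡.cong (λ g → ιℕ (below i j) + ιℕ (g ∧ (toℕ j ℕ.<ᵇ toℕ i))) (symG i j))

  isTree⇒Tree : ∀ {n} {G : Graph n} → IsTree G → Tree G
  isTree⇒Tree {G = G} (symG , irrefl , conn , count) = record
    { symmetric = symG ; loopless = irrefl ; connected = conn
    ; degrees = ≡.trans (handshake G symG irrefl) (≡.cong (2 *_) count) }

  iso-degree : ∀ {n} {G H : Graph n} ((σ , _) : Iso G H) → ∀ i → size (H (σ ⟨$⟩ʳ i)) ≡ size (G i)
  iso-degree {n} {G} {H} (σ , h) i = ≡.trans (sum-permute {n} {n} (λ j → ιℕ (H (σ ⟨$⟩ʳ i) j)) σ)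
    (sum-cong-≗ {n} (λ j → ≡.cong ιℕ (h i j)))

  iso-tree : ∀ {n} {G H : Graph n} → Iso G H → Tree G → Tree H
  iso-tree {n} {G} {H} iso@(σ , h) tree = record
    { symmetric = λ i j → ≡.trans (back i j) (≡.trans (symmetric _ _) (≡.sym (back j i)))
    ; loopless  = λ i → ≡.trans (back i i) (loopless _)
    ; connected = λ i j → ≡.subst₂ (Walk H) (Perm.inverseʳ σ) (Perm.inverseʳ σ)
        (gmap (σ ⟨$⟩ʳ_) (λ e → ≡.trans (h _ _) e) (connected (σ ⟨$⟩ˡ i) (σ ⟨$⟩ˡ j)))
    ; degrees   = ≡.trans (sum-permute {n} {n} (λ v → size (H v)) σ)
        (≡.trans (sum-cong-≗ {n} (iso-degree {G = G} {H} iso)) degrees) }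
    where
    open Tree tree
    back : ∀ i j → H i j ≡ G (σ ⟨$⟩ˡ i) (σ ⟨$⟩ˡ j)
    back i j = ≡.trans (≡.cong₂ H (≡.sym (Perm.inverseʳ σ)) (≡.sym (Perm.inverseʳ σ))) (h _ _)

open Trees using (Tree)

module Paths {n : ℕ} (G : Graph n) (symG : ∀ i j → G i j ≡ G j i) (loopless : ∀ i → G i i ≡ false) (y : Fin n) where
  open Cardinality
  open Trees
  open EdgeRemoval

  firstOf : List (Fin n) → Fin n
  firstOf []      = y
  firstOf (a ∷ _) = a

  chain-first : ∀ {x} ms → Chain G x ms y → G x (firstOf ms) ≡ true
  chain-first []       e       = e
  chain-first (a ∷ ms) (e , _) = e

  chain-last : ∀ {x} ms → Chain G x ms y → G (lastOf x ms) y ≡ true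
  chain-last []       e       = e
  chain-last (a ∷ ms) (_ , c) = chain-last ms c

  ends : ∀ x ms → Ends x y ms (firstOf ms) (lastOf x ms)
  ends x []       = direct
  ends x (a ∷ ms) = through (proj₂ (split a ms))
    where
    split : ∀ a ms → ∃ λ l → a ∷ ms ≡ l ++ [ lastOf {n = n} a ms ]
    split a []       = [] , ≡.refl
    split a (b ∷ ms) with split b ms
    ... | l , e = a ∷ l , ≡.cong (a ∷_) e

  two-neighbours : ∀ (B : Sub n) → size B ≡ 2 → ∀ {p q u} → B p ≡ true → B q ≡ true → p ≢ q → B u ≡ true → u ≡ p ⊎ u ≡ q
  two-neighbours B two {p} {q} {u} Bp Bq p≢q Bu = go (u Fin.≟ p) (u Fin.≟ q)
    where
    one : size (B ∖ p) ≡ 1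
    one = ℕ.suc-injective (≡.trans (≡.sym (size-remove B p Bp)) two)
    none : size (B ∖ p ∖ q) ≡ 0
    none = ℕ.suc-injective (≡.trans (≡.sym (size-remove (B ∖ p) q (∖-in B Bq (p≢q ∘ ≡.sym)))) one)
    go : Dec (u ≡ p) → Dec (u ≡ q) → u ≡ p ⊎ u ≡ q
    go (yes e) _ = inj₁ e
    go (no _) (yes e) = inj₂ e
    go (no u≢p) (no u≢q) = ⊥-elim (ℕ.0≢1+n (≡.trans (≡.sym none)
      (size-remove (B ∖ p ∖ q) u (∖-in (B ∖ p) (∖-in B Bu u≢p) u≢q))))

  open Segments {n}

  unique-head : ∀ {p : Fin n} {l} → Unique (p ∷ l) → ∀ {m} → m ∈ l → p ≢ m
  unique-head (h ∷ _) m∈ = All.lookup h m∈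

  unique-tail : ∀ {p : Fin n} {l} → Unique (p ∷ l) → Unique l
  unique-tail (_ ∷ t) = t

  y∈ : ∀ (ms : List (Fin n)) → y ∈ ms ++ [ y ]
  y∈ ms = ∈.∈-++⁺ʳ ms (here ≡.refl)

  -- An interior vertex has two neighbours, and its predecessor on the path already lies outside
  -- `S`; within `S` only the successor can be left.
  chain-segment : ∀ p ms → Chain G p ms y → Unique (p ∷ ms ++ [ y ]) → (∀ {m} → m ∈ ms → size (G m) ≡ 2) →
    ∀ S → (∀ {m} → m ∈ ms → S m ≡ true) → S p ≡ false → S y ≡ false → Segment G S ms
  chain-segment p [] _ _ _ S _ _ _ = _
  chain-segment p (a ∷ l) (Gpa , chain) uniq two S ms⊆S Sp Sy = ms⊆S (here ≡.refl) , only , next ,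
    chain-segment a l chain (unique-tail uniq) (two ∘ there) (S ∖ a)
      (λ m∈ → ∖-in S (ms⊆S (there m∈)) (unique-head (unique-tail uniq) (∈.∈-++⁺ˡ m∈) ∘ ≡.sym)) (∖-self S a) (∖-out S Sy)
    where
    first∈ : ∀ l → firstOf l ∈ l ++ [ y ]
    first∈ []      = here ≡.refl
    first∈ (b ∷ l) = here ≡.refl
    neighbour : ∀ u → G a u ≡ true → S u ≡ true → u ≡ firstOf l
    neighbour u g Su with two-neighbours (G a) (two (here ≡.refl)) (≡.trans (symG a p) Gpa) (chain-first l chain)
                            (unique-head uniq (there (first∈ l))) g
    ... | inj₁ ≡.refl = true≢false Su Sp
    ... | inj₂ e      = e
    as-head : ∀ l {u} → u ≡ firstOf l → S u ≡ true → ∃ λ l′ → l ≡ u ∷ l′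
    as-head []      ≡.refl Su = true≢false Su Sy
    as-head (b ∷ l) ≡.refl Su = l , ≡.refl
    only : ∀ u → G a u ≡ true → (S ∖ a) u ≡ true → ∃ λ l′ → l ≡ u ∷ l′
    only u g t = as-head l (neighbour u g (∖-⊆ S t)) (∖-⊆ S t)
    next : ∀ b l′ → l ≡ b ∷ l′ → G a b ≡ true × (S ∖ a) b ≡ true
    next b l′ ≡.refl = proj₁ chain , ∖-in S (ms⊆S (there (here ≡.refl))) (unique-head (unique-tail uniq) (here ≡.refl) ∘ ≡.sym)

  Away : Fin n → Fin n → Set
  Away = Star (λ i j → G i j ≡ true × i ≢ y × j ≢ y)

  away-reverse : ∀ {i j} → Away i j → Away j i
  away-reverse = reverse (λ {i} {j} (g , p , q) → ≡.trans (symG j i) g , q , p)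

  chain-away : ∀ {x} ms → Chain G x ms y → x ≢ y → (∀ {m} → m ∈ ms → m ≢ y) → ∀ {d} → d ∈ ms → Away x d
  chain-away (a ∷ ms) (g , c) x≢y h (here ≡.refl) = (g , x≢y , h (here ≡.refl)) ◅ ε
  chain-away (a ∷ ms) (g , c) x≢y h (there d∈) =
    (g , x≢y , h (here ≡.refl)) ◅ chain-away ms c (h (here ≡.refl)) (h ∘ there) d∈

  -- The path meets `y` only through its last edge, which comes from a vertex other than `d`, so
  -- deleting the pair `y`, `d` leaves it intact.
  chain-cut : ∀ {x} ms → Chain G x ms y → x ≢ y → (∀ {m} → m ∈ ms → m ≢ y) → ∀ {d} → lastOf x ms ≢ d →
    Walk (cut G y d) x y
  chain-cut [] e x≢y h {d} z≢d = ≡.trans (remove-sym y (_==F d) symG _ _)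
    (≡.trans (remove-keep G y (_==F d) x≢y (≢⇒==F z≢d)) (≡.trans (symG _ _) e)) ◅ ε
  chain-cut (a ∷ ms) (g , c) x≢y h {d} z≢d = ≡.trans (remove-off G y (_==F d) x≢y (h (here ≡.refl))) g
    ◅ chain-cut ms c (h (here ≡.refl)) (h ∘ there) z≢d

module Move {n : ℕ} {G : Graph n} (tree : Tree G) (x y : Fin n) (ms : List (Fin n))
  (chain : Chain G x ms y) (uniq : Unique (x ∷ ms ++ [ y ])) (two : ∀ {m} → m ∈ ms → size (G m) ≡ 2) where
  open import Data.Nat.Base using (_+_)
  open Cardinality
  open Counting
  open Trees
  open EdgeRemoval
  open import Algebra.Properties.CommutativeMonoid.Sum ℕ.+-0-commutativeMonoid using (∑-distrib-+)

  open Tree tree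
  open Paths G symmetric loopless y public

  f z : Fin n
  f = firstOf ms
  z = lastOf x ms

  Ny Nx : Sub n
  Ny u = G y u ∧ not (u ==F z)
  Nx u = G x u ∧ not (u ==F f)

  x∉ms : ¬ (x ∈ ms)
  x∉ms x∈ = unique-head uniq (∈.∈-++⁺ˡ x∈) ≡.refl

  x≢y : x ≢ y
  x≢y = unique-head uniq (y∈ ms)

  ms≢y : ∀ {m} → m ∈ ms → m ≢ y
  ms≢y = go ms (unique-tail uniq)
    where
    go : ∀ l → Unique (l ++ [ y ]) → ∀ {m} → m ∈ l → m ≢ y
    go (a ∷ l) u (here ≡.refl) = unique-head u (y∈ l)
    go (a ∷ l) u (there m∈)    = go l (unique-tail u) m∈

  Gyz : G y z ≡ true
  Gyz = ≡.trans (symmetric y z) (chain-last ms chain)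

  Gxf : G x f ≡ true
  Gxf = chain-first ms chain

  -- A walk from `d` to `x` off `y`, continued along the path to `y`, would join the ends of the
  -- edge between `y` and `d` without using it. The facts that moved neighbours are neither `x`, nor
  -- adjacent to `x`, nor on the path all rest on this.
  no-return : ∀ d → Ny d ≡ true → ¬ Away d x
  no-return d Nyd away = bridge tree {y} {d} (∧-trueˡ Nyd)
    (walk-reverse sym-cut (chain-cut ms chain x≢y ms≢y (λ z≡d → true≢false (≡⇒==F (≡.sym z≡d)) (not-true (∧-trueʳ {G y d} Nyd))))
      ◅◅ walk-reverse sym-cut (Star.map (λ {i} {j} (g , p , q) → ≡.trans (remove-off G y (_==F d) p q) g) away))
    where
    sym-cut = remove-sym y (_==F d) symmetric

  Ny-≢y : ∀ {d} → Ny d ≡ true → d ≢ y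
  Ny-≢y e ≡.refl = true≢false (∧-trueˡ e) (loopless y)

  Ny-x≡ : Ny x ≡ false
  Ny-x≡ = ≢true⇒≡false (λ e → no-return x e ε)

  Ny-¬x : ∀ d → Ny d ≡ true → G x d ≡ false
  Ny-¬x d e = ≢true⇒≡false (λ g → no-return d e ((≡.trans (symmetric d x) g , Ny-≢y e , x≢y) ◅ ε))

  Ny-ms : ∀ d → Ny d ≡ true → ¬ (d ∈ ms)
  Ny-ms d e d∈ = no-return d e (away-reverse (chain-away ms chain x≢y ms≢y d∈))

  -- If `x` and `y` are adjacent and `x ≠ z`, then `x` would be a moved neighbour of `y`. So
  -- `x = z`, which forces the path to be a single edge, and then `y` is `f`.
  Nx-y≡ : Nx y ≡ false
  Nx-y≡ = ≢true⇒≡false (λ e → true≢false (≡⇒==F (y≡f (∧-trueˡ e))) (not-true (∧-trueʳ {G x y} e)))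
    where
    last∈ : ∀ (a : Fin n) l → lastOf {n = n} a l ∈ a ∷ l
    last∈ a []      = here ≡.refl
    last∈ a (b ∷ l) = there (last∈ b l)
    y≡f : G x y ≡ true → y ≡ f
    y≡f g = go ms ≡.refl (x Fin.≟ z)
      where
      go : ∀ l → ms ≡ l → Dec (x ≡ z) → y ≡ firstOf l
      go _       e      (no x≢z) = true≢false (∧-true (≡.trans (symmetric y x) g) (not-false (≢⇒==F x≢z))) Ny-x≡
      go []      e      (yes _)  = ≡.refl
      go (a ∷ l) ≡.refl (yes x≡z) = ⊥-elim (x∉ms (≡.subst (_∈ a ∷ l) (≡.sym x≡z) (last∈ a l)))

  deg-y : size (G y) ≡ suc (size Ny)
  deg-y = ≡.trans (size-remove (G y) z Gyz) (≡.cong suc (size-cong (λ u → Bool.∧-comm _ (G y u))))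

  deg-x : size (G x) ≡ suc (size Nx)
  deg-x = ≡.trans (size-remove (G x) f Gxf) (≡.cong suc (size-cong (λ u → Bool.∧-comm _ (G x u))))

  T : Graph n
  T = Defs.shift G x y z

  -- The Boolean core of `edge-count`: `a` and `b` mark a pair deleted at `y`, `p` and `q` a pair
  -- created at `x`, and `g` an edge of `G`. Deleted pairs are edges, created pairs are not, and no
  -- pair is deleted or created twice.
  count : ∀ a b p q g → (a ≡ true → g ≡ true) → (b ≡ true → g ≡ true) → (p ≡ true → g ≡ false) → (q ≡ true → g ≡ false) →
    ¬ (a ≡ true × b ≡ true) → ¬ (p ≡ true × q ≡ true) →
    ιℕ (if a ∨ b then false else (p ∨ q ∨ g)) + (ιℕ b + ιℕ a) ≡ ιℕ g + (ιℕ q + ιℕ p)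
  count a b true q true _ _ h _ _ _ with () ← h ≡.refl
  count a b false true true _ _ _ h _ _ with () ← h ≡.refl
  count true true p q g _ _ _ _ h _ = ⊥-elim (h (≡.refl , ≡.refl))
  count true false false false true _ _ _ _ _ _ = ≡.refl
  count false true false false true _ _ _ _ _ _ = ≡.refl
  count false false false false true _ _ _ _ _ _ = ≡.refl
  count true b p q false h _ _ _ _ _ with () ← h ≡.refl
  count false true p q false _ h _ _ _ _ with () ← h ≡.refl
  count false false true true false _ _ _ _ _ h = ⊥-elim (h (≡.refl , ≡.refl))
  count false false true false false _ _ _ _ _ _ = ≡.refl
  count false false false true false _ _ _ _ _ _ = ≡.refl
  count false false false false false _ _ _ _ _ _ = ≡.refl

  edge-count : ∀ v u → ιℕ (T v u) + (ιℕ ((u ==F y) ∧ Ny v) + ιℕ ((v ==F y) ∧ Ny u))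
    ≡ ιℕ (G v u) + (ιℕ ((u ==F x) ∧ Ny v) + ιℕ ((v ==F x) ∧ Ny u))
  edge-count v u = count ((v ==F y) ∧ Ny u) ((u ==F y) ∧ Ny v) ((v ==F x) ∧ Ny u) ((u ==F x) ∧ Ny v) (G v u)
    (λ e → at {a = v} {b = u} e (∧-trueˡ (∧-trueʳ {v ==F y} e)))
    (λ e → ≡.trans (symmetric v u) (at {a = u} {b = v} e (∧-trueˡ (∧-trueʳ {u ==F y} e))))
    (λ e → atx {a = v} {b = u} e)
    (λ e → ≡.trans (symmetric v u) (atx {a = u} {b = v} e))
    (λ (e , e′) → Ny-≢y (∧-trueʳ {v ==F y} e) (==F⇒≡ (∧-trueˡ e′)))
    (λ (e , e′) → true≢false (≡.trans (≡.cong Ny (≡.sym (==F⇒≡ {i = u} (∧-trueˡ e′)))) (∧-trueʳ {v ==F x} e)) Ny-x≡)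
    where
    at : ∀ {a b} → (a ==F y) ∧ Ny b ≡ true → G y b ≡ true → G a b ≡ true
    at {a} {b} e g = ≡.trans (≡.cong (λ i → G i b) (==F⇒≡ {i = a} (∧-trueˡ e))) g
    atx : ∀ {a b} → (a ==F x) ∧ Ny b ≡ true → G a b ≡ false
    atx {a} {b} e = ≡.trans (≡.cong (λ i → G i b) (==F⇒≡ {i = a} (∧-trueˡ e))) (Ny-¬x b (∧-trueʳ {a ==F x} e))

  ιℕ-∧ : ∀ a b → ιℕ (a ∧ b) ≡ (if a then ιℕ b else 0)
  ιℕ-∧ true  b = ≡.refl
  ιℕ-∧ false b = ≡.refl

  row-sum : ∀ (v w : Fin n) → sum (λ u → ιℕ ((v ==F w) ∧ Ny u)) ≡ (if v ==F w then size Ny else 0)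
  row-sum v w with v ==F w
  ... | true  = ≡.refl
  ... | false = sum-zero {n} (λ _ → ≡.refl)

  column-sum : ∀ (v w : Fin n) → sum (λ u → ιℕ ((u ==F w) ∧ Ny v)) ≡ ιℕ (Ny v)
  column-sum v w = ≡.trans (sum-cong-≗ {n} (λ u → ιℕ-∧ (u ==F w) (Ny v))) (sum-point w (λ _ → ιℕ (Ny v)))

  -- A moved neighbour trades its edge to `y` for one to `x`, so `ιℕ (Ny v)` occurs on both sides of
  -- the summed `edge-count` and cancels. The additive form avoids truncated subtraction.
  deg-T : ∀ v → size (T v) + (if v ==F y then size Ny else 0) ≡ size (G v) + (if v ==F x then size Ny else 0)
  deg-T v = cancel {size (T v)} {ιℕ (Ny v)} {_} {size (G v)} (≡.trans (≡.sym (expand (T v) y)) (≡.trans (sum-cong-≗ {n} (edge-count v)) (expand (G v) x)))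
    where
    expand : ∀ (B : Sub n) w → sum (λ u → ιℕ (B u) + (ιℕ ((u ==F w) ∧ Ny v) + ιℕ ((v ==F w) ∧ Ny u)))
      ≡ size B + (ιℕ (Ny v) + (if v ==F w then size Ny else 0))
    expand B w = ≡.trans (∑-distrib-+ {n} (λ u → ιℕ (B u)) _) (≡.cong (size B +_)
      (≡.trans (∑-distrib-+ {n} (λ u → ιℕ ((u ==F w) ∧ Ny v)) _) (≡.cong₂ _+_ (column-sum v w) (row-sum v w))))
    cancel : ∀ {a b c d e : ℕ} → a + (b + c) ≡ d + (b + e) → a + c ≡ d + e
    cancel {a} {b} {c} {d} {e} p = ℕ.+-cancelˡ-≡ b _ _ (≡.trans (swap b a c) (≡.trans p (≡.sym (swap b d e))))
      where
      swap : ∀ b a c → b + (a + c) ≡ a + (b + c)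
      swap b a c = ≡.trans (≡.sym (ℕ.+-assoc b a c)) (≡.trans (≡.cong (_+ c) (ℕ.+-comm b a)) (ℕ.+-assoc a b c))

  -- Since `c` is adjacent to `x`, a walk from `c` to `d` off `y` would lead from `d` back to `x`,
  -- against `no-return`.
  separated : ∀ c d → Nx c ≡ true → Ny d ≡ true →
    ¬ Star (λ a b → G a b ≡ true × ((λ _ → true) ∖ y ∖ x) b ≡ true) c d
  separated c d Nxc Nyd walk = no-return d Nyd (away-reverse (away c≢y walk) ◅◅ ((≡.trans (symmetric c x) (∧-trueˡ Nxc) , c≢y , x≢y) ◅ ε))
    where
    c≢y : c ≢ y
    c≢y ≡.refl = true≢false Nxc Nx-y≡
    away : ∀ {a b} → a ≢ y → Star (λ a b → G a b ≡ true × ((λ _ → true) ∖ y ∖ x) b ≡ true) a b → Away a b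
    away a≢y ε = ε
    away a≢y (_◅_ {j = b} (g , t) rest) = (g , a≢y , b≢y) ◅ away b≢y rest
      where
      b≢y : b ≢ y
      b≢y = ∖-≢ (λ _ → true) (∖-⊆ ((λ _ → true) ∖ y) t)

  T-edge : ∀ {a b} → G a b ≡ true → (a ==F y) ∧ Ny b ≡ false → (b ==F y) ∧ Ny a ≡ false → T a b ≡ true
  T-edge {a} {b} g p q rewrite p | q | g = ≡.trans (≡.cong (((a ==F x) ∧ Ny b) ∨_) (Bool.∨-zeroʳ _)) (Bool.∨-zeroʳ _)

  T-new : ∀ {d} → Ny d ≡ true → T x d ≡ true
  T-new {d} e rewrite ≢⇒==F x≢y | Ny-x≡ | Bool.∧-zeroʳ (d ==F y) | ==F-refl x | e = ≡.refl

  symT : ∀ i j → T i j ≡ T j i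
  symT = shift-sym symmetric x y z

  T-path : ∀ {a} l → Chain G a l y → a ≢ y → (∀ {m} → m ∈ l → m ≢ y) → lastOf a l ≡ z → Walk T a y
  T-path {a} [] g a≢y h e = T-edge g (≡.cong (_∧ Ny y) (≢⇒==F a≢y))
    (≡.trans (≡.cong ((y ==F y) ∧_) (≡.trans (≡.cong (λ b → G y a ∧ not b) (≡⇒==F e)) (Bool.∧-zeroʳ _))) (Bool.∧-zeroʳ _)) ◅ ε
  T-path {a} (m ∷ l) (g , c) a≢y h e = T-edge g (≡.cong (_∧ Ny m) (≢⇒==F a≢y)) (≡.cong (_∧ Ny a) (≢⇒==F (h (here ≡.refl))))
    ◅ T-path l c (h (here ≡.refl)) (h ∘ there) e

  -- A deleted edge from `y` to `d` is replaced by the path back to `x`, which survives the shift,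
  -- followed by the new edge from `x` to `d`.
  T-walk : ∀ {a b} → G a b ≡ true → Walk T a b
  T-walk {a} {b} g = go ((a ==F y) ∧ Ny b) ((b ==F y) ∧ Ny a) ≡.refl ≡.refl
    where
    path : Walk T x y
    path = T-path ms chain x≢y ms≢y ≡.refl
    detour : ∀ {i j} → (i ==F y) ∧ Ny j ≡ true → Walk T i j
    detour {i} {j} e = ≡.subst (λ i → Walk T i j) (≡.sym (==F⇒≡ {i = i} (∧-trueˡ e)))
      (walk-reverse symT path ◅◅ (T-new (∧-trueʳ {i ==F y} e) ◅ ε))
    go : ∀ p q → (a ==F y) ∧ Ny b ≡ p → (b ==F y) ∧ Ny a ≡ q → Walk T a b
    go true  q     e e′ = detour e
    go false true  e e′ = walk-reverse symT (detour e′)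
    go false false e e′ = T-edge g e e′ ◅ ε

  T-tree : Tree T
  T-tree = record
    { symmetric = symT
    ; loopless  = no-loop
    ; connected = λ i j → Star.concat (Star.map T-walk (connected i j))
    ; degrees   = ≡.trans (ℕ.+-cancelʳ-≡ (size Ny) _ _ (≡.trans (≡.sym (total T y))
        (≡.trans (sum-cong-≗ {n} deg-T) (total G x)))) degrees }
    where
    total : ∀ (K : Graph n) w → sum (λ v → size (K v) + (if v ==F w then size Ny else 0)) ≡ degreeSum K + size Ny
    total K w = ≡.trans (∑-distrib-+ {n} (λ v → size (K v)) _) (≡.cong (degreeSum K +_) (sum-point w (λ _ → size Ny)))
    no-loop : ∀ v → T v v ≡ false
    no-loop v = at-x ((v ==F x) ∧ Ny v) ≡.refl
      where
      at-x : ∀ b → (v ==F x) ∧ Ny v ≡ b → T v v ≡ false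
      at-x true  e = true≢false (≡.trans (≡.cong Ny (≡.sym (==F⇒≡ {i = v} (∧-trueˡ e)))) (∧-trueʳ {v ==F x} e)) Ny-x≡
      at-x false e rewrite e | loopless v with ((v ==F y) ∧ Ny v) ∨ ((v ==F y) ∧ Ny v)
      ... | true  = ≡.refl
      ... | false = ≡.refl

-- The effect of one tree shift on the matching polynomial.

module Step {c ℓ p} {R : CommutativeRing c ℓ} {cone : Cone R p} (vars : Variables cone) {n : ℕ}
  {G : Graph n} (tree : Tree G) (x y : Fin n) (ms : List (Fin n)) (chain : Chain G x ms y)
  (uniq : Unique (x ∷ ms ++ [ y ])) (two : ∀ {m} → m ∈ ms → size (G m) ≡ 2) where
  open EdgeRemoval

  open CommutativeRing R hiding (zero)
  open Cone cone
  open Variables vars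
  open Tree tree using (connected; loopless) renaming (symmetric to symG)
  open Move tree x y ms chain uniq two
  open Laplacian vars {n}
  open WeightedMatchings R α β {n}
  open Peel s#
  open DifferenceSolver R
  open import Relation.Binary.Reasoning.Setoid setoid
  open Positivity vars G symG connected
    using (w; Q; Q-cong; Δ; Δ-pos; Q-pos; second-difference-pos; Pos-sum; Pos-ι; sum-difference)

  -- Both G and its shift T arise from H by reattaching the moved neighbours Ny,
  -- at y and at x respectively; J is H without the neighbours Nx of x off the path.
  H : Graph n
  H = remove G y Ny

  J : Graph n
  J = remove H x Nx

  symH : Symmetric H
  symH = remove-sym y Ny symG

  symJ : Symmetric J
  symJ = remove-sym x Nx symH

  -- Moved neighbours keep their weight from `G` although they have lost an edge in `H`, because
  -- they get it back at `y` or at `x`. Only `y` is reset, to the degree 1 that its path edge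
  -- accounts for; `wJ` treats `x` likewise.
  wH : Fin n → Carrier
  wH v = if v ==F y then degreeWeight 1 else w v

  wJ : Fin n → Carrier
  wJ v = if v ==F x then degreeWeight 1 else wH v

  wH-y : wH y ≈ degreeWeight 1
  wH-y rewrite ==F-refl y = refl

  wH-other : ∀ {v} → v ≢ y → wH v ≈ w v
  wH-other v≢y rewrite ≢⇒==F v≢y = refl

  wJ-x : wJ x ≈ degreeWeight 1
  wJ-x rewrite ==F-refl x = refl

  wJ-other : ∀ {v} → v ≢ x → wJ v ≈ wH v
  wJ-other v≢x rewrite ≢⇒==F v≢x = refl

  y≢x : y ≢ x
  y≢x = x≢y ∘ ≡.sym

  Ny-y : Ny y ≡ false
  Ny-y = ≡.cong (_∧ not (y ==F z)) (loopless y)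

  Nx-x : Nx x ≡ false
  Nx-x = ≡.cong (_∧ not (x ==F f)) (loopless x)

  Ny-≢ : ∀ {d} → Ny d ≡ true → d ≢ y × d ≢ x
  Ny-≢ e = (λ { ≡.refl → true≢false e Ny-y }) , (λ { ≡.refl → true≢false e Ny-x≡ })

  Nx-≢ : ∀ {c} → Nx c ≡ true → c ≢ x × c ≢ y
  Nx-≢ e = (λ { ≡.refl → true≢false e Nx-x }) , (λ { ≡.refl → true≢false e Nx-y≡ })

  peel-G : ∀ S → S y ≡ true → (∀ u → Ny u ≡ true → (S ∖ y) u ≡ true) →
    P G w S ≈ P H wH S + ∑[ d < n ] (ι (Ny d) * gain (P H wH (S ∖ y)) (P H wH (S ∖ y ∖ d)))
  peel-G = peel symG symH y Ny (λ i j p q → ≡.sym (remove-off G y Ny p q)) (λ i p → sym (wH-other p))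
    (remove-∨ G y Ny (λ u → ∧-trueˡ) Ny-y) (λ u → remove-gone G y Ny)
    (trans (reflexive (≡.cong degreeWeight deg-y)) (trans (degreeWeight-+ 1 Ny) (+-congʳ (sym wH-y))))

  T-off : ∀ i j → i ≢ x → j ≢ x → T i j ≡ H i j
  T-off i j i≢x j≢x rewrite ≢⇒==F i≢x | ≢⇒==F j≢x = cases ((i ==F y ∧ Ny j) ∨ (j ==F y ∧ Ny i)) (G i j)
    where
    cases : ∀ a g → (if a then false else g) ≡ g ∧ not a
    cases true  g = ≡.sym (Bool.∧-zeroʳ g)
    cases false g = ≡.sym (Bool.∧-identityʳ g)

  T-x : ∀ u → T x u ≡ H x u ∨ Ny u
  T-x u rewrite ≢⇒==F x≢y | ==F-refl x | Ny-x≡ | Bool.∧-zeroʳ (u ==F y) | Bool.∧-zeroʳ (u ==F x)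
              | Bool.∧-identityʳ (G x u) = Bool.∨-comm (Ny u) (G x u)

  H-x : ∀ u → H x u ≡ G x u
  H-x u rewrite ≢⇒==F x≢y | Ny-x≡ | Bool.∧-zeroʳ (u ==F y) = Bool.∧-identityʳ (G x u)

  deg-T-x : size (T x) ≡ size (G x) ℕ.+ size Ny
  deg-T-x = ≡.trans (≡.sym (ℕ.+-identityʳ _)) (≡.trans
    (≡.cong (λ b → size (T x) ℕ.+ (if b then size Ny else 0)) (≡.sym (≢⇒==F x≢y)))
    (≡.trans (deg-T x) (≡.cong (λ b → size (G x) ℕ.+ (if b then size Ny else 0)) (==F-refl x))))

  deg-T-y : size (T y) ≡ 1
  deg-T-y = ℕ.+-cancelʳ-≡ (size Ny) _ _ (≡.trans
    (≡.cong (λ b → size (T y) ℕ.+ (if b then size Ny else 0)) (≡.sym (==F-refl y)))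
    (≡.trans (deg-T y) (≡.trans (≡.cong (λ b → size (G y) ℕ.+ (if b then size Ny else 0)) (≢⇒==F y≢x))
      (≡.trans (ℕ.+-identityʳ _) deg-y))))

  deg-T-other : ∀ {v} → v ≢ x → v ≢ y → size (T v) ≡ size (G v)
  deg-T-other {v} v≢x v≢y = ≡.trans (≡.sym (ℕ.+-identityʳ _)) (≡.trans
    (≡.cong (λ b → size (T v) ℕ.+ (if b then size Ny else 0)) (≡.sym (≢⇒==F v≢y)))
    (≡.trans (deg-T v) (≡.trans (≡.cong (λ b → size (G v) ℕ.+ (if b then size Ny else 0)) (≢⇒==F v≢x)) (ℕ.+-identityʳ _))))

  laplacian-T : ∀ v → v ≢ x → laplacian T v ≈ wH v
  laplacian-T v v≢x = go (v Fin.≟ y)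
    where
    go : Dec (v ≡ y) → laplacian T v ≈ wH v
    go (yes ≡.refl) = trans (reflexive (≡.cong degreeWeight deg-T-y)) (sym wH-y)
    go (no v≢y)     = trans (reflexive (≡.cong degreeWeight (deg-T-other v≢x v≢y))) (sym (wH-other v≢y))

  peel-T : ∀ S → S x ≡ true → (∀ u → Ny u ≡ true → (S ∖ x) u ≡ true) →
    P T (laplacian T) S ≈ P H wH S + ∑[ d < n ] (ι (Ny d) * gain (P H wH (S ∖ x)) (P H wH (S ∖ x ∖ d)))
  peel-T = peel symT symH x Ny T-off laplacian-T T-x (λ d e → ≡.trans (H-x d) (Ny-¬x d e))
    (trans (reflexive (≡.cong degreeWeight deg-T-x)) (trans (degreeWeight-+ (size (G x)) Ny) (+-congʳ (sym (wH-other x≢y)))))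

  peel-H : ∀ S → S x ≡ true → (∀ u → Nx u ≡ true → (S ∖ x) u ≡ true) →
    P H wH S ≈ P J wJ S + ∑[ c < n ] (ι (Nx c) * gain (P J wJ (S ∖ x)) (P J wJ (S ∖ x ∖ c)))
  peel-H = peel symH symJ x Nx (λ i j p q → ≡.sym (remove-off H x Nx p q)) (λ i p → sym (wJ-other p))
    (remove-∨ H x Nx (λ u e → ≡.trans (H-x u) (∧-trueˡ e)) Nx-x) (λ u → remove-gone H x Nx)
    (trans (wH-other x≢y) (trans (reflexive (≡.cong degreeWeight deg-x)) (trans (degreeWeight-+ 1 Nx) (+-congʳ (sym wJ-x)))))

  J-inner : ∀ S → S x ≡ false → S y ≡ false → P J wJ S ≈ Q S
  J-inner S Sx Sy = P-agree symG symJ S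
    (λ i Si → trans (wJ-other (≢x Si)) (wH-other (≢y Si)))
    (λ i j Si Sj → ≡.trans (remove-off H x Nx (≢x Si) (≢x Sj)) (remove-off G y Ny (≢y Si) (≢y Sj)))
    where
    ≢x : ∀ {i} → S i ≡ true → i ≢ x
    ≢x e ≡.refl = true≢false e Sx
    ≢y : ∀ {i} → S i ≡ true → i ≢ y
    ≢y e ≡.refl = true≢false e Sy

  H-J : ∀ S → S x ≡ false → P H wH S ≈ P J wJ S
  H-J S Sx = P-agree symJ symH S (λ i Si → sym (wJ-other (≢x Si)))
    (λ i j Si Sj → ≡.sym (remove-off H x Nx (≢x Si) (≢x Sj)))
    where
    ≢x : ∀ {i} → S i ≡ true → i ≢ x
    ≢x e ≡.refl = true≢false e Sx

  J-x-only : ∀ u → J x u ≡ true → u ≡ f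
  J-x-only u e = case (u ==F f) ≡.refl
    where
    case : ∀ b → (u ==F f) ≡ b → u ≡ f
    case true  q = ==F⇒≡ q
    case false q = true≢false (∧-true (≡.trans (≡.sym (H-x u)) (remove-⊆ H x Nx e)) (not-false q)) (remove-not H x Nx e)

  J-y-only : ∀ u → J y u ≡ true → u ≡ z
  J-y-only u e = case (u ==F z) ≡.refl
    where
    Hyu = remove-⊆ H x Nx e
    case : ∀ b → (u ==F z) ≡ b → u ≡ z
    case true  q = ==F⇒≡ q
    case false q = true≢false (∧-true (remove-⊆ G y Ny Hyu) (not-false q)) (remove-not G y Ny Hyu)

  J-xf : f ≢ x → J x f ≡ true
  J-xf f≢x = ≡.trans (remove-keep H x Nx f≢x (≡.trans (≡.cong (λ b → G x f ∧ not b) (==F-refl f)) (Bool.∧-zeroʳ _)))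
    (≡.trans (H-x f) Gxf)

  J-yz : z ≢ x → z ≢ y → J y z ≡ true
  J-yz z≢x z≢y = ≡.trans (remove-off H x Nx y≢x z≢x)
    (≡.trans (remove-keep G y Ny z≢y (≡.trans (≡.cong (λ b → G y z ∧ not b) (==F-refl z)) (Bool.∧-zeroʳ _))) Gyz)

  -- Removing either end of the path leaves paths with equal weight sequences.
  ends-exchange : ∀ S → S x ≡ true → S y ≡ true → (∀ {m} → m ∈ ms → S m ≡ true) →
    P J wJ (S ∖ y) ≈ P J wJ (S ∖ x)
  ends-exchange S Sx Sy ms⊆S = go (ends x ms) ≡.refl ≡.refl ≡.refl
    where
    W = S ∖ y ∖ x
    W′ = S ∖ x ∖ y
    Wx = ∖-self (S ∖ y) x
    Wy = ∖-out (S ∖ y) {v = x} (∖-self S y)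
    Jx≈ : P J wJ W ≈ Q W
    Jx≈ = J-inner W Wx Wy
    Jy≈ : P J wJ W′ ≈ Q W
    Jy≈ = trans (P-cong J wJ (∖-comm S x y)) Jx≈
    wy : wJ y ≈ degreeWeight 1
    wy = trans (wJ-other y≢x) wH-y
    x∈S : (S ∖ y) x ≡ true
    x∈S = ∖-in S Sx x≢y
    y∈S : (S ∖ x) y ≡ true
    y∈S = ∖-in S Sy y≢x
    ms⊆W : ∀ {m} → m ∈ ms → W m ≡ true
    ms⊆W m∈ = ∖-in (S ∖ y) (∖-in S (ms⊆S m∈) (λ { ≡.refl → ms≢y m∈ ≡.refl })) (λ { ≡.refl → x∉ms m∈ })
    go : ∀ {ms′ f′ z′} → Ends x y ms′ f′ z′ → ms ≡ ms′ → f ≡ f′ → z ≡ z′ → P J wJ (S ∖ y) ≈ P J wJ (S ∖ x)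
    go direct _ f≡y z≡x = begin
      P J wJ (S ∖ y)
        ≈⟨ expand-isolated wJ symJ (S ∖ y) x x∈S (λ u e t → ∖-≢ S (∖-⊆ (S ∖ y) t) (≡.trans (J-x-only u e) f≡y)) ⟩
      wJ x * P J wJ W    ≈⟨ *-cong (trans wJ-x (sym wy)) (trans Jx≈ (sym Jy≈)) ⟩
      wJ y * P J wJ W′
        ≈⟨ expand-isolated wJ symJ (S ∖ x) y y∈S (λ u e t → ∖-≢ S (∖-⊆ (S ∖ x) t) (≡.trans (J-y-only u e) z≡x)) ⟨
      P J wJ (S ∖ x) ∎
    go (through {a} {l} {l′} {z′} eq) ≡.refl ≡.refl ≡.refl = begin
      P J wJ (S ∖ y)
        ≈⟨ expand-pendant wJ symJ (S ∖ y) x a x∈S (J-xf (∖-≢ (S ∖ y) Wa)) Wa (λ u e _ → J-x-only u e) ⟩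
      wJ x * P J wJ W + edge * P J wJ (W ∖ a)
        ≈⟨ +-cong (*-cong (trans wJ-x (sym wy)) (trans Jx≈ (sym Jy≈))) (*-congˡ (begin
             P J wJ (W ∖ a)  ≈⟨ J-inner (W ∖ a) (∖-out W {i = x} Wx) (∖-out W {i = y} Wy) ⟩
             Q (W ∖ a)       ≈⟨ segment-length w symG (degreeWeight 2) l l′ (λ m → deg₂ (there m))
                                  (λ m → deg₂ (≡.subst (_ ∈_) (≡.sym eq) (∈.∈-++⁺ˡ m))) lengths
                                  (proj₂ (proj₂ (proj₂ seg))) (Segment-init l′ z seg′) sets ⟩
             Q (W ∖ z)       ≈⟨ J-inner (W ∖ z) (∖-out W {i = x} Wx) (∖-out W {i = y} Wy) ⟨
             P J wJ (W ∖ z)  ≈⟨ P-cong J wJ (∖-cong z (∖-comm S x y)) ⟨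
             P J wJ (W′ ∖ z) ∎)) ⟩
      wJ y * P J wJ W′ + edge * P J wJ (W′ ∖ z)
        ≈⟨ expand-pendant wJ symJ (S ∖ x) y z y∈S (J-yz (∖-≢ (S ∖ y) Wz) (∖-≢ S (∖-⊆ (S ∖ y) Wz)))
             (≡.trans (∖-comm S x y z) Wz) (λ u e _ → J-y-only u e) ⟨
      P J wJ (S ∖ x) ∎
      where
      Wa : W a ≡ true
      Wa = ms⊆W (here ≡.refl)
      Wz : W z ≡ true
      Wz = ms⊆W (≡.subst (z ∈_) (≡.sym eq) (∈.∈-++⁺ʳ l′ (here ≡.refl)))
      deg₂ : ∀ {m} → m ∈ ms → w m ≈ degreeWeight 2
      deg₂ m = reflexive (≡.cong degreeWeight (two m))
      seg : Segment G W (a ∷ l)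
      seg = chain-segment x ms chain uniq two W ms⊆W Wx Wy
      seg′ : Segment G W (l′ ++ [ z ])
      seg′ = ≡.subst (Segment G W) eq seg
      lengths : length l ≡ length l′
      lengths = ℕ.suc-injective (≡.trans (≡.cong length eq) (≡.trans (List.length-++ l′) (ℕ.+-comm (length l′) 1)))
      sets : W ∖ a ∖∖ l ≗ W ∖ z ∖∖ l′
      sets i = ≡.trans (≡.cong (λ k → (W ∖∖ k) i) eq) (∖∖-last W l′ z i)

  -- In `J` the two path ends can be exchanged, so the difference is just what attaching `Nx` at `x`
  -- adds while `y` is absent. `S` is general because the formula is applied to all vertices and to
  -- the complement of one moved neighbour.
  F-expand : ∀ S → S x ≡ true → S y ≡ true → (∀ {m} → m ∈ ms → S m ≡ true) → (∀ c → Nx c ≡ true → S c ≡ true) →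
    P H wH (S ∖ y) - P H wH (S ∖ x) ≈ ∑[ c < n ] (ι (Nx c) * gain (Q (S ∖ y ∖ x)) (Q (S ∖ y ∖ x ∖ c)))
  F-expand S Sx Sy ms⊆S Nx⊆S = begin
    P H wH (S ∖ y) - P H wH (S ∖ x)
      ≈⟨ +-cong (peel-H (S ∖ y) (∖-in S Sx x≢y)
           (λ c e → ∖-in (S ∖ y) (∖-in S (Nx⊆S c e) (proj₂ (Nx-≢ e))) (proj₁ (Nx-≢ e)))) (-‿cong (H-J (S ∖ x) (∖-self S x))) ⟩
    P J wJ (S ∖ y) + rest - P J wJ (S ∖ x)
      ≈⟨ +-congʳ (+-congʳ (ends-exchange S Sx Sy ms⊆S)) ⟩
    P J wJ (S ∖ x) + rest - P J wJ (S ∖ x)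
      ≈⟨ solve 2 (λ a b → (a :+ b) :- a := b) refl _ _ ⟩
    rest
      ≈⟨ sum-cong-≋ {n} (λ c → *-congˡ (+-cong (*-congˡ (J-inner W Wx Wy))
           (*-congˡ (J-inner (W ∖ c) (∖-out W {i = x} Wx) (∖-out W {i = y} Wy))))) ⟩
    ∑[ c < n ] (ι (Nx c) * gain (Q (S ∖ y ∖ x)) (Q (S ∖ y ∖ x ∖ c))) ∎
    where
    W = S ∖ y ∖ x
    Wx = ∖-self (S ∖ y) x
    Wy = ∖-out (S ∖ y) {v = x} (∖-self S y)
    rest = ∑[ c < n ] (ι (Nx c) * gain (P J wJ W) (P J wJ (W ∖ c)))

  W : Sub n
  W = full ∖ y ∖ x

  Wx : W x ≡ false
  Wx = ∖-self (full ∖ y) x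

  Wy : W y ≡ false
  Wy = ∖-out (full ∖ y) {v = x} (∖-self full y)

  -- Sorting by the explicit powers of `u` gives the combination: a second difference, then `u`
  -- times two first differences, then `u` twice times a matching sum. The vertices `x` and `y` are
  -- the outside neighbours of `c` and `d`.
  pair-pos : ∀ c d → Nx c ≡ true → Ny d ≡ true →
    Pos (s# * gain (Q W) (Q (W ∖ c)) + edge * gain (Q (W ∖ d)) (Q (W ∖ d ∖ c)))
  pair-pos c d Nxc Nyd = Pos-resp (begin
    s# * s# * ((Δ W c - Δ (W ∖ d) c) + (u# * Δ (W ∖ c) d + (u# * Δ (W ∖ d) c + u# * (u# * Q (W ∖ d ∖ c)))))
      ≈⟨ *-congˡ (+-congˡ (+-congʳ (*-congˡ (+-congˡ (-‿cong (Q-cong (∖-comm W c d))))))) ⟩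
    s# * s# * ((Δ W c - Δ (W ∖ d) c) + (u# * (b - e) + (u# * Δ (W ∖ d) c + u# * (u# * e))))
      ≈⟨ solve 6 (λ s u a b f e → s :* s :* (((a :- b) :- (f :- e)) :+ (u :* (b :- e) :+ (u :* (f :- e) :+ u :* (u :* e))))
           := s :* (s :* a :+ (s :* u :- s) :* b) :+ (s :* u :- s) :* (s :* f :+ (s :* u :- s) :* e)) refl s# u# a b f′ e ⟩
    s# * (s# * a + (s# * u# - s#) * b) + (s# * u# - s#) * (s# * f′ + (s# * u# - s#) * e)
      ≈⟨ +-cong (*-congˡ (+-congˡ (*-congʳ edge≈))) (*-cong edge≈ (+-congˡ (*-congʳ edge≈))) ⟨
    s# * gain a b + edge * gain f′ e ∎)
    (Pos-* (Pos-* Pos-s Pos-s) (Pos-+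
      -- `Reach` is what `c` reaches inside `W`. Appending a step shows that it is closed along
      -- edges, and `separated` keeps `d` out of it.
      (second-difference-pos Reach W (λ i j Wi Wj reach g → reach ◅◅ ((g , Wj) ◅ ε)) c x d y Wc ε Wx
        (≡.trans (symG c x) (∧-trueˡ Nxc)) Wd (separated c d Nxc Nyd) Wy (≡.trans (symG d y) (∧-trueˡ Nyd)))
      (Pos-+ (Pos-* Pos-u (Δ-pos (W ∖ c) d y (∖-in W Wd (c≢d ∘ ≡.sym)) (∖-out W {i = y} Wy) (≡.trans (symG d y) (∧-trueˡ Nyd))))
      (Pos-+ (Pos-* Pos-u (Δ-pos (W ∖ d) c x (∖-in W Wc c≢d) (∖-out W {i = x} Wx) (≡.trans (symG c x) (∧-trueˡ Nxc))))
        (Pos-* Pos-u (Pos-* Pos-u (Q-pos (W ∖ d ∖ c) x (∖-out (W ∖ d) {i = x} (∖-out W {i = x} Wx)))))))))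
    where
    a = Q W
    b = Q (W ∖ c)
    f′ = Q (W ∖ d)
    e = Q (W ∖ d ∖ c)
    Reach : Fin n → Set
    Reach v = Star (λ i j → G i j ≡ true × W j ≡ true) c v
    Wc : W c ≡ true
    Wc = ∖-in (full ∖ y) (∖-in full ≡.refl (proj₂ (Nx-≢ Nxc))) (proj₁ (Nx-≢ Nxc))
    Wd : W d ≡ true
    Wd = ∖-in (full ∖ y) (∖-in full ≡.refl (proj₁ (Ny-≢ Nyd))) (proj₂ (Ny-≢ Nyd))
    c≢d : c ≢ d
    c≢d ≡.refl = true≢false (∧-trueˡ Nxc) (Ny-¬x c Nyd)

  -- `G` and `T` are both peeled down to `H`, whose sum cancels. Each moved neighbour `d` leaves the
  -- difference of its gains at `y` and at `x`, and `F-expand` evaluates both parts of it.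
  step-pos : Pos (P G (laplacian G) full - P T (laplacian T) full)
  step-pos = Pos-resp (sym (begin
    P G w full - P T (laplacian T) full
      ≈⟨ +-cong (peel-G full ≡.refl (λ d e → ∖-in full ≡.refl (proj₁ (Ny-≢ e))))
           (-‿cong (peel-T full ≡.refl (λ d e → ∖-in full ≡.refl (proj₂ (Ny-≢ e))))) ⟩
    (P H wH full + sum gy) - (P H wH full + sum gx)
      ≈⟨ solve 3 (λ a b c → (a :+ b) :- (a :+ c) := b :- c) refl _ _ _ ⟩
    sum gy - sum gx
      ≈⟨ sum-difference gy gx ⟩
    ∑[ d < n ] (gy d - gx d)
      ≈⟨ sum-cong-≋ {n} (λ d → solve 7 (λ i s e a b c f → i :* (s :* a :+ e :* b) :- i :* (s :* c :+ e :* f)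
           := i :* (s :* (a :- c) :+ e :* (b :- f))) refl _ s# edge _ _ _ _) ⟩
    ∑[ d < n ] (ι (Ny d) * (s# * (P H wH (full ∖ y) - P H wH (full ∖ x))
                           + edge * (P H wH (full ∖ y ∖ d) - P H wH (full ∖ x ∖ d)))) ∎))
    (Pos-sum (λ d → Pos-ι _ (λ e → Pos-resp (sym (inner d e)) (Pos-sum (λ c → Pos-ι _ (λ e′ → pair-pos c d e′ e))))))
    where
    gy gx : Fin n → Carrier
    gy d = ι (Ny d) * gain (P H wH (full ∖ y)) (P H wH (full ∖ y ∖ d))
    gx d = ι (Ny d) * gain (P H wH (full ∖ x)) (P H wH (full ∖ x ∖ d))
    inner : ∀ d → Ny d ≡ true →
      s# * (P H wH (full ∖ y) - P H wH (full ∖ x)) + edge * (P H wH (full ∖ y ∖ d) - P H wH (full ∖ x ∖ d))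
        ≈ ∑[ c < n ] (ι (Nx c) * (s# * gain (Q W) (Q (W ∖ c)) + edge * gain (Q (W ∖ d)) (Q (W ∖ d ∖ c))))
    inner d e = begin
      s# * (P H wH (full ∖ y) - P H wH (full ∖ x)) + edge * (P H wH (full ∖ y ∖ d) - P H wH (full ∖ x ∖ d))
        ≈⟨ +-cong (*-congˡ (F-expand full ≡.refl ≡.refl (λ _ → ≡.refl) (λ _ _ → ≡.refl))) (*-congˡ (begin
             P H wH (full ∖ y ∖ d) - P H wH (full ∖ x ∖ d)
               ≈⟨ +-cong (P-cong H wH (∖-comm full y d)) (-‿cong (P-cong H wH (∖-comm full x d))) ⟩
             P H wH (full ∖ d ∖ y) - P H wH (full ∖ d ∖ x)
               -- Removing `d` leaves the path and all of `Nx` in place, since `d` is neither on the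
               -- path nor adjacent to `x`.
               ≈⟨ F-expand (full ∖ d) (∖-in full ≡.refl (proj₂ (Ny-≢ e) ∘ ≡.sym)) (∖-in full ≡.refl (proj₁ (Ny-≢ e) ∘ ≡.sym))
                    (λ {m} m∈ → ∖-in full {i = m} ≡.refl (λ { ≡.refl → Ny-ms d e m∈ }))
                    (λ c e′ → ∖-in full {i = c} ≡.refl (λ { ≡.refl → true≢false (∧-trueˡ e′) (Ny-¬x d e) })) ⟩
             ∑[ c < n ] (ι (Nx c) * gain (Q (full ∖ d ∖ y ∖ x)) (Q (full ∖ d ∖ y ∖ x ∖ c)))
               ≈⟨ sum-cong-≋ {n} (λ c → *-congˡ (+-cong (*-congˡ (Q-cong move)) (*-congˡ (Q-cong (∖-cong c move))))) ⟩
             ∑[ c < n ] (ι (Nx c) * gain (Q (W ∖ d)) (Q (W ∖ d ∖ c))) ∎)) ⟩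
      s# * ∑[ c < n ] (ι (Nx c) * gain (Q W) (Q (W ∖ c))) + edge * ∑[ c < n ] (ι (Nx c) * gain (Q (W ∖ d)) (Q (W ∖ d ∖ c)))
        ≈⟨ +-cong (*-distribˡ-sum {n} s# _) (*-distribˡ-sum {n} edge _) ⟩
      ∑[ c < n ] (s# * (ι (Nx c) * gain (Q W) (Q (W ∖ c)))) + ∑[ c < n ] (edge * (ι (Nx c) * gain (Q (W ∖ d)) (Q (W ∖ d ∖ c))))
        ≈⟨ ∑-distrib-+ {n} _ _ ⟨
      ∑[ c < n ] (s# * (ι (Nx c) * gain (Q W) (Q (W ∖ c))) + edge * (ι (Nx c) * gain (Q (W ∖ d)) (Q (W ∖ d ∖ c))))
        ≈⟨ sum-cong-≋ {n} (λ c → solve 5 (λ s i a e b → s :* (i :* a) :+ e :* (i :* b) := i :* (s :* a :+ e :* b)) refl s# _ _ edge _) ⟩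
      _ ∎
      where
      move : full ∖ d ∖ y ∖ x ≗ W ∖ d
      move i = ≡.trans (∖-cong x (∖-comm full d y) i) (∖-comm (full ∖ y) d x i)

-- Monotonicity of the matching polynomial along the order on trees.

module Monotone {c ℓ p} {R : CommutativeRing c ℓ} {cone : Cone R p} (vars : Variables cone) {n : ℕ} where
  open Trees
  open Counting using (deg-size)

  open CommutativeRing R hiding (zero) renaming (_+_ to _⊕_; _-_ to _⊖_)
  open Cone cone
  open Variables vars using (α; β)
  open Laplacian vars {n}
  open WeightedMatchings R α β {n} using (P; relabel)
  open DifferenceSolver R using (solve; _:+_; _:-_; _:=_)

  matchingPolynomial : Graph n → Carrier
  matchingPolynomial G = P G (laplacian G) full

  iso-polynomial : ∀ {G H} → Tree G → Iso G H → matchingPolynomial H ≈ matchingPolynomial G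
  iso-polynomial {G} {H} tree iso@(σ , h) = relabel (Tree.symmetric tree) (Tree.symmetric (iso-tree {G = G} {H} iso tree)) σ full full
    (λ _ → ≡.refl) (λ i _ → reflexive (≡.cong degreeWeight (iso-degree {G = G} {H} iso i))) (λ i j _ _ → h i j)

  pointwise-iso : ∀ {G H : Graph n} → (∀ u v → H u v ≡ G u v) → Iso G H
  pointwise-iso p = Perm.id , p

  gts-step : ∀ {G H} → Tree G → IsGTS G H → Tree H × Pos (matchingPolynomial G ⊖ matchingPolynomial H)
  gts-step {G} {H} tree (x , y , ms , chain , uniq , two , h) = iso-tree {G = M.T} {H} iso M.T-tree ,
    Pos-resp (+-congˡ (-‿cong (sym (iso-polynomial {M.T} {H} M.T-tree iso))))
      (Step.step-pos vars tree x y ms chain uniq two′)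
    where
    two′ : ∀ {m} → m ∈ ms → size (G m) ≡ 2
    two′ {m} m∈ = ≡.trans (≡.sym (deg-size G m)) (All.lookup two m∈)
    module M = Move tree x y ms chain uniq two′
    iso : Iso M.T H
    iso = pointwise-iso {M.T} {H} h

  monotone : ∀ {G H} → Tree G → G ≤GTS H → Pos (matchingPolynomial G ⊖ matchingPolynomial H)
  monotone {G} tree ε = Pos-resp (sym (-‿inverseʳ (matchingPolynomial G))) Pos-0
  monotone {G} {H} tree (_◅_ {j = L} (inj₁ iso) rest) =
    Pos-resp (+-congʳ (iso-polynomial {G} {L} tree iso)) (monotone {L} {H} (iso-tree {G = G} {L} iso tree) rest)
  monotone {G} {H} tree (_◅_ {j = L} (inj₂ (K , move , iso)) rest) =
    Pos-resp (telescope (matchingPolynomial G) (matchingPolynomial K) (matchingPolynomial H)) (Pos-+ (proj₂ moved)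
      (Pos-resp (+-congʳ (iso-polynomial {K} {L} (proj₁ moved) iso))
        (monotone {L} {H} (iso-tree {G = K} {L} iso (proj₁ moved)) rest)))
    where
    moved : Tree K × Pos (matchingPolynomial G ⊖ matchingPolynomial K)
    moved = gts-step {G} {K} tree move
    telescope : ∀ a b c → (a ⊖ b) ⊕ (b ⊖ c) ≈ a ⊖ c
    telescope = solve 3 (λ a b c → (a :- b) :+ (b :- c) := a :- c) refl

-- Monomial coefficients of power sums for partitions into parts 1 and 2.

module Pascal where
  open import Data.Nat.Base
  open import Data.Nat.Properties
  open import Relation.Binary.PropositionalEquality

  binom : ℕ → ℕ → ℕ
  binom zero    zero    = 1
  binom zero    (suc a) = 0
  binom (suc j) zero    = 1
  binom (suc j) (suc a) = binom j a + binom j (suc a)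

  binom-zero : ∀ j → binom j 0 ≡ 1
  binom-zero zero    = refl
  binom-zero (suc j) = refl

  absorption : ∀ j a → suc a * binom (suc j) (suc a) ≡ suc j * binom j a
  absorption zero zero = refl
  absorption zero (suc a) = trans (cong (suc (suc a) *_) (+-identityʳ (binom 0 (suc a)))) (*-zeroʳ a)
  absorption (suc j) zero = trans (*-identityˡ _) (trans (cong suc (trans (sym (*-identityˡ _)) (absorption j 0)))
    (cong (λ b → suc (suc j * b)) (binom-zero j)))
  absorption (suc j) (suc a) = begin
    suc (suc a) * (binom (suc j) (suc a) + binom (suc j) (suc (suc a)))
      ≡⟨ *-distribˡ-+ (suc (suc a)) (binom (suc j) (suc a)) _ ⟩
    binom (suc j) (suc a) + suc a * binom (suc j) (suc a) + suc (suc a) * binom (suc j) (suc (suc a))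
      ≡⟨ cong₂ (λ p q → binom (suc j) (suc a) + p + q) (absorption j a) (absorption j (suc a)) ⟩
    binom (suc j) (suc a) + suc j * binom j a + suc j * binom j (suc a)
      ≡⟨ +-assoc (binom (suc j) (suc a)) _ _ ⟩
    binom (suc j) (suc a) + (suc j * binom j a + suc j * binom j (suc a))
      ≡⟨ cong (binom (suc j) (suc a) +_) (*-distribˡ-+ (suc j) (binom j a) _) ⟨
    suc (suc j) * binom (suc j) (suc a) ∎
    where open ≡-Reasoning

module Counts where
  open import Data.Nat.Base
  open import Data.Nat.Properties
  open import Relation.Binary.PropositionalEquality
  open Defs using (product)
  open Pascal

  twosOnes : ℕ → ℕ → List ℕ
  twosOnes a b = replicate a 2 ++ replicate b 1

  -- Fillings of p boxes of capacity 2 and r boxes of capacity 1 by a blocks of size 2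
  -- and b blocks of size 1, all distinguishable.
  fillings : ℕ → ℕ → ℕ → ℕ → ℕ
  fillings (suc a) b       p       r = p * fillings a b (pred p) r
  fillings zero    (suc b) p       r = p * fillings zero b (pred p) (suc r) + r * fillings zero b p (pred r)
  fillings zero    zero    zero    zero    = 1
  fillings zero    zero    zero    (suc r) = 0
  fillings zero    zero    (suc p) r       = 0

  -- Seen as slots, the boxes receive the blocks in `b !` ways, and the two slots of a box of
  -- capacity 2 are interchangeable.
  fillings-ones : ∀ b p r → 2 * p + r ≡ b → 2 ^ p * fillings 0 b p r ≡ b !
  fillings-ones zero zero zero e = refl
  fillings-ones (suc b) zero (suc r) e = trans (*-identityˡ _) (cong₂ _*_ e
    (trans (sym (*-identityˡ _)) (fillings-ones b 0 r (suc-injective e))))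
  fillings-ones (suc b) (suc p) zero e = begin
    2 * 2 ^ p * (suc p * fillings 0 b p 1 + 0)        ≡⟨ rearrange (2 ^ p) (suc p) (fillings 0 b p 1) ⟩
    2 * suc p * (2 ^ p * fillings 0 b p 1)            ≡⟨ cong₂ _*_ (trans (sym (+-identityʳ _)) e)
      (fillings-ones b p 1 (suc-injective (trans (shuffle p 0) e))) ⟩
    suc b * b ! ∎
    where
    open ≡-Reasoning
    rearrange : ∀ x y z → 2 * x * (y * z + 0) ≡ 2 * y * (x * z)
    rearrange = solve-∀
    shuffle : ∀ p r → suc (2 * p + suc r) ≡ 2 * suc p + r
    shuffle = solve-∀
  fillings-ones (suc b) (suc p) (suc r) e = begin
    2 * 2 ^ p * (suc p * fillings 0 b p (suc (suc r)) + suc r * fillings 0 b (suc p) r)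
      ≡⟨ rearrange (2 ^ p) (suc p) (fillings 0 b p (suc (suc r))) (suc r) _ ⟩
    2 * suc p * (2 ^ p * fillings 0 b p (suc (suc r))) + suc r * (2 ^ suc p * fillings 0 b (suc p) r)
      ≡⟨ cong₂ (λ x y → 2 * suc p * x + suc r * y) (fillings-ones b p (suc (suc r)) (suc-injective (trans (shuffle p r) e)))
           (fillings-ones b (suc p) r (suc-injective (trans (shuffle′ p r) e))) ⟩
    2 * suc p * b ! + suc r * b !
      ≡⟨ *-distribʳ-+ (b !) (2 * suc p) (suc r) ⟨
    (2 * suc p + suc r) * b !
      ≡⟨ cong (_* b !) e ⟩
    suc b * b ! ∎
    where
    open ≡-Reasoning
    rearrange : ∀ x y z w v → 2 * x * (y * z + w * v) ≡ 2 * y * (x * z) + w * (2 * x * v)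
    rearrange = solve-∀
    shuffle : ∀ p r → suc (2 * p + suc (suc r)) ≡ 2 * suc p + suc r
    shuffle = solve-∀
    shuffle′ : ∀ p r → suc (2 * suc p + r) ≡ 2 * suc p + suc r
    shuffle′ = solve-∀

  -- The blocks of size 2 choose `a` of the `j` large boxes, in `binom j a * a !` ways, and the
  -- other large boxes supply the remaining powers of 2 through `fillings-ones`. The factor
  -- `b ! * (2 ^ a * a !)` is kept whole because it is `zee (twosOnes a b)`.
  fillings-binom : ∀ a b j c → 2 * a + b ≡ 2 * j + c → 2 ^ j * fillings a b j c ≡ binom j a * (b ! * (2 ^ a * a !))
  fillings-binom zero b j c e = trans (fillings-ones b j c (sym e))
    (trans (sym (*-identityʳ _)) (trans (sym (*-identityˡ _)) (cong (_* (b ! * 1)) (sym (binom-zero j)))))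
  fillings-binom (suc a) b zero c e = refl
  fillings-binom (suc a) b (suc j) c e = begin
    2 * 2 ^ j * (suc j * fillings a b j c)
      ≡⟨ rearrange (2 ^ j) (suc j) _ ⟩
    2 * suc j * (2 ^ j * fillings a b j c)
      ≡⟨ cong (2 * suc j *_) (fillings-binom a b j c (suc-injective (suc-injective (trans (sym (shift a b)) (trans e (shift j c)))))) ⟩
    2 * suc j * (binom j a * (b ! * (2 ^ a * a !)))
      ≡⟨ regroup (suc j) (binom j a) _ ⟩
    suc j * binom j a * (2 * (b ! * (2 ^ a * a !)))
      ≡⟨ cong (_* (2 * (b ! * (2 ^ a * a !)))) (absorption j a) ⟨
    suc a * binom (suc j) (suc a) * (2 * (b ! * (2 ^ a * a !)))
      ≡⟨ finish (suc a) (binom (suc j) (suc a)) (b !) (2 ^ a) (a !) ⟩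
    binom (suc j) (suc a) * (b ! * (2 * 2 ^ a * (suc a * a !))) ∎
    where
    open ≡-Reasoning
    rearrange : ∀ x y z → 2 * x * (y * z) ≡ 2 * y * (x * z)
    rearrange = solve-∀
    regroup : ∀ x y z → 2 * x * (y * z) ≡ x * y * (2 * z)
    regroup = solve-∀
    finish : ∀ x y z w v → x * y * (2 * (z * (w * v))) ≡ y * (z * (2 * w * (x * v)))
    finish = solve-∀
    shift : ∀ a b → 2 * suc a + b ≡ suc (suc (2 * a + b))
    shift = solve-∀

  occ : ℕ → List ℕ → ℕ
  occ k = countB (λ m → m ≡ᵇ k)

  Small : List ℕ → Set
  Small = All (_≤ 2)

  subAt-small : ∀ v i m → Small v → Small (subAt v i m)
  subAt-small []      i       m h       = []
  subAt-small (a ∷ v) zero    m (p ∷ h) = ≤-trans (m∸n≤m a m) p ∷ h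
  subAt-small (a ∷ v) (suc i) m (p ∷ h) = p ∷ subAt-small v i m h

  lookup-small : ∀ v i → Small v → lookupL v i ≤ 2
  lookup-small []      i       h       = z≤n
  lookup-small (a ∷ v) zero    (p ∷ h) = p
  lookup-small (a ∷ v) (suc i) (p ∷ h) = lookup-small v i h

  occ-step : ∀ k a v → occ k (a ∷ v) ≡ (if a ≡ᵇ k then 1 else 0) + occ k v
  occ-step k a v with a ≡ᵇ k
  ... | true  = refl
  ... | false = refl

  -- The old and the new entry appear on opposite sides so that no count is subtracted. A positive
  -- lookup certifies that `i` is in range, since `lookupL` returns 0 beyond the end.
  occ-subAt : ∀ k v i m x → lookupL v i ≡ suc x →
    (if suc x ≡ᵇ k then 1 else 0) + occ k (subAt v i m) ≡ (if suc x ∸ m ≡ᵇ k then 1 else 0) + occ k v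
  occ-subAt k (a ∷ v) zero m x refl = begin
    y + occ k (a ∸ m ∷ v)  ≡⟨ cong (y +_) (occ-step k (a ∸ m) v) ⟩
    y + (y′ + occ k v)     ≡⟨ swap y y′ (occ k v) ⟩
    y′ + (y + occ k v)     ≡⟨ cong (y′ +_) (occ-step k a v) ⟨
    y′ + occ k (a ∷ v)     ∎
    where
    open ≡-Reasoning
    y = if a ≡ᵇ k then 1 else 0
    y′ = if a ∸ m ≡ᵇ k then 1 else 0
    swap : ∀ p q r → p + (q + r) ≡ q + (p + r)
    swap = solve-∀
  occ-subAt k (a ∷ v) (suc i) m x e = begin
    y + occ k (a ∷ subAt v i m)     ≡⟨ cong (y +_) (occ-step k a (subAt v i m)) ⟩
    y + (w + occ k (subAt v i m))   ≡⟨ swap y w _ ⟩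
    w + (y + occ k (subAt v i m))   ≡⟨ cong (w +_) (occ-subAt k v i m x e) ⟩
    w + (y′ + occ k v)              ≡⟨ swap w y′ _ ⟩
    y′ + (w + occ k v)              ≡⟨ cong (y′ +_) (occ-step k a v) ⟨
    y′ + occ k (a ∷ v)              ∎
    where
    open ≡-Reasoning
    y = if suc x ≡ᵇ k then 1 else 0
    y′ = if suc x ∸ m ≡ᵇ k then 1 else 0
    w = if a ≡ᵇ k then 1 else 0
    swap : ∀ p q r → p + (q + r) ≡ q + (p + r)
    swap = solve-∀

  sum-cong : ∀ {A : Set} {f g : A → ℕ} l → (∀ i → f i ≡ g i) → Defs.sum (map f l) ≡ Defs.sum (map g l)
  sum-cong l p = cong Defs.sum (List.map-cong p l)

  sum-lookup : ∀ (h : ℕ → ℕ) v → Defs.sum (map (h ∘ lookupL v) (upTo (length v))) ≡ Defs.sum (map h v)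
  sum-lookup h v = trans (cong Defs.sum (List.map-upTo (h ∘ lookupL v) (length v))) (go v)
    where
    go : ∀ v → Defs.sum (applyUpTo (h ∘ lookupL v) (length v)) ≡ Defs.sum (map h v)
    go []      = refl
    go (a ∷ v) = cong (h a +_) (go v)

  sum-occ : ∀ h v → h 0 ≡ 0 → Small v → Defs.sum (map h v) ≡ occ 2 v * h 2 + occ 1 v * h 1
  sum-occ h []      h0 _ = refl
  sum-occ h (a ∷ v) h0 (p ∷ s) = go a p
    where
    open ≡-Reasoning
    ih = sum-occ h v h0 s
    go : ∀ a → a ≤ 2 → h a + Defs.sum (map h v) ≡ occ 2 (a ∷ v) * h 2 + occ 1 (a ∷ v) * h 1
    go 0 _ = trans (cong₂ _+_ h0 ih) refl
    go 1 _ = trans (cong (h 1 +_) ih) (swap (h 1) (occ 2 v * h 2) (occ 1 v * h 1))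
      where
      swap : ∀ x y z → x + (y + z) ≡ y + (x + z)
      swap = solve-∀
    go 2 _ = trans (cong (h 2 +_) ih) (sym (+-assoc (h 2) _ _))
    go (suc (suc (suc a))) (s≤s (s≤s ()))

  -- A summand of countA is nonzero only at entries 1 and 2 of the list.
  countA-step : ∀ m μ v (h : ℕ → ℕ) → Small v → h 0 ≡ 0 →
    (∀ i x → lookupL v i ≡ suc x → (if m ≤ᵇ suc x then countA μ (subAt v i m) else 0) ≡ h (suc x)) →
    (m ≤ᵇ 0) ≡ false →
    countA (m ∷ μ) v ≡ occ 2 v * h 2 + occ 1 v * h 1
  countA-step m μ v h s h0 p m>0 = trans (sum-cong (upTo (length v)) (λ i → at i (lookupL v i) refl))
    (trans (sum-lookup h v) (sum-occ h v h0 s))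
    where
    at : ∀ i x → lookupL v i ≡ x → (if m ≤ᵇ lookupL v i then countA μ (subAt v i m) else 0) ≡ h (lookupL v i)
    at i zero    e rewrite e | m>0 = sym h0
    at i (suc x) e = trans (cong (λ y → if m ≤ᵇ y then countA μ (subAt v i m) else 0) e) (trans (p i x e) (cong h (sym e)))

  countA-empty : ∀ v → Small v → (if allB (λ a → a ≡ᵇ 0) v then 1 else 0) ≡ fillings 0 0 (occ 2 v) (occ 1 v)
  countA-empty []      _       = refl
  countA-empty (0 ∷ v) (p ∷ s) = countA-empty v s
  countA-empty (1 ∷ v) (p ∷ s) with occ 2 v
  ... | zero  = refl
  ... | suc _ = refl
  countA-empty (2 ∷ v) (p ∷ s) = refl
  countA-empty (suc (suc (suc a)) ∷ v) (s≤s (s≤s ()) ∷ s)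

  countA-fillings : ∀ a b v → Small v → countA (twosOnes a b) v ≡ fillings a b (occ 2 v) (occ 1 v)
  countA-fillings (suc a) b v s = trans (countA-step 2 (twosOnes a b) v h s refl at refl)
    (trans (cong (occ 2 v * h 2 +_) (*-zeroʳ (occ 1 v))) (+-identityʳ _))
    where
    h : ℕ → ℕ
    h 2 = fillings a b (pred (occ 2 v)) (occ 1 v)
    h _ = 0
    at : ∀ i x → lookupL v i ≡ suc x → (if 2 ≤ᵇ suc x then countA (twosOnes a b) (subAt v i 2) else 0) ≡ h (suc x)
    at i 0 e = refl
    at i 1 e = trans (countA-fillings a b (subAt v i 2) (subAt-small v i 2 s))
      (cong₂ (fillings a b) (cong pred (occ-subAt 2 v i 2 1 e)) (occ-subAt 1 v i 2 1 e))
    at i (suc (suc x)) e with s≤s (s≤s ()) ← ≤-trans (≤-reflexive (sym e)) (lookup-small v i s)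
  countA-fillings zero (suc b) v s = countA-step 1 (twosOnes 0 b) v h s refl at refl
    where
    h : ℕ → ℕ
    h 1 = fillings 0 b (occ 2 v) (pred (occ 1 v))
    h 2 = fillings 0 b (pred (occ 2 v)) (suc (occ 1 v))
    h _ = 0
    at : ∀ i x → lookupL v i ≡ suc x → (if 1 ≤ᵇ suc x then countA (twosOnes 0 b) (subAt v i 1) else 0) ≡ h (suc x)
    at i 0 e = trans (countA-fillings 0 b (subAt v i 1) (subAt-small v i 1 s))
      (cong₂ (fillings 0 b) (occ-subAt 2 v i 1 0 e) (cong pred (occ-subAt 1 v i 1 0 e)))
    at i 1 e = trans (countA-fillings 0 b (subAt v i 1) (subAt-small v i 1 s))
      (cong₂ (fillings 0 b) (cong pred (occ-subAt 2 v i 1 1 e)) (occ-subAt 1 v i 1 1 e))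
    at i (suc (suc x)) e with s≤s (s≤s ()) ← ≤-trans (≤-reflexive (sym e)) (lookup-small v i s)
  countA-fillings zero zero v s = countA-empty v s

  Big : List ℕ → Set
  Big = Any (3 ≤_)

  sum-zero : ∀ {A : Set} {f : A → ℕ} l → (∀ i → f i ≡ 0) → Defs.sum (map f l) ≡ 0
  sum-zero []      p = refl
  sum-zero (i ∷ l) p = cong₂ _+_ (p i) (sum-zero l p)

  -- A part of size at least 3 fits into no entry of `v`. Hence coefficients at partitions into
  -- parts 1 and 2 involve only cycle types of the same form.
  countA-big : ∀ μ v → Small v → Big μ → countA μ v ≡ 0
  countA-big (m ∷ μ) v s big = sum-zero (upTo (length v)) (at big)
    where
    at : Big (m ∷ μ) → ∀ i → (if m ≤ᵇ lookupL v i then countA μ (subAt v i m) else 0) ≡ 0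
    at (here m≥3) i = cong (if_then countA μ (subAt v i m) else 0) (≢true⇒≡false (λ e →
      <-irrefl refl (≤-trans m≥3 (≤-trans (≤ᵇ⇒≤ m _ (≡true⇒T e)) (lookup-small v i s)))))
      where
      open import Data.Bool using (T)
      ≡true⇒T : ∀ {b} → b ≡ true → T b
      ≡true⇒T refl = _
    at (there big) i with m ≤ᵇ lookupL v i
    ... | true  = countA-big μ (subAt v i m) (subAt-small v i m s) big
    ... | false = refl

  occ-replicate : ∀ k c a v → occ k (replicate a c ++ v) ≡ (if c ≡ᵇ k then a else 0) + occ k v
  occ-replicate k c zero v with c ≡ᵇ k
  ... | true  = refl
  ... | false = refl
  occ-replicate k c (suc a) v = trans (occ-step k c (replicate a c ++ v))
    (trans (cong ((if c ≡ᵇ k then 1 else 0) +_) (occ-replicate k c a v)) (add (c ≡ᵇ k)))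
    where
    add : ∀ t → (if t then 1 else 0) + ((if t then a else 0) + occ k v) ≡ (if t then suc a else 0) + occ k v
    add true  = refl
    add false = refl

  occ-twosOnes : ∀ k a b → occ k (twosOnes a b) ≡ (if 2 ≡ᵇ k then a else 0) + (if 1 ≡ᵇ k then b else 0)
  occ-twosOnes k a b = trans (occ-replicate k 2 a (replicate b 1)) (cong ((if 2 ≡ᵇ k then a else 0) +_) ones)
    where
    ones : occ k (replicate b 1) ≡ (if 1 ≡ᵇ k then b else 0)
    ones = trans (cong (occ k) (sym (List.++-identityʳ (replicate b 1)))) (trans (occ-replicate k 1 b []) (+-identityʳ _))

  sum-twosOnes : ∀ a b → Defs.sum (twosOnes a b) ≡ 2 * a + b
  sum-twosOnes zero zero = refl
  sum-twosOnes zero (suc b) = cong suc (sum-twosOnes zero b)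
  sum-twosOnes (suc a) b = trans (cong (2 +_) (sum-twosOnes a b)) (shift a b)
    where
    shift : ∀ a b → 2 + (2 * a + b) ≡ 2 * suc a + b
    shift = solve-∀

  small-twosOnes : ∀ a b → Small (twosOnes a b)
  small-twosOnes zero zero = []
  small-twosOnes zero (suc b) = s≤s z≤n ∷ small-twosOnes zero b
  small-twosOnes (suc a) b = ≤-refl ∷ small-twosOnes a b

  zee-factor : List ℕ → ℕ → ℕ
  zee-factor μ i = (i ^ occ i μ) * (occ i μ) !

  product-one : ∀ {f : ℕ → ℕ} n → (∀ i → f i ≡ 1) → product (applyUpTo f n) ≡ 1
  product-one zero    p = refl
  product-one (suc n) p = cong₂ _*_ (p 0) (product-one n (p ∘ suc))

  zee-twosOnes : ∀ a b → zee (twosOnes a b) ≡ b ! * (2 ^ a * a !)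
  zee-twosOnes a b = trans (cong product (trans (cong (λ k → map (zee-factor μ) (map suc (upTo k))) (sum-twosOnes a b))
      (trans (sym (List.map-∘ (upTo (2 * a + b)))) (List.map-upTo (zee-factor μ ∘ suc) (2 * a + b)))))
    (go (2 * a + b) a b refl (λ i → occ-twosOnes i a b))
    where
    μ = twosOnes a b
    shift : ∀ a b → 2 * suc a + b ≡ suc (suc (2 * a + b))
    shift = solve-∀
    one : ∀ c → 1 ^ c ≡ 1
    one = ^-zeroˡ
    go : ∀ k a b → 2 * a + b ≡ k → (∀ i → occ i μ ≡ (if 2 ≡ᵇ i then a else 0) + (if 1 ≡ᵇ i then b else 0)) →
      product (applyUpTo (zee-factor μ ∘ suc) k) ≡ b ! * (2 ^ a * a !)
    go zero zero zero e h = refl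
    go (suc zero) zero (suc zero) e h rewrite h 1 = refl
    go (suc zero) (suc a) b e h with () ← trans (sym (shift a b)) e
    go (suc (suc k)) a b e h = trans (cong₂ _*_ first (cong₂ _*_ second (product-one k others))) (cong (b ! *_) (*-identityʳ _))
      where
      first : zee-factor μ 1 ≡ b !
      first rewrite h 1 = trans (cong (_* b !) (one b)) (*-identityˡ _)
      second : zee-factor μ 2 ≡ 2 ^ a * a !
      second rewrite h 2 | +-identityʳ a = refl
      others : ∀ i → zee-factor μ (suc (suc (suc i))) ≡ 1
      others i rewrite h (suc (suc (suc i))) = refl

-- Naturals as rationals, and binomial inversion.

module RationalNaturals where
  open import Data.Rational using (_+_; _*_)
  open import Relation.Binary.PropositionalEquality hiding ([_])

  private
    toᵘ : ∀ k → ℚ.toℚᵘ (ℕtoℚ k) ℚᵘ.≃ ℚᵘ.mkℚᵘ (ℤ.+ k) 0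
    toᵘ k = ℚ.toℚᵘ-fromℚᵘ (ℚᵘ.mkℚᵘ (ℤ.+ k) 0)

  ℕtoℚ-+ : ∀ a b → ℕtoℚ (a ℕ.+ b) ≡ ℕtoℚ a + ℕtoℚ b
  ℕtoℚ-+ a b = ℚ.toℚᵘ-injective (ℚᵘ.≃-trans (toᵘ (a ℕ.+ b)) (ℚᵘ.≃-sym (ℚᵘ.≃-trans (ℚ.toℚᵘ-homo-+ (ℕtoℚ a) (ℕtoℚ b))
    (ℚᵘ.≃-trans (ℚᵘ.+-cong (toᵘ a) (toᵘ b)) (ℚᵘ.*≡* (cong (ℤ._* ℤ.+ 1) (cong₂ ℤ._+_ (ℤ.*-identityʳ (ℤ.+ a)) (ℤ.*-identityʳ (ℤ.+ b)))))))))

  ℕtoℚ-* : ∀ a b → ℕtoℚ (a ℕ.* b) ≡ ℕtoℚ a * ℕtoℚ b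
  ℕtoℚ-* a b = ℚ.toℚᵘ-injective (ℚᵘ.≃-trans (toᵘ (a ℕ.* b)) (ℚᵘ.≃-sym (ℚᵘ.≃-trans (ℚ.toℚᵘ-homo-* (ℕtoℚ a) (ℕtoℚ b))
    (ℚᵘ.≃-trans (ℚᵘ.*-cong (toᵘ a) (toᵘ b)) (ℚᵘ.*≡* (cong (ℤ._* ℤ.+ 1) (sym (ℤ.pos-* a b))))))))

  ℕtoℚ-≥0 : ∀ a → 0ℚ ℚ.≤ ℕtoℚ a
  ℕtoℚ-≥0 a = ℚ.toℚᵘ-cancel-≤ (ℚᵘ.≤-trans (ℚᵘ.nonNegative⁻¹ (ℚᵘ.mkℚᵘ (ℤ.+ a) 0)) (ℚᵘ.≤-reflexive (ℚᵘ.≃-sym (toᵘ a))))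

  recip-inverse : ∀ k → recipℕ (suc k) * ℕtoℚ (suc k) ≡ 1ℚ
  recip-inverse k = ℚ.toℚᵘ-injective (ℚᵘ.≃-trans (ℚ.toℚᵘ-homo-* (recipℕ (suc k)) (ℕtoℚ (suc k)))
    (ℚᵘ.≃-trans (ℚᵘ.*-cong (ℚ.toℚᵘ-fromℚᵘ (ℚᵘ.mkℚᵘ (ℤ.+ 1) k)) (toᵘ (suc k)))
      (ℚᵘ.*≡* (trans (ℤ.*-identityʳ _) (cong (λ m → ℤ.+ suc m) (trans (ℕ.+-identityʳ k) (sym (trans (ℕ.+-identityʳ _) (ℕ.*-identityʳ k)))))))))

module Differences where
  open import Data.Rational using (_+_; _*_; _-_; -_)
  open import Relation.Binary.PropositionalEquality hiding ([_])
  open DifferenceSolver ℚ.+-*-commutativeRing using (solve; _:+_; _:-_; _:=_)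
  open Pascal
  open RationalNaturals
  open import Data.Nat.Base using (_≤_)

  tl : (ℕ → ℚ) → ℕ → ℚ
  tl g a = g (suc a)

  -- half g r is the sum of g a over all a with 2 a ≤ r.
  half : (ℕ → ℚ) → ℕ → ℚ
  half g 0             = g 0
  half g 1             = g 0
  half g (suc (suc r)) = g 0 + half (tl g) r

  -- The binomial transform, the sum of `binom j a` times `g a` over all `a`, built by Pascal's rule
  -- on shifted sequences. Its inverse is `difference`, the iterated forward difference at 0.
  binomial : (ℕ → ℚ) → ℕ → ℚ
  binomial g zero    = g 0
  binomial g (suc j) = binomial g j + binomial (tl g) j

  difference : (ℕ → ℚ) → ℕ → ℚ
  difference h zero    = h 0
  difference h (suc a) = difference (tl h) a - difference h a

  double-suc : ∀ a → 2 ℕ.* suc a ≡ suc (suc (2 ℕ.* a))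
  double-suc a = ℕ.*-suc 2 a

  half-cong : ∀ r {g h} → (∀ a → 2 ℕ.* a ≤ r → g a ≡ h a) → half g r ≡ half h r
  half-cong 0 p = p 0 z≤n
  half-cong 1 p = p 0 z≤n
  half-cong (suc (suc r)) p = cong₂ _+_ (p 0 z≤n)
    (half-cong r (λ a q → p (suc a) (ℕ.≤-trans (ℕ.≤-reflexive (double-suc a)) (s≤s (s≤s q)))))

  half-+ : ∀ r g h → half (λ a → g a + h a) r ≡ half g r + half h r
  half-+ 0 g h = refl
  half-+ 1 g h = refl
  half-+ (suc (suc r)) g h = trans (cong ((g 0 + h 0) +_) (half-+ r (tl g) (tl h)))
    (solve 4 (λ a b c d → (a :+ b) :+ (c :+ d) := (a :+ c) :+ (b :+ d)) refl (g 0) (h 0) _ _)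

  half-* : ∀ r x g → x * half g r ≡ half (λ a → x * g a) r
  half-* 0 x g = refl
  half-* 1 x g = refl
  half-* (suc (suc r)) x g = trans (ℚ.*-distribˡ-+ x (g 0) _) (cong (x * g 0 +_) (half-* r x (tl g)))

  half-zero : ∀ r {g} → (∀ a → g a ≡ 0ℚ) → half g r ≡ 0ℚ
  half-zero 0 p = p 0
  half-zero 1 p = p 0
  half-zero (suc (suc r)) p = trans (cong₂ _+_ (p 0) (half-zero r (p ∘ suc))) (ℚ.+-identityʳ 0ℚ)

  one-* : ∀ j x → ℕtoℚ (binom j 0) * x ≡ x
  one-* j x = trans (cong (λ b → ℕtoℚ b * x) (binom-zero j)) (ℚ.*-identityˡ x)

  -- The bound `2 * j ≤ r` keeps every nonzero `binom j a` inside the truncated sum.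
  half-binom : ∀ j g r → 2 ℕ.* j ≤ r → half (λ a → ℕtoℚ (binom j a) * g a) r ≡ binomial g j
  half-binom zero g 0 _ = one-* 0 (g 0)
  half-binom zero g 1 _ = one-* 0 (g 0)
  half-binom zero g (suc (suc r)) _ = trans (cong₂ _+_ (one-* 0 (g 0)) (half-zero r (λ a → ℚ.*-zeroˡ (g (suc a))))) (ℚ.+-identityʳ _)
  half-binom (suc j) g r p with r | ℕ.≤-trans (ℕ.≤-reflexive (sym (double-suc j))) p
  ... | suc (suc r) | s≤s (s≤s q) = begin
    ℕtoℚ (binom (suc j) 0) * g 0 + half (λ a → ℕtoℚ (binom j a ℕ.+ binom j (suc a)) * g (suc a)) r
      ≡⟨ cong₂ _+_ (trans (one-* (suc j) (g 0)) (sym (one-* j (g 0))))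
           (trans (half-cong r (λ a _ → trans (cong (_* g (suc a)) (ℕtoℚ-+ (binom j a) (binom j (suc a))))
              (ℚ.*-distribʳ-+ (g (suc a)) (ℕtoℚ (binom j a)) _)))
             (half-+ r (λ a → ℕtoℚ (binom j a) * g (suc a)) (λ a → ℕtoℚ (binom j (suc a)) * g (suc a)))) ⟩
    ℕtoℚ (binom j 0) * g 0 + (half (λ a → ℕtoℚ (binom j a) * g (suc a)) r + half (λ a → ℕtoℚ (binom j (suc a)) * g (suc a)) r)
      ≡⟨ solve 3 (λ x y z → x :+ (y :+ z) := (x :+ z) :+ y) refl (ℕtoℚ (binom j 0) * g 0)
           (half (λ a → ℕtoℚ (binom j a) * g (suc a)) r) (half (λ a → ℕtoℚ (binom j (suc a)) * g (suc a)) r) ⟩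
    half (λ a → ℕtoℚ (binom j a) * g a) (suc (suc r)) + half (λ a → ℕtoℚ (binom j a) * g (suc a)) r
      ≡⟨ cong₂ _+_ (half-binom j g (suc (suc r)) (ℕ.≤-trans q (ℕ.≤-trans (ℕ.n≤1+n r) (ℕ.n≤1+n _)))) (half-binom j (tl g) r q) ⟩
    binomial g j + binomial (tl g) j ∎
    where open ≡-Reasoning

  difference-cong : ∀ a {h h′} → (∀ i → i ≤ a → h i ≡ h′ i) → difference h a ≡ difference h′ a
  difference-cong zero    p = p 0 z≤n
  difference-cong (suc a) p = cong₂ _-_ (difference-cong a (λ i q → p (suc i) (s≤s q)))
    (difference-cong a (λ i q → p i (ℕ.m≤n⇒m≤1+n q)))

  difference-+ : ∀ a g h → difference (λ i → g i + h i) a ≡ difference g a + difference h a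
  difference-+ zero    g h = refl
  difference-+ (suc a) g h = trans (cong₂ _-_ (difference-+ a (tl g) (tl h)) (difference-+ a g h))
    (solve 4 (λ a b c d → (a :+ b) :- (c :+ d) := (a :- c) :+ (b :- d)) refl (difference (tl g) a) (difference (tl h) a) (difference g a) (difference h a))

  difference-binomial : ∀ a g → difference (binomial g) a ≡ g a
  difference-binomial zero    g = refl
  difference-binomial (suc a) g = begin
    difference (λ j → binomial g j + binomial (tl g) j) a - difference (binomial g) a
      ≡⟨ cong (_- difference (binomial g) a) (difference-+ a (binomial g) (binomial (tl g))) ⟩
    (difference (binomial g) a + difference (binomial (tl g)) a) - difference (binomial g) a
      ≡⟨ solve 2 (λ x y → (x :+ y) :- x := y) refl (difference (binomial g) a) _ ⟩
    difference (binomial (tl g)) a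
      ≡⟨ difference-binomial a (tl g) ⟩
    g (suc a) ∎
    where open ≡-Reasoning

-- The inverse Frobenius image of a monomial symmetric function on involutions.

module ClassFunction where
  open import Data.Rational using (_+_; _*_)
  open import Relation.Binary.PropositionalEquality hiding ([_])
  open DifferenceSolver ℚ.+-*-commutativeRing using (solve; _:*_; _:=_)
  open Pascal
  open RationalNaturals
  open Counts
  open Differences
  open import Data.Nat.Base using (_∸_; _^_; _!; _≤_; _⊓_)

  listSum : (List ℕ → ℚ) → List (List ℕ) → ℚ
  listSum F l = foldr _+_ 0ℚ (map F l)

  listSum-++ : ∀ F k l → listSum F (k ++ l) ≡ listSum F k + listSum F l
  listSum-++ F []      l = sym (ℚ.+-identityˡ _)
  listSum-++ F (μ ∷ k) l = trans (cong (F μ +_) (listSum-++ F k l)) (sym (ℚ.+-assoc (F μ) _ _))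

  listSum-map : ∀ F (g : List ℕ → List ℕ) l → listSum F (map g l) ≡ listSum (F ∘ g) l
  listSum-map F g l = cong (foldr _+_ 0ℚ) (sym (List.map-∘ l))

  listSum-zero : ∀ {F} l → (∀ μ → F μ ≡ 0ℚ) → listSum F l ≡ 0ℚ
  listSum-zero []      p = refl
  listSum-zero (μ ∷ l) p = trans (cong₂ _+_ (p μ) (listSum-zero l p)) (ℚ.+-identityˡ 0ℚ)

  listSum-big : ∀ F (Q : ℕ → List (List ℕ)) (f : ℕ → ℕ) q → (∀ i → 2 ≤ f i) → (∀ μ → Big μ → F μ ≡ 0ℚ) →
    listSum F (concatMap (λ k → map (k ∷_) (Q k)) (map suc (applyUpTo f q))) ≡ 0ℚ
  listSum-big F Q f zero    f≥2 vanish = refl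
  listSum-big F Q f (suc q) f≥2 vanish = trans (listSum-++ F (map (suc (f 0) ∷_) (Q (suc (f 0)))) _)
    (trans (cong₂ _+_ (trans (listSum-map F (suc (f 0) ∷_) (Q (suc (f 0)))) (listSum-zero (Q (suc (f 0))) (λ μ → vanish _ (here (s≤s (f≥2 0))))))
      (listSum-big F Q (f ∘ suc) q (f≥2 ∘ suc) vanish)) (ℚ.+-identityˡ 0ℚ))

  ones : ∀ f r → r ≤ f → partsB f r 1 ≡ replicate r 1 ∷ []
  ones zero    zero    _ = refl
  ones (suc f) zero    _ = refl
  ones (suc f) (suc r) (s≤s p) = trans (List.++-identityʳ _) (cong (map (1 ∷_)) (ones f r p))

  -- `partsB` branches on the largest part: 1 leaves only ones, 2 recurses with bound 2, and
  -- anything larger is killed by the vanishing of `F`. The bound `suc (suc m)` makes sure that a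
  -- part 2 is allowed.
  parts-sum : ∀ f r m F → r ≤ f → (∀ μ → Big μ → F μ ≡ 0ℚ) →
    listSum F (partsB f r (suc (suc m))) ≡ half (λ a → F (twosOnes a (r ∸ 2 ℕ.* a))) r
  parts-sum zero    zero m F _ v = ℚ.+-identityʳ _
  parts-sum (suc f) zero m F _ v = ℚ.+-identityʳ _
  parts-sum (suc zero)    (suc zero) m F _ v = ℚ.+-identityʳ _
  parts-sum (suc (suc f)) (suc zero) m F _ v = ℚ.+-identityʳ _
  parts-sum (suc f) (suc (suc r)) m F (s≤s p) v = begin
    listSum F (map (1 ∷_) (partsB f (suc r) 1) ++ (map (2 ∷_) (partsB f r 2) ++ rest))
      ≡⟨ trans (listSum-++ F (map (1 ∷_) (partsB f (suc r) 1)) _) (cong (listSum F (map (1 ∷_) (partsB f (suc r) 1)) +_) (listSum-++ F (map (2 ∷_) (partsB f r 2)) rest)) ⟩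
    listSum F (map (1 ∷_) (partsB f (suc r) 1)) + (listSum F (map (2 ∷_) (partsB f r 2)) + listSum F rest)
      ≡⟨ cong₂ _+_ (trans (cong (listSum F ∘ map (1 ∷_)) (ones f (suc r) p)) (ℚ.+-identityʳ (F (replicate (suc (suc r)) 1))))
           (trans (cong₂ _+_ (trans (listSum-map F (2 ∷_) (partsB f r 2))
               (parts-sum f r 0 (F ∘ (2 ∷_)) (ℕ.≤-trans (ℕ.n≤1+n r) p) (λ μ b → v (2 ∷ μ) (there b))))
             (listSum-big F (λ k → partsB f (suc (suc r) ∸ k) k) (λ i → suc (suc i)) (m ⊓ r) (λ i → s≤s (s≤s z≤n)) v)) (ℚ.+-identityʳ (half (λ a → F (2 ∷ twosOnes a (r ∸ 2 ℕ.* a))) r))) ⟩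
    F (replicate (suc (suc r)) 1) + half (λ a → F (2 ∷ twosOnes a (r ∸ 2 ℕ.* a))) r
      ≡⟨ cong (F (replicate (suc (suc r)) 1) +_) (half-cong r (λ a _ → cong (λ k → F (twosOnes (suc a) (suc (suc r) ∸ k))) (sym (double-suc a)))) ⟩
    half (λ a → F (twosOnes a (suc (suc r) ∸ 2 ℕ.* a))) (suc (suc r)) ∎
    where
    open ≡-Reasoning
    rest = concatMap (λ k → map (k ∷_) (partsB f (suc (suc r) ∸ k) k)) (map suc (applyUpTo (λ i → suc (suc i)) (m ⊓ r)))

  all-parts-sum : ∀ n F → 1 ≤ n → (∀ μ → Big μ → F μ ≡ 0ℚ) →
    listSum F (parts n) ≡ half (λ a → F (twosOnes a (n ∸ 2 ℕ.* a))) n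
  all-parts-sum 1             F _ v = ℚ.+-identityʳ _
  all-parts-sum (suc (suc n)) F _ v = parts-sum (suc (suc n)) (suc (suc n)) n F ℕ.≤-refl v

  isPartition-twosOnes : ∀ n j → 2 ℕ.* j ≤ n → IsPartition n (twosOnes j (n ∸ 2 ℕ.* j))
  isPartition-twosOnes n j p = trans (sum-twosOnes j _) (ℕ.m+[n∸m]≡n p) , positive j _ , linked j _
    where
    positive : ∀ a b → All (1 ≤_) (twosOnes a b)
    positive zero zero = []
    positive zero (suc b) = s≤s z≤n ∷ positive zero b
    positive (suc a) b = s≤s z≤n ∷ positive a b
    linked : ∀ a b → Linked ℕ._≥_ (twosOnes a b)
    linked zero zero = []
    linked zero (suc zero) = [-]
    linked zero (suc (suc b)) = s≤s z≤n ∷ linked zero (suc b)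
    linked (suc zero) zero = [-]
    linked (suc zero) (suc b) = s≤s z≤n ∷ linked zero (suc b)
    linked (suc (suc a)) b = ℕ.≤-refl ∷ linked (suc a) b

  module _ (n : ℕ) (1≤n : 1 ≤ n) (λ' : List ℕ) (Γ : List ℕ → ℚ) (inverse : IsChInvMono n λ' Γ) where

    ν : ℕ → List ℕ
    ν j = twosOnes j (n ∸ 2 ℕ.* j)

    -- `2 ^ j` times the prescribed coefficient of the monomial function at `ν j`; the power of 2 is
    -- the one that turns fillings into binomial coefficients in `fillings-binom`.
    indicator : ℕ → ℚ
    indicator j = ℕtoℚ (2 ^ j) * (if ν j ==L λ' then 1ℚ else 0ℚ)

    -- The count contains the factor `zee (ν a)`, which cancels the reciprocal in the Frobenius
    -- characteristic and leaves a bare binomial coefficient.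
    summand : ∀ j a → 2 ℕ.* j ≤ n → 2 ℕ.* a ≤ n →
      ℕtoℚ (2 ^ j) * (recipℕ (zee (ν a)) * Γ (ν a) * ℕtoℚ (countA (ν a) (ν j))) ≡ ℕtoℚ (binom j a) * Γ (ν a)
    summand j a p q = begin
      ℕtoℚ (2 ^ j) * (recipℕ (zee (ν a)) * Γ (ν a) * ℕtoℚ (countA (ν a) (ν j)))
        ≡⟨ solve 4 (λ t r g c → t :* (r :* g :* c) := r :* g :* (t :* c)) refl (ℕtoℚ (2 ^ j)) (recipℕ (zee (ν a))) (Γ (ν a)) _ ⟩
      recipℕ (zee (ν a)) * Γ (ν a) * (ℕtoℚ (2 ^ j) * ℕtoℚ (countA (ν a) (ν j)))
        ≡⟨ cong (recipℕ (zee (ν a)) * Γ (ν a) *_) (trans (sym (ℕtoℚ-* (2 ^ j) _)) (trans (cong ℕtoℚ counting) (ℕtoℚ-* (binom j a) z))) ⟩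
      recipℕ (zee (ν a)) * Γ (ν a) * (ℕtoℚ (binom j a) * ℕtoℚ z)
        ≡⟨ cong (λ z′ → recipℕ z′ * Γ (ν a) * (ℕtoℚ (binom j a) * ℕtoℚ z)) (zee-twosOnes a b) ⟩
      recipℕ z * Γ (ν a) * (ℕtoℚ (binom j a) * ℕtoℚ z)
        ≡⟨ solve 4 (λ r g b z → r :* g :* (b :* z) := (r :* z) :* (b :* g)) refl (recipℕ z) (Γ (ν a)) (ℕtoℚ (binom j a)) (ℕtoℚ z) ⟩
      recipℕ z * ℕtoℚ z * (ℕtoℚ (binom j a) * Γ (ν a))
        ≡⟨ cong (_* (ℕtoℚ (binom j a) * Γ (ν a))) (inverse-z z z>0) ⟩
      1ℚ * (ℕtoℚ (binom j a) * Γ (ν a))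
        ≡⟨ ℚ.*-identityˡ _ ⟩
      ℕtoℚ (binom j a) * Γ (ν a) ∎
      where
      open ≡-Reasoning
      b = n ∸ 2 ℕ.* a
      c = n ∸ 2 ℕ.* j
      z = b ! ℕ.* (2 ^ a ℕ.* a !)
      z>0 : 1 ≤ z
      z>0 = ℕ.*-mono-≤ (ℕ.1≤n! b) (ℕ.*-mono-≤ (ℕ.m^n>0 2 a) (ℕ.1≤n! a))
      inverse-z : ∀ z → 1 ≤ z → recipℕ z * ℕtoℚ z ≡ 1ℚ
      inverse-z (suc z) _ = recip-inverse z
      counting : 2 ^ j ℕ.* countA (ν a) (ν j) ≡ binom j a ℕ.* z
      counting = trans (cong (2 ^ j ℕ.*_) (trans (countA-fillings a b (ν j) (small-twosOnes j c))
          (cong₂ (fillings a b) (trans (occ-twosOnes 2 j c) (ℕ.+-identityʳ j)) (occ-twosOnes 1 j c))))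
        (fillings-binom a b j c (trans (ℕ.m+[n∸m]≡n q) (sym (ℕ.m+[n∸m]≡n p))))

    binomial-Γ : ∀ j → 2 ℕ.* j ≤ n → binomial (Γ ∘ ν) j ≡ indicator j
    binomial-Γ j p = begin
      binomial (Γ ∘ ν) j
        ≡⟨ half-binom j (Γ ∘ ν) n p ⟨
      half (λ a → ℕtoℚ (binom j a) * Γ (ν a)) n
        ≡⟨ half-cong n (λ a q → sym (summand j a p q)) ⟩
      half (λ a → ℕtoℚ (2 ^ j) * F (ν a)) n
        ≡⟨ half-* n (ℕtoℚ (2 ^ j)) (F ∘ ν) ⟨
      ℕtoℚ (2 ^ j) * half (F ∘ ν) n
        ≡⟨ cong (ℕtoℚ (2 ^ j) *_) (all-parts-sum n F 1≤n vanish) ⟨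
      ℕtoℚ (2 ^ j) * chCoeff n Γ (ν j)
        ≡⟨ cong (ℕtoℚ (2 ^ j) *_) (inverse (ν j) (isPartition-twosOnes n j p)) ⟩
      indicator j ∎
      where
      open ≡-Reasoning
      F : List ℕ → ℚ
      F μ = recipℕ (zee μ) * Γ μ * ℕtoℚ (countA μ (ν j))
      vanish : ∀ μ → Big μ → F μ ≡ 0ℚ
      vanish μ big = trans (cong (λ k → recipℕ (zee μ) * Γ μ * ℕtoℚ k) (countA-big μ (ν j) (small-twosOnes j _) big))
        (ℚ.*-zeroʳ (recipℕ (zee μ) * Γ μ))

    -- Binomial inversion of the system `binomial-Γ`. Only indices up to `a` enter a difference of
    -- order `a`, so all of them satisfy the size bound.
    Γ-difference : ∀ a → 2 ℕ.* a ≤ n → Γ (ν a) ≡ difference indicator a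
    Γ-difference a p = trans (sym (difference-binomial a (Γ ∘ ν)))
      (difference-cong a (λ i i≤a → binomial-Γ i (ℕ.≤-trans (ℕ.*-monoʳ-≤ 2 i≤a) p)))

    indicator-≥0 : ∀ j → 0ℚ ℚ.≤ indicator j
    indicator-≥0 j = go (ν j ==L λ')
      where
      go : ∀ b → 0ℚ ℚ.≤ ℕtoℚ (2 ^ j) * (if b then 1ℚ else 0ℚ)
      go true  = ℚ.≤-trans (ℕtoℚ-≥0 (2 ^ j)) (ℚ.≤-reflexive (sym (ℚ.*-identityʳ _)))
      go false = ℚ.≤-reflexive (sym (ℚ.*-zeroʳ (ℕtoℚ (2 ^ j))))

    indicator-zero : (∀ k → λ' ≢ ν k) → ∀ j → indicator j ≡ 0ℚ
    indicator-zero other j = trans (cong (λ b → ℕtoℚ (2 ^ j) * (if b then 1ℚ else 0ℚ)) (distinct _ _ (other j ∘ sym)))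
      (ℚ.*-zeroʳ (ℕtoℚ (2 ^ j)))
      where
      distinct : ∀ k l → k ≢ l → (k ==L l) ≡ false
      distinct k l k≢l with List.≡-dec ℕ._≟_ k l
      ... | yes e = ⊥-elim (k≢l e)
      ... | no _  = refl

-- Injective maps along tree edges, and cycle types of involutions.

module InjectiveMaps where
  open import Data.Nat.Base using (_+_; _∸_; _<_)
  open EdgeRemoval
  open Trees

  allB-tabulate : ∀ {n} {A : Set} (p : A → Bool) (g : Fin n → A) → allB p (tabulate g) ≡ allF (p ∘ g)
  allB-tabulate {zero}  p g = ≡.refl
  allB-tabulate {suc n} p g = ≡.cong (p (g zero) ∧_) (allB-tabulate p (g ∘ suc))

  module _ {n : ℕ} (f : Fin n → Fin n) where

    private
      test : Fin n → Fin n → Bool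
      test i j = not (f i ==F f j) ∨ (i ==F j)

      isInj-allF : isInj f ≡ allF (λ i → allF (test i))
      isInj-allF = ≡.trans (allB-tabulate (λ i → allB (test i) (allFin n)) id) (allF-cong (λ i → allB-tabulate (test i) id))
        where
        allF-cong : ∀ {m} {p q : Fin m → Bool} → p ≗ q → allF p ≡ allF q
        allF-cong {zero}  h = ≡.refl
        allF-cong {suc m} h = ≡.cong₂ _∧_ (h zero) (allF-cong (h ∘ suc))

    isInj-injective : isInj f ≡ true → ∀ {i j} → f i ≡ f j → i ≡ j
    isInj-injective e {i} {j} fi≡fj with ∨-true {not (f i ==F f j)} (allF-elim (test i) (allF-elim (λ i → allF (test i)) (≡.trans (≡.sym isInj-allF) e) i) j)
    ... | inj₁ p = true≢false (≡⇒==F fi≡fj) (not-true p)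
    ... | inj₂ p = ==F⇒≡ p

    injective-isInj : (∀ {i j} → f i ≡ f j → i ≡ j) → isInj f ≡ true
    injective-isInj inj = ≡.trans isInj-allF (allF-true _ (λ i → allF-true _ (λ j → go i j (f i ==F f j) ≡.refl)))
      where
      go : ∀ i j b → (f i ==F f j) ≡ b → test i j ≡ true
      go i j false e = ∨-true₁ (not-false e)
      go i j true  e = ∨-true₂ {not (f i ==F f j)} (≡⇒==F (inj (==F⇒≡ e)))

    iter-+ : ∀ a b i → iter f (a + b) i ≡ iter f a (iter f b i)
    iter-+ zero    b i = ≡.refl
    iter-+ (suc a) b i = ≡.cong f (iter-+ a b i)

    iter-injective : (∀ {i j} → f i ≡ f j → i ≡ j) → ∀ a {i j} → iter f a i ≡ iter f a j → i ≡ j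
    iter-injective inj zero    e = e
    iter-injective inj (suc a) e = iter-injective inj a (inj e)

    recurrent : (∀ {i j} → f i ≡ f j → i ≡ j) → ∀ i → ∃ λ k → iter f (suc k) i ≡ i
    recurrent inj i = go (Fin.pigeonhole (ℕ.n<1+n n) (λ a → iter f (toℕ a) i))
      where
      go : (∃ λ a → ∃ λ b → a Fin.< b × iter f (toℕ a) i ≡ iter f (toℕ b) i) → ∃ λ k → iter f (suc k) i ≡ i
      go (a , b , a<b , e) = k , ≡.sym (iter-injective inj (toℕ a) (≡.trans e
        (≡.trans (≡.cong (λ m → iter f m i) split) (iter-+ (toℕ a) (suc k) i))))
        where
        k = toℕ b ∸ suc (toℕ a)
        split : toℕ b ≡ toℕ a + suc k
        split = ≡.sym (≡.trans (ℕ.+-suc (toℕ a) k) (ℕ.m+[n∸m]≡n a<b))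

    -- A longer cycle of f would join the ends of one of its edges without using that edge.
    tree-involutive : ∀ {G : Graph n} → Tree G → (∀ {i j} → f i ≡ f j → i ≡ j) →
      (∀ i → f i ≡ i ⊎ G i (f i) ≡ true) → ∀ i → f (f i) ≡ i
    tree-involutive {G} tree inj along i = go (f i Fin.≟ i) (f (f i) Fin.≟ i)
      where
      open Tree tree
      sym-cut : ∀ a b → cut G i (f i) a b ≡ cut G i (f i) b a
      sym-cut = remove-sym i (_==F f i) symmetric
      go : Dec (f i ≡ i) → Dec (f (f i) ≡ i) → f (f i) ≡ i
      go (yes e) _       = ≡.trans (≡.cong f e) e
      go (no _)  (yes e) = e
      go (no fi≢i) (no ffi≢i) = ⊥-elim (bridge tree edge (walk-reverse sym-cut returned))
        where
        edge : G i (f i) ≡ true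
        edge with along i
        ... | inj₁ e = ⊥-elim (fi≢i e)
        ... | inj₂ g = g
        step : ∀ {j} → j ≢ i → Walk (cut G i (f i)) (f i) j → Walk (cut G i (f i)) (f i) (f j)
        step {j} j≢i walk with along j
        ... | inj₁ e = ≡.subst (Walk (cut G i (f i)) (f i)) (≡.sym e) walk
        ... | inj₂ g = walk ◅◅ (kept ◅ ε)
          where
          kept : cut G i (f i) j (f j) ≡ true
          kept = ∧-true g (not-false (≢true⇒≡false λ e → bad (∨-true {(j ==F i) ∧ (f j ==F f i)} e)))
            where
            bad : ((j ==F i) ∧ (f j ==F f i)) ≡ true ⊎ ((f j ==F i) ∧ (j ==F f i)) ≡ true → ⊥
            bad (inj₁ p) = j≢i (==F⇒≡ (∧-trueˡ p))
            bad (inj₂ p) = ffi≢i (≡.trans (≡.cong f (≡.sym (==F⇒≡ {i = j} (∧-trueʳ {f j ==F i} p)))) (==F⇒≡ (∧-trueˡ p)))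
        -- The walk follows the orbit of `f i` and stops for good once it meets `i`. It avoids the
        -- deleted pair in one direction because it never steps from `i`, in the other because
        -- `f (f i)` is not `i`.
        orbit : ∀ k → Walk (cut G i (f i)) (f i) (iter f (suc k) i) ⊎ Walk (cut G i (f i)) (f i) i
        orbit zero = inj₁ ε
        orbit (suc k) with orbit k
        ... | inj₂ walk = inj₂ walk
        ... | inj₁ walk with iter f (suc k) i Fin.≟ i
        ...   | yes e = inj₂ (≡.subst (Walk (cut G i (f i)) (f i)) e walk)
        ...   | no j≢i = inj₁ (step j≢i walk)
        returned : Walk (cut G i (f i)) (f i) i
        returned with recurrent inj i
        ... | k , e with orbit k
        ...   | inj₁ walk = ≡.subst (Walk (cut G i (f i)) (f i)) e walk
        ...   | inj₂ walk = walk

module CycleType {n : ℕ} (f : Fin n → Fin n) (involutive : ∀ i → f (f i) ≡ i) where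
  open import Data.Nat.Base using (_+_; _*_; _∸_; _≤_; _<ᵇ_; _≤ᵇ_)
  open Cardinality
  open Counting
  open Counts using (twosOnes)
  open import Algebra.Properties.CommutativeMonoid.Sum ℕ.+-0-commutativeMonoid using (∑-distrib-+; sum-permute)

  <ᵇ-irrefl : ∀ a → (a <ᵇ a) ≡ false
  <ᵇ-irrefl zero    = ≡.refl
  <ᵇ-irrefl (suc a) = <ᵇ-irrefl a

  <ᵇ-trichotomy : ∀ a b → ((a <ᵇ b) ≡ true × (b <ᵇ a) ≡ false) ⊎ (a ≡ b) ⊎ ((a <ᵇ b) ≡ false × (b <ᵇ a) ≡ true)
  <ᵇ-trichotomy zero    zero    = inj₂ (inj₁ ≡.refl)
  <ᵇ-trichotomy zero    (suc b) = inj₁ (≡.refl , ≡.refl)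
  <ᵇ-trichotomy (suc a) zero    = inj₂ (inj₂ (≡.refl , ≡.refl))
  <ᵇ-trichotomy (suc a) (suc b) with <ᵇ-trichotomy a b
  ... | inj₁ p        = inj₁ p
  ... | inj₂ (inj₁ e) = inj₂ (inj₁ (≡.cong suc e))
  ... | inj₂ (inj₂ p) = inj₂ (inj₂ p)

  ≤ᵇ-<ᵇ : ∀ a b → (a ≤ᵇ b) ≡ not (b <ᵇ a)
  ≤ᵇ-<ᵇ zero    b       = ≡.refl
  ≤ᵇ-<ᵇ (suc a) zero    = ≡.refl
  ≤ᵇ-<ᵇ (suc a) (suc b) = ≡.trans (lemma a b) (≤ᵇ-<ᵇ a b)
    where
    lemma : ∀ a b → (a <ᵇ suc b) ≡ (a ≤ᵇ b)
    lemma zero    b = ≡.refl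
    lemma (suc a) b = ≡.refl

  lower upper fixed : Sub n
  lower i = toℕ i <ᵇ toℕ (f i)
  upper i = toℕ (f i) <ᵇ toℕ i
  fixed i = f i ==F i

  iter-cases : ∀ k i → iter f k i ≡ i ⊎ iter f k i ≡ f i
  iter-cases zero    i = inj₁ ≡.refl
  iter-cases (suc k) i with iter-cases k i
  ... | inj₁ e = inj₂ (≡.cong f e)
  ... | inj₂ e = inj₁ (≡.trans (≡.cong f e) (involutive i))

  allB-applyUpTo : ∀ (p : ℕ → Bool) g m → (∀ k → p k ≡ true) → allB p (applyUpTo g m) ≡ true
  allB-applyUpTo p g zero    h = ≡.refl
  allB-applyUpTo p g (suc m) h = ∧-true (h (g 0)) (allB-applyUpTo p (g ∘ suc) m h)

  one-point : ∀ {m} → n ≡ suc m → m ≡ 0 → ∀ (i j : Fin n) → i ≡ j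
  one-point ≡.refl ≡.refl zero zero = ≡.refl

  -- For an involution the iterates 0 and 1 decide everything. With `n = 1` the iterate 1 is not
  -- tested, but then the only point is fixed.
  minRep : ∀ i → isMinRep f i ≡ not (upper i)
  minRep i = ≡-bool to from
    where
    p : ℕ → Bool
    p k = toℕ i ≤ᵇ toℕ (iter f k i)
    to : isMinRep f i ≡ true → not (upper i) ≡ true
    to e = go n ≡.refl
      where
      go : ∀ m → n ≡ m → not (upper i) ≡ true
      go zero          q = ⊥-elim (Fin.¬Fin0 (≡.subst Fin q i))
      go (suc zero)    q = not-false (≡.trans (≡.cong (λ j → toℕ j <ᵇ toℕ i) (one-point q ≡.refl (f i) i)) (<ᵇ-irrefl (toℕ i)))
      go (suc (suc m)) q = ≡.trans (≡.sym (≤ᵇ-<ᵇ (toℕ i) (toℕ (f i)))) (∧-trueˡ (∧-trueʳ {p 0} (≡.subst (λ k → allB p (upTo k) ≡ true) q e)))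
    from : not (upper i) ≡ true → isMinRep f i ≡ true
    from e = allB-applyUpTo p id n (λ k → below k (iter-cases k i))
      where
      below : ∀ k → iter f k i ≡ i ⊎ iter f k i ≡ f i → p k ≡ true
      below k (inj₁ q) = ≡.trans (≡.cong (λ j → toℕ i ≤ᵇ toℕ j) q) (≡.trans (≤ᵇ-<ᵇ (toℕ i) (toℕ i)) (not-false (<ᵇ-irrefl (toℕ i))))
      below k (inj₂ q) = ≡.trans (≡.cong (λ j → toℕ i ≤ᵇ toℕ j) q) (≡.trans (≤ᵇ-<ᵇ (toℕ i) (toℕ (f i))) e)

  orbitLength : ∀ i → orbitLen f i ≡ (if fixed i then 1 else 2)
  orbitLength i = go n ≡.refl
    where
    go : ∀ m → n ≡ m → firstHit f i (map suc (upTo m)) ≡ (if fixed i then 1 else 2)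
    go zero          q = ⊥-elim (Fin.¬Fin0 (≡.subst Fin q i))
    go (suc zero)    q rewrite ≡⇒==F (one-point q ≡.refl (f i) i) = ≡.refl
    go (suc (suc m)) q with f i ==F i
    ... | true  = ≡.refl
    ... | false rewrite ≡⇒==F (involutive i) = ≡.refl

  insert-one : ∀ a b → insertD {n} 1 (twosOnes a b) ≡ twosOnes a (suc b)
  insert-one zero    zero    = ≡.refl
  insert-one zero    (suc b) = ≡.refl
  insert-one (suc a) b       = ≡.cong (2 ∷_) (insert-one a b)

  insert-two : ∀ a b → insertD {n} 2 (twosOnes a b) ≡ twosOnes (suc a) b
  insert-two zero    zero    = ≡.refl
  insert-two zero    (suc b) = ≡.refl
  insert-two (suc a) b       = ≡.refl

  doubles singles : ∀ {m} (h : Fin (suc m) → Fin n) (p r : Fin n → Bool) → ℕ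
  doubles h p r = size (λ i → p (h (suc i)) ∧ not (r (h (suc i))))
  singles h p r = size (λ i → p (h (suc i)) ∧ r (h (suc i)))

  -- p selects representatives, r those of them forming a singleton.
  sort-lengths : ∀ {m} (h : Fin m → Fin n) (p r : Fin n → Bool) →
    foldr (insertD {n}) [] (map (λ i → if r i then 1 else 2) (filterB p (tabulate h)))
      ≡ twosOnes (size (λ i → p (h i) ∧ not (r (h i)))) (size (λ i → p (h i) ∧ r (h i)))
  sort-lengths {zero}  h p r = ≡.refl
  sort-lengths {suc m} h p r with p (h zero)
  ... | false = sort-lengths (h ∘ suc) p r
  ... | true with r (h zero)
  ...   | true  = ≡.trans (≡.cong (insertD {n} 1) (sort-lengths (h ∘ suc) p r)) (insert-one (doubles h p r) (singles h p r))
  ...   | false = ≡.trans (≡.cong (insertD {n} 2) (sort-lengths (h ∘ suc) p r)) (insert-two (doubles h p r) (singles h p r))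

  trichotomy : ∀ i → (lower i ≡ true × upper i ≡ false × fixed i ≡ false) ⊎ (lower i ≡ false × upper i ≡ false × fixed i ≡ true)
    ⊎ (lower i ≡ false × upper i ≡ true × fixed i ≡ false)
  trichotomy i with <ᵇ-trichotomy (toℕ i) (toℕ (f i))
  ... | inj₁ (p , q) = inj₁ (p , q , ≢⇒==F (λ e → true≢false (≡.subst (λ j → (toℕ i <ᵇ toℕ j) ≡ true) e p) (<ᵇ-irrefl (toℕ i))))
  ... | inj₂ (inj₂ (p , q)) = inj₂ (inj₂ (p , q , ≢⇒==F (λ e → true≢false (≡.subst (λ j → (toℕ j <ᵇ toℕ i) ≡ true) e q) (<ᵇ-irrefl (toℕ i)))))
  ... | inj₂ (inj₁ e) = inj₂ (inj₁ (irr , irr′ , ≡⇒==F e′))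
    where
    e′ : f i ≡ i
    e′ = ≡.sym (Fin.toℕ-injective e)
    irr : lower i ≡ false
    irr = ≡.trans (≡.cong (toℕ i <ᵇ_) (≡.sym e)) (<ᵇ-irrefl (toℕ i))
    irr′ : upper i ≡ false
    irr′ = ≡.trans (≡.cong (_<ᵇ toℕ i) (≡.sym e)) (<ᵇ-irrefl (toℕ i))

  transpositions : ℕ
  transpositions = size lower

  σ : Permutation′ n
  σ = permutation f f involutive involutive

  -- Reindexing by `f` itself exchanges the two ends of every transposition.
  size-upper : size upper ≡ size lower
  size-upper = ≡.trans (sum-permute {n} {n} (λ i → ιℕ (upper i)) σ)
    (sum-cong-≗ {n} (λ i → ≡.cong (λ j → ιℕ (toℕ j <ᵇ toℕ (f i))) (involutive i)))

  total : n ≡ 2 * transpositions + size fixed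
  total = begin
    n                                          ≡⟨ size-all {n} (λ _ → true) (λ _ → ≡.refl) ⟨
    size {n} (λ _ → true)                      ≡⟨ sum-cong-≗ {n} one ⟩
    sum (λ i → ιℕ (lower i) + (ιℕ (upper i) + ιℕ (fixed i)))
      ≡⟨ ≡.trans (∑-distrib-+ {n} (λ i → ιℕ (lower i)) _) (≡.cong (size lower +_) (∑-distrib-+ {n} (λ i → ιℕ (upper i)) (λ i → ιℕ (fixed i)))) ⟩
    size lower + (size upper + size fixed)     ≡⟨ ≡.cong (λ k → size lower + (k + size fixed)) size-upper ⟩
    size lower + (size lower + size fixed)     ≡⟨ ℕ.+-assoc (size lower) (size lower) (size fixed) ⟨
    size lower + size lower + size fixed       ≡⟨ ≡.cong (λ k → size lower + k + size fixed) (ℕ.+-identityʳ (size lower)) ⟨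
    2 * transpositions + size fixed            ∎
    where
    open ≡.≡-Reasoning
    one : ∀ i → 1 ≡ ιℕ (lower i) + (ιℕ (upper i) + ιℕ (fixed i))
    one i with trichotomy i
    ... | inj₁ (p , q , r)        rewrite p | q | r = ≡.refl
    ... | inj₂ (inj₁ (p , q , r)) rewrite p | q | r = ≡.refl
    ... | inj₂ (inj₂ (p , q , r)) rewrite p | q | r = ≡.refl

  transpositions-≤ : 2 * transpositions ≤ n
  transpositions-≤ = ≡.subst (2 * transpositions ≤_) (≡.sym total) (ℕ.m≤m+n _ _)

  cycleType-twosOnes : cycleType f ≡ twosOnes transpositions (n ∸ 2 * transpositions)
  cycleType-twosOnes = begin
    cycleType f
      ≡⟨ ≡.cong (foldr (insertD {n}) []) (≡.trans (List.map-cong orbitLength (filterB (isMinRep f) (allFin n)))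
           (≡.cong (map (λ i → if fixed i then 1 else 2)) (filterB-cong minRep (allFin n)))) ⟩
    foldr (insertD {n}) [] (map (λ i → if fixed i then 1 else 2) (filterB (not ∘ upper) (tabulate id)))
      ≡⟨ sort-lengths id (not ∘ upper) fixed ⟩
    twosOnes (size (λ i → not (upper i) ∧ not (fixed i))) (size (λ i → not (upper i) ∧ fixed i))
      ≡⟨ ≡.cong₂ twosOnes (size-cong as-lower) (≡.trans (size-cong as-fixed)
           (≡.sym (≡.trans (≡.cong (_∸ 2 * transpositions) total) (ℕ.m+n∸m≡n (2 * transpositions) (size fixed))))) ⟩
    twosOnes transpositions (n ∸ 2 * transpositions) ∎
    where
    open ≡.≡-Reasoning
    filterB-cong : ∀ {A : Set} {p q : A → Bool} → p ≗ q → ∀ l → filterB p l ≡ filterB q l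
    filterB-cong h [] = ≡.refl
    filterB-cong {q = q} h (a ∷ l) = ≡.cong₂ (λ b r → if b then a ∷ r else r) (h a) (filterB-cong h l)
    as-lower : ∀ i → (not (upper i) ∧ not (fixed i)) ≡ lower i
    as-lower i with trichotomy i
    ... | inj₁ (p , q , r)        rewrite p | q | r = ≡.refl
    ... | inj₂ (inj₁ (p , q , r)) rewrite p | q | r = ≡.refl
    ... | inj₂ (inj₂ (p , q , r)) rewrite p | q = ≡.refl
    as-fixed : ∀ i → (not (upper i) ∧ fixed i) ≡ fixed i
    as-fixed i with trichotomy i
    ... | inj₁ (p , q , r)        rewrite q | r = ≡.refl
    ... | inj₂ (inj₁ (p , q , r)) rewrite q | r = ≡.refl
    ... | inj₂ (inj₂ (p , q , r)) rewrite q | r = ≡.refl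

-- Cones of power series with conditions that depend on the exponent.

-- A positivity condition for each exponent, compatible with addition of exponents under products.
-- This is what series need in order to form a cone while even powers, odd powers or alternating
-- signs are treated differently.
record Grading {c ℓ} (R : CommutativeRing c ℓ) (p : Level) : Set (c ⊔ ℓ ⊔ lsuc p) where
  open CommutativeRing R
  field
    K      : ℕ → Carrier → Set p
    K-resp : ∀ k {a b} → a ≈ b → K k a → K k b
    K-0    : ∀ k → K k 0#
    K-1    : K 0 1#
    K-+    : ∀ k {a b} → K k a → K k b → K k (a + b)
    K-*    : ∀ k l {a b} → K k a → K l b → K (k ℕ.+ l) (a * b)

-- The power series whose k-th coefficient lies in the k-th piece of a grading.
module SeriesCone {c ℓ p} {R : CommutativeRing c ℓ} (grading : Grading R p) where
  open CommutativeRing R hiding (zero)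
  open Grading grading
  open PowerSeries R

  -- The offsets `a` and `b` carry the induction: the recursion of `_⊛_` passes to `tl f`, whose
  -- coefficients sit one step higher in the grading.
  K-⊛ : ∀ k {a b f g} → (∀ i → K (a ℕ.+ i) (f i)) → (∀ i → K (b ℕ.+ i) (g i)) → K (a ℕ.+ b ℕ.+ k) ((f ⊛ g) k)
  K-⊛ zero {a} {b} {f} {g} hf hg = ≡.subst (λ m → K m (f 0 * g 0))
    (≡.trans (≡.cong₂ ℕ._+_ (ℕ.+-identityʳ a) (ℕ.+-identityʳ b)) (≡.sym (ℕ.+-identityʳ _))) (K-* _ _ (hf 0) (hg 0))
  K-⊛ (suc k) {a} {b} {f} {g} hf hg = K-+ _
    (≡.subst (λ m → K m (f 0 * g (suc k))) (≡.trans (≡.cong (ℕ._+ (b ℕ.+ suc k)) (ℕ.+-identityʳ a)) (≡.sym (ℕ.+-assoc a b (suc k))))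
      (K-* _ _ (hf 0) (hg (suc k))))
    (≡.subst (λ m → K m ((tl f ⊛ g) k)) (≡.sym (ℕ.+-suc (a ℕ.+ b) k))
      (K-⊛ k {suc a} {b} {tl f} {g} (λ i → ≡.subst (λ m → K m (f (suc i))) (ℕ.+-suc a i) (hf (suc i))) hg))

  seriesCone : Cone series p
  seriesCone = record
    { Pos      = λ f → ∀ k → K k (f k)
    ; Pos-resp = λ p h k → K-resp k (p k) (h k)
    ; Pos-0    = λ k → K-0 k
    ; Pos-1    = λ { zero → K-1 ; (suc k) → K-0 (suc k) }
    ; Pos-+    = λ h h′ k → K-+ k (h k) (h′ k)
    ; Pos-*    = λ {f} {g} h h′ k → K-⊛ k {0} {0} {f} {g} h h′
    }

module _ {c ℓ p} {R : CommutativeRing c ℓ} (cone : Cone R p) where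
  open CommutativeRing R hiding (zero)
  open Cone cone
  open import Algebra.Properties.Ring ring using (-‿distribˡ-*; -‿distribʳ-*)
  open import Algebra.Properties.AbelianGroup +-abelianGroup using (ε⁻¹≈ε; ⁻¹-∙-comm)

  constantGrading : Grading R p
  constantGrading = record
    { K = λ _ → Pos ; K-resp = λ _ → Pos-resp ; K-0 = λ _ → Pos-0 ; K-1 = Pos-1
    ; K-+ = λ _ → Pos-+ ; K-* = λ _ _ → Pos-* }

  -- Nonnegativity in the variable -x.
  alternatingGrading : Grading R p
  alternatingGrading = record
    { K = K ; K-resp = K-resp ; K-0 = K-0 ; K-1 = Pos-1 ; K-+ = K-+ ; K-* = K-* }
    where
    K : ℕ → Carrier → Set p
    K zero    a = Pos a
    K (suc k) a = K k (- a)
    K-resp : ∀ k {a b} → a ≈ b → K k a → K k b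
    K-resp zero    e = Pos-resp e
    K-resp (suc k) e = K-resp k (-‿cong e)
    K-0 : ∀ k → K k 0#
    K-0 zero    = Pos-0
    K-0 (suc k) = K-resp k (sym ε⁻¹≈ε) (K-0 k)
    K-+ : ∀ k {a b} → K k a → K k b → K k (a + b)
    K-+ zero    h h′ = Pos-+ h h′
    K-+ (suc k) h h′ = K-resp k (⁻¹-∙-comm _ _) (K-+ k h h′)
    K-* : ∀ k l {a b} → K k a → K l b → K (k ℕ.+ l) (a * b)
    K-* zero    zero    h h′ = Pos-* h h′
    K-* zero    (suc l) h h′ = K-resp l (sym (-‿distribʳ-* _ _)) (K-* zero l h h′)
    K-* (suc k) l       h h′ = K-resp (k ℕ.+ l) (sym (-‿distribˡ-* _ _)) (K-* k l h h′)

module _ {c ℓ} {R : CommutativeRing c ℓ} (cone : Cone R ℓ) where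
  open CommutativeRing R hiding (zero)
  open Cone cone

  -- Nonnegativity together with the vanishing of odd coefficients.
  evenGrading : Grading R ℓ
  evenGrading = record
    { K = K ; K-resp = K-resp ; K-0 = K-0 ; K-1 = Pos-1 ; K-+ = K-+ ; K-* = K-* }
    where
    K : ℕ → Carrier → Set ℓ
    K zero          a = Pos a
    K (suc zero)    a = a ≈ 0#
    K (suc (suc k)) a = K k a
    K-resp : ∀ k {a b} → a ≈ b → K k a → K k b
    K-resp zero          e h = Pos-resp e h
    K-resp (suc zero)    e h = trans (sym e) h
    K-resp (suc (suc k)) e h = K-resp k e h
    K-0 : ∀ k → K k 0#
    K-0 zero          = Pos-0
    K-0 (suc zero)    = refl
    K-0 (suc (suc k)) = K-0 k
    K-+ : ∀ k {a b} → K k a → K k b → K k (a + b)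
    K-+ zero          h h′ = Pos-+ h h′
    K-+ (suc zero)    h h′ = trans (+-cong h h′) (+-identityˡ 0#)
    K-+ (suc (suc k)) h h′ = K-+ k h h′
    K-* : ∀ k l {a b} → K k a → K l b → K (k ℕ.+ l) (a * b)
    K-* zero          zero          h h′ = Pos-* h h′
    K-* zero          (suc zero)    h h′ = trans (*-congˡ h′) (zeroʳ _)
    K-* zero          (suc (suc l)) h h′ = K-* zero l h h′
    K-* (suc zero)    l             h h′ = K-resp (suc l) (sym (trans (*-congʳ h) (zeroˡ _))) (K-0 (suc l))
    K-* (suc (suc k)) l             h h′ = K-* k l h h′

module RingSign {c ℓ} (R : CommutativeRing c ℓ) where
  open CommutativeRing R hiding (zero)

  sign : ℕ → Carrier
  sign zero    = 1#
  sign (suc k) = - sign k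

-- From the matching polynomial to the generalized matrix function.

module Extraction {c ℓ} (R₀ : CommutativeRing c ℓ) (Q y₀ : CommutativeRing.Carrier R₀) (n : ℕ)
  (e : ℕ → CommutativeRing.Carrier R₀) where
  open InjectiveMaps

  module S = PowerSeries R₀
  open S using (constant; series; X)
  open RingSign R₀ using (sign)

  module R₀ where
    open CommutativeRing R₀ public
    open FunctionSums R₀ public
    open import Algebra.Properties.Semiring.Sum semiring public using (sum; sum-cong-≋; *-distribˡ-sum; ∑-distrib-+)
    open import Algebra.Properties.CommutativeMonoid.Sum *-commutativeMonoid public using ()
      renaming (sum to ∏; sum-cong-≋ to ∏-cong)
    open import Algebra.Properties.Semiring.Mult semiring public using () renaming (_×_ to _∙_)
    open DifferenceSolver R₀ public using (solve; _:+_; _:-_; _:*_; _:=_; :-_)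

  module R where
    open CommutativeRing series public
    open FunctionSums series public
    open import Algebra.Properties.Semiring.Sum semiring public using (sum; sum-cong-≋)
    open import Algebra.Properties.CommutativeMonoid.Sum *-commutativeMonoid public using ()
      renaming (sum to ∏; sum-cong-≋ to ∏-cong; ∑-distrib-+ to ∏-distrib-*)
    open import Algebra.Properties.Semiring.Mult semiring public using () renaming (_×_ to _∙_)
    open DifferenceSolver series public using (solve; _:+_; _:-_; _:*_; _:=_; :-_)

  S₀ : R₀.Carrier
  S₀ = Q R₀.* Q

  -- `α` carries the whole factor `u - 1` and `β` none of it, so a product of entries contains one
  -- `t` per transposition. Both contain the off-diagonal Laplacian entry `- q`, whose square is
  -- `s#`.
  t α β y# s# u# : R.Carrier
  t  = X R.- R.1#
  α  = R.- (constant Q R.* t)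
  β  = R.- constant Q
  y# = constant y₀
  s# = constant S₀
  u# = X

  edge≈ : α R.* β R.≈ s# R.* u# R.- s#
  edge≈ = R.trans (R.solve 3 (λ q x o → (R.:- (q R.:* (x R.:- o))) R.:* (R.:- q) R.:= q R.:* q R.:* x R.:- q R.:* q R.:* o) R.refl (constant Q) X R.1#)
    (R.+-cong (R.*-congʳ {X} (R.sym (S.constant-* Q Q))) (R.-‿cong (R.trans (R.*-identityʳ _) (R.sym (S.constant-* Q Q)))))

  -- The linear functional u^k ↦ e k on polynomials of degree at most n in u.
  extract : R.Carrier → R₀.Carrier
  extract F = R₀.sum {suc n} (λ k → e (toℕ k) R₀.* F (toℕ k))

  extract-cong : ∀ {F F′} → F R.≈ F′ → extract F R₀.≈ extract F′
  extract-cong p = R₀.sum-cong-≋ {suc n} (λ k → R₀.*-congˡ {e (toℕ k)} (p (toℕ k)))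

  extract-+ : ∀ F F′ → extract (F R.+ F′) R₀.≈ extract F R₀.+ extract F′
  extract-+ F F′ = R₀.trans (R₀.sum-cong-≋ {suc n} (λ k → R₀.distribˡ (e (toℕ k)) (F (toℕ k)) (F′ (toℕ k))))
    (R₀.∑-distrib-+ {suc n} (λ k → e (toℕ k) R₀.* F (toℕ k)) (λ k → e (toℕ k) R₀.* F′ (toℕ k)))

  extract-0 : extract R.0# R₀.≈ R₀.0#
  extract-0 = SumLemmas.sum-zero R₀.+-commutativeMonoid {suc n} {λ k → e (toℕ k) R₀.* R₀.0#} (λ k → R₀.zeroʳ (e (toℕ k)))

  extract-constant : ∀ a F → extract (constant a R.* F) R₀.≈ a R₀.* extract F
  extract-constant a F = R₀.trans (R₀.sum-cong-≋ {suc n} (λ k → R₀.trans (R₀.*-congˡ (S.constant-⊛ a F (toℕ k)))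
      (R₀.solve 3 (λ e a f → e R₀.:* (a R₀.:* f) R₀.:= a R₀.:* (e R₀.:* f)) R₀.refl (e (toℕ k)) a (F (toℕ k)))))
    (R₀.sym (R₀.*-distribˡ-sum {suc n} a (λ k → e (toℕ k) R₀.* F (toℕ k))))

  extract-sum : ∀ {m} (F : Fin m → R.Carrier) → extract (R.sum F) R₀.≈ R₀.sum (extract ∘ F)
  extract-sum {zero}  F = extract-0
  extract-sum {suc m} F = R₀.trans (extract-+ (F zero) (R.sum (F ∘ suc))) (R₀.+-congˡ (extract-sum (F ∘ suc)))

  extract-∑F : ∀ m (F : (Fin m → Fin n) → R.Carrier) → extract (R.∑F m F) R₀.≈ R₀.∑F m (extract ∘ F)
  extract-∑F zero    F = R₀.refl
  extract-∑F (suc m) F = R₀.trans (extract-sum (λ a → R.∑F m (F ∘ Defs.consF a)))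
    (R₀.sum-cong-≋ {n} (λ a → extract-∑F m (F ∘ Defs.consF a)))

  difference : (ℕ → R₀.Carrier) → ℕ → R₀.Carrier
  difference h zero    = h 0
  difference h (suc a) = difference (h ∘ suc) a R₀.- difference h a

  power : ℕ → R.Carrier
  power zero    = R.1#
  power (suc m) = t R.* power m

  t-zero : ∀ F → (t R.* F) 0 R₀.≈ R₀.- F 0
  t-zero F = R₀.trans (R₀.*-congʳ (R₀.+-identityˡ _)) (R₀.trans (R₀.sym (-‿distribˡ-* R₀.1# (F 0))) (R₀.-‿cong (R₀.*-identityˡ _)))
    where open import Algebra.Properties.Ring R₀.ring using (-‿distribˡ-*)

  t-suc : ∀ F k → (t R.* F) (suc k) R₀.≈ F k R₀.- F (suc k)
  t-suc F k = R₀.trans (lemma (suc k)) (R₀.+-cong (S.X-⊛-suc F k) (R₀.-‿cong (S.⊛-identityˡ F (suc k))))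
    where
    lemma : t R.* F R.≈ X R.* F R.- R.1# R.* F
    lemma = R.solve 3 (λ x o f → (x R.:- o) R.:* f R.:= x R.:* f R.:- o R.:* f) R.refl X R.1# F

  pairing : (ℕ → R₀.Carrier) → R.Carrier → ℕ → R₀.Carrier
  pairing h F N = R₀.sum {N} (λ k → h (toℕ k) R₀.* F (toℕ k))

  -- Multiplication by `u` acts on the functional as a shift of `h`, so multiplication by `u - 1`
  -- acts as a forward difference. The shifted sum has one term fewer, hence `N` next to `suc N`.
  pairing-t : ∀ h F N → pairing h (t R.* F) (suc N) R₀.≈ pairing (h ∘ suc) F N R₀.- pairing h F (suc N)
  pairing-t h F N = R₀.trans (R₀.+-cong (R₀.*-congˡ (t-zero F))
      (R₀.trans (R₀.sum-cong-≋ {N} (λ k → R₀.trans (R₀.*-congˡ (t-suc F (toℕ k)))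
          (R₀.solve 3 (λ h f g → h R₀.:* (f R₀.:- g) R₀.:= h R₀.:* f R₀.:+ (R₀.:- (h R₀.:* g))) R₀.refl (h (suc (toℕ k))) (F (toℕ k)) (F (suc (toℕ k))))))
        (R₀.trans (R₀.∑-distrib-+ {N} (λ k → h (suc (toℕ k)) R₀.* F (toℕ k)) (λ k → R₀.- (h (suc (toℕ k)) R₀.* F (suc (toℕ k)))))
          (R₀.+-congˡ (negative-sum {N} (λ k → h (suc (toℕ k)) R₀.* F (suc (toℕ k))))))))
    (R₀.solve 4 (λ h f a b → h R₀.:* (R₀.:- f) R₀.:+ (a R₀.:- b) R₀.:= a R₀.:- (h R₀.:* f R₀.:+ b)) R₀.refl
      (h 0) (F 0) (pairing (h ∘ suc) F N) (R₀.sum {N} (λ k → h (suc (toℕ k)) R₀.* F (suc (toℕ k)))))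
    where
    open import Algebra.Properties.AbelianGroup R₀.+-abelianGroup using (ε⁻¹≈ε; ⁻¹-∙-comm)
    negative-sum : ∀ {m} (f : Fin m → R₀.Carrier) → R₀.sum (λ k → R₀.- f k) R₀.≈ R₀.- R₀.sum f
    negative-sum {zero}  f = R₀.sym ε⁻¹≈ε
    negative-sum {suc m} f = R₀.trans (R₀.+-congˡ (negative-sum (f ∘ suc))) (⁻¹-∙-comm _ _)

  -- The power has degree `m < N`, so the truncated pairing sees all of it, and repeated use of
  -- `pairing-t` ends at the value `h 0`.
  pairing-power : ∀ m h N → m ℕ.< N → pairing h (power m) N R₀.≈ difference h m
  pairing-power zero h (suc N) _ = R₀.trans (R₀.+-cong (R₀.*-identityʳ (h 0))
    (SumLemmas.sum-zero R₀.+-commutativeMonoid {N} (λ k → R₀.zeroʳ (h (suc (toℕ k)))))) (R₀.+-identityʳ (h 0))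
  pairing-power (suc m) h (suc N) (s≤s p) = R₀.trans (pairing-t h (power m) N)
    (R₀.+-cong (pairing-power m (h ∘ suc) N p) (R₀.-‿cong (pairing-power m h (suc N) (ℕ.m≤n⇒m≤1+n p))))

  ∏-constant : ∀ {m} (a : Fin m → R₀.Carrier) → R.∏ (constant ∘ a) R.≈ constant (R₀.∏ a)
  ∏-constant {zero}  a = R.refl
  ∏-constant {suc m} a = R.trans (R.*-congˡ {constant (a zero)} (∏-constant (a ∘ suc))) (R.sym (S.constant-* (a zero) (R₀.∏ (a ∘ suc))))

  ∏-power : ∀ {m} (B : Sub m) → R.∏ (λ i → if B i then t else R.1#) R.≈ power (size B)
  ∏-power {zero}  B = R.refl
  ∏-power {suc m} B = head (B zero)
    where
    head : ∀ b → (if b then t else R.1#) R.* R.∏ (λ i → if B (suc i) then t else R.1#) R.≈ power (ιℕ b ℕ.+ size (B ∘ suc))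
    head true  = R.*-congˡ {t} (∏-power (B ∘ suc))
    head false = R.trans (R.*-identityˡ _) (∏-power (B ∘ suc))

  constant-∙ : ∀ d a → constant (d R₀.∙ a) R.≈ d R.∙ constant a
  constant-∙ zero    a zero    = R₀.refl
  constant-∙ zero    a (suc k) = R₀.refl
  constant-∙ (suc d) a = R.trans (S.constant-+ a (d R₀.∙ a)) (R.+-congˡ {constant a} (constant-∙ d a))

  module _ {p} (cone₀ : Cone R₀ p) (Pos-y₀ : Cone.Pos cone₀ y₀) (Pos-S₀ : Cone.Pos cone₀ S₀) where

    open Cone cone₀

    cone : Cone series p
    cone = SeriesCone.seriesCone (constantGrading cone₀)

    Pos-constant : ∀ {a} → Pos a → Cone.Pos cone (constant a)
    Pos-constant h zero    = h
    Pos-constant h (suc k) = Pos-0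

    Pos-X : Cone.Pos cone X
    Pos-X zero          = Pos-0
    Pos-X (suc zero)    = Pos-1
    Pos-X (suc (suc k)) = Pos-0

    vars : Variables cone
    vars = record
      { α = α ; β = β ; y# = y# ; s# = s# ; u# = u# ; edge≈ = edge≈
      ; Pos-y = Pos-constant Pos-y₀ ; Pos-s = Pos-constant Pos-S₀ ; Pos-u = Pos-X }

    module L = Laplacian vars {n}
    module M = Monotone vars {n}
    module W = WeightedMatchings series α β {n}

    extracted : Graph n → R₀.Carrier
    extracted G = extract (M.matchingPolynomial G)

    extract-pos : (∀ k → Pos (e k)) → ∀ F → Cone.Pos cone F → Pos (extract F)
    extract-pos he F hF = go {suc n} (λ k → e (toℕ k) R₀.* F (toℕ k)) (λ k → Pos-* (he (toℕ k)) (hF (toℕ k)))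
      where
      go : ∀ {m} (f : Fin m → R₀.Carrier) → (∀ i → Pos (f i)) → Pos (R₀.sum f)
      go {zero}  f h = Pos-0
      go {suc m} f h = Pos-+ (h zero) (go (f ∘ suc) (h ∘ suc))

    extracted-monotone : (∀ k → Pos (e k)) → ∀ {G H} → Trees.Tree G → G ≤GTS H → Pos (extracted G R₀.- extracted H)
    extracted-monotone he {G} {H} tree G≤H = Pos-resp (R₀.trans (extract-cong rearranged)
        (R₀.trans (extract-+ PG (constant (R₀.- R₀.1#) R.* PH)) (R₀.+-congˡ (R₀.trans (extract-constant (R₀.- R₀.1#) PH) minus))))
      (extract-pos he (PG R.- PH) (M.monotone tree G≤H))
      where
      open import Algebra.Properties.Ring R₀.ring using (-‿distribˡ-*)
      PG PH : R.Carrier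
      PG = M.matchingPolynomial G
      PH = M.matchingPolynomial H
      minus : R₀.- R₀.1# R₀.* extracted H R₀.≈ R₀.- extracted H
      minus = R₀.trans (R₀.sym (-‿distribˡ-* R₀.1# (extracted H))) (R₀.-‿cong (R₀.*-identityˡ (extracted H)))
      rearranged : PG R.- PH R.≈ PG R.+ constant (R₀.- R₀.1#) R.* PH
      rearranged k = R₀.+-congˡ (R₀.sym (R₀.trans (S.constant-⊛ (R₀.- R₀.1#) PH k)
        (R₀.trans (R₀.sym (-‿distribˡ-* R₀.1# (PH k))) (R₀.-‿cong (R₀.*-identityˡ (PH k))))))

    module _ (G : Graph n) (entry : Fin n → Fin n → R₀.Carrier)
      (diagonal : ∀ i → entry i i R₀.≈ y₀ R₀.+ R₀.1# R₀.- S₀ R₀.+ size (G i) R₀.∙ S₀)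
      (off-diagonal : ∀ i j → i ≢ j → entry i j R₀.≈ R₀.ι (G i j) R₀.* (R₀.- Q)) where

      lower : (Fin n → Fin n) → Sub n
      lower f i = toℕ i ℕ.<ᵇ toℕ (f i)

      -- Separates the dependence on `u`: the scalar matrix entry on one side, a factor `t` above
      -- the diagonal on the other. A product over `f` then yields `t` to the number of points that
      -- `f` raises.
      matrix-entry : ∀ i j → W.matrix G (L.laplacian G) i j R.≈ constant (entry i j) R.* (if toℕ i ℕ.<ᵇ toℕ j then t else R.1#)
      matrix-entry i j = go (i Fin.≟ j)
        where
        irrefl : ∀ a → (a ℕ.<ᵇ a) ≡ false
        irrefl zero    = ≡.refl
        irrefl (suc a) = irrefl a
        go : Dec (i ≡ j) → W.matrix G (L.laplacian G) i j R.≈ constant (entry i j) R.* (if toℕ i ℕ.<ᵇ toℕ j then t else R.1#)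
        go (yes ≡.refl) = R.trans (W.matrix-diagonal G (L.laplacian G) i) (R.sym (R.trans
          (R.reflexive (≡.cong (λ b → constant (entry i i) R.* (if b then t else R.1#)) (irrefl (toℕ i))))
          (R.trans (R.*-identityʳ (constant (entry i i))) (R.trans (S.constant-cong (diagonal i)) constant-weight))))
          where
          constant-weight : constant (y₀ R₀.+ R₀.1# R₀.- S₀ R₀.+ size (G i) R₀.∙ S₀) R.≈ L.laplacian G i
          constant-weight = R.trans (S.constant-+ (y₀ R₀.+ R₀.1# R₀.- S₀) (size (G i) R₀.∙ S₀)) (R.+-cong
            (R.trans (S.constant-+ (y₀ R₀.+ R₀.1#) (R₀.- S₀)) (R.+-cong (S.constant-+ y₀ R₀.1#) (S.constant-neg S₀)))
            (constant-∙ (size (G i)) S₀))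
        go (no i≢j) = R.trans
          (R.reflexive (≡.cong (λ b → if b then L.laplacian G i else R.ι (G i j) R.* (if toℕ i ℕ.<ᵇ toℕ j then α else β)) (≢⇒==F i≢j)))
          (R.sym (R.trans (R.*-congʳ {if toℕ i ℕ.<ᵇ toℕ j then t else R.1#} (S.constant-cong (off-diagonal i j i≢j)))
            (cases (G i j) (toℕ i ℕ.<ᵇ toℕ j))))
          where
          cases : ∀ g b → constant (R₀.ι g R₀.* (R₀.- Q)) R.* (if b then t else R.1#) R.≈ R.ι g R.* (if b then α else β)
          cases false b = R.trans (R.*-congʳ {if b then t else R.1#} (λ { zero → R₀.zeroˡ _ ; (suc k) → R₀.refl }))
            (R.trans (R.zeroˡ (if b then t else R.1#)) (R.sym (R.zeroˡ (if b then α else β))))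
          cases true b = R.trans (R.*-congʳ {if b then t else R.1#} (R.trans (S.constant-cong (R₀.*-identityˡ (R₀.- Q))) (S.constant-neg Q)))
            (R.sym (R.trans (R.*-identityˡ (if b then α else β)) (branch b)))
            where
            open import Algebra.Properties.Ring R.ring using (-‿distribˡ-*)
            branch : ∀ b → (if b then α else β) R.≈ (R.- constant Q) R.* (if b then t else R.1#)
            branch true  = -‿distribˡ-* (constant Q) t
            branch false = R.sym (R.*-identityʳ (R.- constant Q))

      module Mat = Matchings series (W.matrix G (L.laplacian G))

      extract-weight : ∀ f → size (lower f) ℕ.≤ n → extract (Mat.weight L.full f)
        R₀.≈ R₀.ι (Mat.valid L.full f) R₀.* (R₀.∏ (λ i → entry i (f i)) R₀.* difference e (size (lower f)))
      extract-weight f small = cases (Mat.valid L.full f)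
        where
        product : R.∏ (λ i → W.matrix G (L.laplacian G) i (f i)) R.≈ constant (R₀.∏ (λ i → entry i (f i))) R.* power (size (lower f))
        product = R.trans (R.∏-cong {n} (λ i → matrix-entry i (f i)))
          (R.trans (R.∏-distrib-* {n} (λ i → constant (entry i (f i))) (λ i → if lower f i then t else R.1#))
            (R.*-cong (∏-constant (λ i → entry i (f i))) (∏-power (lower f))))
        cases : ∀ b → extract (R.ι b R.* R.∏ (λ i → W.matrix G (L.laplacian G) i (f i)))
          R₀.≈ R₀.ι b R₀.* (R₀.∏ (λ i → entry i (f i)) R₀.* difference e (size (lower f)))
        cases false = R₀.trans (extract-cong (R.zeroˡ (R.∏ (λ i → W.matrix G (L.laplacian G) i (f i))))) (R₀.trans extract-0 (R₀.sym (R₀.zeroˡ _)))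
        cases true  = R₀.trans (extract-cong (R.trans (R.*-identityˡ (R.∏ (λ i → W.matrix G (L.laplacian G) i (f i)))) product))
          (R₀.trans (extract-constant (R₀.∏ (λ i → entry i (f i))) (power (size (lower f))))
            (R₀.trans (R₀.*-congˡ (pairing-power (size (lower f)) e (suc n) (s≤s small))) (R₀.sym (R₀.*-identityˡ _))))

      extracted-sum : extracted G R₀.≈ R₀.∑F n (λ f → extract (Mat.weight L.full f))
      extracted-sum = extract-∑F n (Mat.weight L.full)

    ∏-neg : ∀ {m} (a : Fin m → R₀.Carrier) → R₀.∏ (λ i → R₀.- a i) R₀.≈ sign m R₀.* R₀.∏ a
    ∏-neg {zero}  a = R₀.sym (R₀.*-identityˡ R₀.1#)
    ∏-neg {suc m} a = R₀.trans (R₀.*-congˡ (∏-neg (a ∘ suc)))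
      (R₀.solve 3 (λ a s p → (R₀.:- a) R₀.:* (s R₀.:* p) R₀.:= (R₀.:- s) R₀.:* (a R₀.:* p)) R₀.refl (a zero) (sign m) (R₀.∏ (a ∘ suc)))

    ∏-vanish : ∀ {m} (a : Fin m → R₀.Carrier) i → a i R₀.≈ R₀.0# → R₀.∏ a R₀.≈ R₀.0#
    ∏-vanish a zero    p = R₀.trans (R₀.*-congʳ p) (R₀.zeroˡ _)
    ∏-vanish a (suc i) p = R₀.trans (R₀.*-congˡ (∏-vanish (a ∘ suc) i p)) (R₀.zeroʳ _)

    size-≤ : ∀ {m} (B : Sub m) → size B ℕ.≤ m
    size-≤ {zero}  B = z≤n
    size-≤ {suc m} B = ℕ.+-mono-≤ (bit (B zero)) (size-≤ (B ∘ suc))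
      where
      bit : ∀ b → ιℕ b ℕ.≤ 1
      bit true  = s≤s z≤n
      bit false = z≤n

    module _ (G : Graph n) (tree : Trees.Tree G) (M₀ : Fin n → Fin n → R₀.Carrier)
      (diagonal : ∀ i → R₀.- M₀ i i R₀.≈ y₀ R₀.+ R₀.1# R₀.- S₀ R₀.+ size (G i) R₀.∙ S₀)
      (off-diagonal : ∀ i j → i ≢ j → R₀.- M₀ i j R₀.≈ R₀.ι (G i j) R₀.* (R₀.- Q))
      (g : (Fin n → Fin n) → R₀.Carrier)
      (class-value : ∀ f → (∀ i → f (f i) ≡ i) → g f R₀.≈ difference e (size (λ i → toℕ i ℕ.<ᵇ toℕ (f i)))) where

      entry : Fin n → Fin n → R₀.Carrier
      entry i j = R₀.- M₀ i j

      valid : (Fin n → Fin n) → Bool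
      valid = Mat.valid G entry diagonal off-diagonal L.full

      M₀-vanish : ∀ i j → i ≢ j → G i j ≡ false → M₀ i j R₀.≈ R₀.0#
      M₀-vanish i j i≢j e = R₀.trans (R₀.sym (-‿involutive (M₀ i j))) (R₀.trans (R₀.-‿cong
        (R₀.trans (off-diagonal i j i≢j) (R₀.ι-false e))) ε⁻¹≈ε)
        where
        open import Algebra.Properties.Ring R₀.ring using (-‿involutive)
        open import Algebra.Properties.AbelianGroup R₀.+-abelianGroup using (ε⁻¹≈ε)

      good? : ∀ (f : Fin n → Fin n) → (∀ i → f i ≡ i ⊎ G i (f i) ≡ true) ⊎ (∃ λ i → f i ≢ i × G i (f i) ≡ false)
      good? f with Fin.all? (λ i → (f i Fin.≟ i) ⊎-dec (G i (f i) Bool.≟ true))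
      ... | yes p = inj₁ p
      ... | no ¬p with Fin.¬∀⟶∃¬ n _ (λ i → (f i Fin.≟ i) ⊎-dec (G i (f i) Bool.≟ true)) ¬p
      ...   | i , q = inj₂ (i , (q ∘ inj₁) , ≢true⇒≡false (q ∘ inj₂))

      involution-valid : ∀ f → (∀ i → f (f i) ≡ i) → valid f ≡ true
      involution-valid f inv = Mat.valid-intro G entry diagonal off-diagonal L.full f inv (λ _ → inj₁ ≡.refl)

      -- Validity on the full vertex set means being an involution. Involutions agree on both sides
      -- through `class-value`. Any other injective `f` moves some point to a non-neighbour, by
      -- `tree-involutive`, and there the matrix entry vanishes.
      matched : ∀ f → (b : Bool) → valid f ≡ b → (c : Bool) → isInj f ≡ c →
        R₀.ι b R₀.* (R₀.∏ (λ i → entry i (f i)) R₀.* difference e (size (λ i → toℕ i ℕ.<ᵇ toℕ (f i))))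
          R₀.≈ sign n R₀.* (R₀.ι c R₀.* (g f R₀.* R₀.∏ (λ i → M₀ i (f i))))
      matched f true v c inj = R₀.trans (R₀.*-identityˡ _) (R₀.trans (R₀.*-cong (∏-neg (λ i → M₀ i (f i))) (R₀.sym (class-value f involutive)))
        (R₀.trans (R₀.solve 3 (λ s p g → s R₀.:* p R₀.:* g R₀.:= s R₀.:* (g R₀.:* p)) R₀.refl (sign n) (R₀.∏ (λ i → M₀ i (f i))) (g f))
          (R₀.*-congˡ (R₀.sym (R₀.ι-true (≡.trans (≡.sym inj) (injective-isInj f (λ {i} {j} → injective {i} {j}))))))))
        where
        involutive : ∀ i → f (f i) ≡ i
        involutive = Mat.valid-involutive G entry diagonal off-diagonal L.full f v
        injective : ∀ {i j} → f i ≡ f j → i ≡ j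
        injective {i} {j} e = ≡.trans (≡.sym (involutive i)) (≡.trans (≡.cong f e) (involutive j))
      matched f false v false inj = R₀.trans (R₀.zeroˡ _) (R₀.sym (R₀.trans (R₀.*-congˡ (R₀.zeroˡ _)) (R₀.zeroʳ _)))
      matched f false v true inj = R₀.trans (R₀.zeroˡ _) (R₀.sym (zero-product (good? f)))
        where
        zero-product : (∀ i → f i ≡ i ⊎ G i (f i) ≡ true) ⊎ (∃ λ i → f i ≢ i × G i (f i) ≡ false) →
          sign n R₀.* (R₀.1# R₀.* (g f R₀.* R₀.∏ (λ i → M₀ i (f i)))) R₀.≈ R₀.0#
        zero-product (inj₁ good) = true≢false (involution-valid f (tree-involutive f tree (isInj-injective f inj) good)) v
        zero-product (inj₂ (i , fi≢i , none)) = R₀.trans (R₀.*-congˡ (R₀.trans (R₀.*-identityˡ _) (R₀.trans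
          (R₀.*-congˡ (∏-vanish (λ i → M₀ i (f i)) i (M₀-vanish i (f i) (fi≢i ∘ ≡.sym) none))) (R₀.zeroʳ _)))) (R₀.zeroʳ _)

      extracted-expansion : extracted G R₀.≈ sign n R₀.* R₀.∑F n (λ f → R₀.ι (isInj f) R₀.* (g f R₀.* R₀.∏ (λ i → M₀ i (f i))))
      extracted-expansion = R₀.trans (extracted-sum G entry diagonal off-diagonal)
        (R₀.trans (R₀.∑F-cong n (λ f → R₀.trans
            (extract-weight G entry diagonal off-diagonal f (size-≤ (λ i → toℕ i ℕ.<ᵇ toℕ (f i))))
            (matched f (valid f) ≡.refl (isInj f) ≡.refl)))
          (R₀.∑F-*ˡ n (sign n) (λ f → R₀.ι (isInj f) R₀.* (g f R₀.* R₀.∏ (λ i → M₀ i (f i))))))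

module Bounds (R₀ : CommutativeRing 0ℓ 0ℓ) where
  module R₀ = CommutativeRing R₀
  open FunctionSums R₀ using (ι; ∑F)
  open import Algebra.Properties.CommutativeMonoid.Sum R₀.*-commutativeMonoid using () renaming (sum to ∏)
  open import Algebra.Properties.Semiring.Mult R₀.semiring using () renaming (_×_ to _∙_)

  module Positive (cone₀ : Cone R₀ 0ℓ) where
    open Cone cone₀

    -- The matrix `M` enters through `- M`: negating `xI - L` gives the diagonal weight with
    -- `y = - x` and the edge entry `- q`. The price is the factor `sign n` in front of the
    -- polynomial.
    module Expanded (Q y₀ : R₀.Carrier) (Pos-y₀ : Pos y₀) (Pos-Q² : Pos (Q R₀.* Q))
      (scalar : ℚ → R₀.Carrier) (scalar-0 : scalar 0ℚ R₀.≈ R₀.0#)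
      (scalar-minus : ∀ a b → scalar (a ℚ.- b) R₀.≈ scalar a R₀.- scalar b)
      (Pos-scalar : ∀ {a} → 0ℚ ℚ.≤ a → Pos (scalar a))
      (n : ℕ) (1≤n : 1 ℕ.≤ n) (λ' : List ℕ) (Γ : List ℕ → ℚ) (inverse : IsChInvMono n λ' Γ)
      (M : Graph n → Fin n → Fin n → R₀.Carrier)
      (diagonal : ∀ G → (∀ i → G i i ≡ false) → ∀ i →
        R₀.- M G i i R₀.≈ y₀ R₀.+ R₀.1# R₀.- Q R₀.* Q R₀.+ size (G i) ∙ (Q R₀.* Q))
      (off-diagonal : ∀ G i j → i ≢ j → R₀.- M G i j R₀.≈ ι (G i j) R₀.* (R₀.- Q))
      (polynomial : Graph n → R₀.Carrier)
      (polynomial≈ : ∀ G → polynomial G R₀.≈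
        ∑F n (λ ψ → ι (isInj ψ) R₀.* (scalar (Γ (cycleType ψ)) R₀.* ∏ (λ i → M G i (ψ i))))) where

      open ClassFunction using (indicator; indicator-≥0; indicator-zero; Γ-difference; ν)
      open RingSign R₀ using (sign)

      e : ℕ → R₀.Carrier
      e k = scalar (indicator n 1≤n λ' Γ inverse k)

      module E = Extraction R₀ Q y₀ n e

      scalar-cong : ∀ {a b} → a ≡ b → scalar a R₀.≈ scalar b
      scalar-cong p = R₀.reflexive (≡.cong scalar p)

      scalar-difference : ∀ m h → E.difference (scalar ∘ h) m R₀.≈ scalar (Differences.difference h m)
      scalar-difference zero    h = R₀.refl
      scalar-difference (suc m) h = R₀.trans (R₀.+-cong (scalar-difference m (h ∘ suc)) (R₀.-‿cong (scalar-difference m h)))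
        (R₀.sym (scalar-minus (Differences.difference (h ∘ suc) m) (Differences.difference h m)))

      class-value : ∀ (f : Fin n → Fin n) → (∀ i → f (f i) ≡ i) →
        scalar (Γ (cycleType f)) R₀.≈ E.difference e (size (λ i → toℕ i ℕ.<ᵇ toℕ (f i)))
      class-value f inv = R₀.trans
        (scalar-cong (≡.trans (≡.cong Γ CT.cycleType-twosOnes) (Γ-difference n 1≤n λ' Γ inverse CT.transpositions CT.transpositions-≤)))
        (R₀.sym (scalar-difference CT.transpositions (indicator n 1≤n λ' Γ inverse)))
        where module CT = CycleType f inv

      extracted : Graph n → R₀.Carrier
      extracted = E.extracted cone₀ Pos-y₀ Pos-Q²

      extracted-polynomial : ∀ G → Trees.Tree G → extracted G R₀.≈ sign n R₀.* polynomial G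
      extracted-polynomial G tree = R₀.trans
        (E.extracted-expansion cone₀ Pos-y₀ Pos-Q² G tree (M G) (diagonal G (Trees.Tree.loopless tree)) (off-diagonal G)
          (λ f → scalar (Γ (cycleType f))) class-value)
        (R₀.*-congˡ (R₀.sym (polynomial≈ G)))

      polynomial-monotone : ∀ {T₁ T₂} → Trees.Tree T₁ → Trees.Tree T₂ → T₁ ≤GTS T₂ →
        Pos (sign n R₀.* polynomial T₁ R₀.- sign n R₀.* polynomial T₂)
      polynomial-monotone {T₁} {T₂} tree₁ tree₂ T₁≤T₂ = Pos-resp
        (R₀.+-cong (extracted-polynomial T₁ tree₁) (R₀.-‿cong (extracted-polynomial T₂ tree₂)))
        (E.extracted-monotone cone₀ Pos-y₀ Pos-Q² (λ k → Pos-scalar (indicator-≥0 n 1≤n λ' Γ inverse k)) {T₁} {T₂} tree₁ T₁≤T₂)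

      polynomial-zero : (∀ k → λ' ≢ ν n 1≤n λ' Γ inverse k) → ∀ T → Trees.Tree T → sign n R₀.* polynomial T R₀.≈ R₀.0#
      polynomial-zero other T tree = R₀.trans (R₀.sym (extracted-polynomial T tree))
        (SumLemmas.sum-zero R₀.+-commutativeMonoid {suc n} {λ k → e (toℕ k) R₀.* p (toℕ k)}
          (λ k → R₀.trans (R₀.*-congʳ (R₀.trans (scalar-cong (indicator-zero n 1≤n λ' Γ inverse other (toℕ k))) scalar-0)) (R₀.zeroˡ (p (toℕ k)))))
        where
        p : ℕ → R₀.Carrier
        p = E.M.matchingPolynomial cone₀ Pos-y₀ Pos-Q² T

-- Translation of list polynomials into power series.

module ListSums {c ℓ} (R : CommutativeRing c ℓ) where
  open CommutativeRing R hiding (zero)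
  open FunctionSums R
  open import Algebra.Properties.Semiring.Sum semiring using (sum; sum-cong-≋)

  listSum : ∀ {A : Set} → (A → Carrier) → List A → Carrier
  listSum h []      = 0#
  listSum h (a ∷ l) = h a + listSum h l

  listSum-++ : ∀ {A : Set} (h : A → Carrier) k l → listSum h (k ++ l) ≈ listSum h k + listSum h l
  listSum-++ h []      l = sym (+-identityˡ _)
  listSum-++ h (a ∷ k) l = trans (+-congˡ (listSum-++ h k l)) (sym (+-assoc _ _ _))

  listSum-map : ∀ {A B : Set} (h : B → Carrier) (k : A → B) l → listSum h (map k l) ≈ listSum (h ∘ k) l
  listSum-map h k []      = refl
  listSum-map h k (a ∷ l) = +-congˡ (listSum-map h k l)

  listSum-concatMap : ∀ {A B : Set} (h : B → Carrier) (k : A → List B) l → listSum h (concatMap k l) ≈ listSum (listSum h ∘ k) l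
  listSum-concatMap h k []      = refl
  listSum-concatMap h k (a ∷ l) = trans (listSum-++ h (k a) (concatMap k l)) (+-congˡ (listSum-concatMap h k l))

  listSum-tabulate : ∀ {m} {A : Set} (h : A → Carrier) (k : Fin m → A) → listSum h (tabulate k) ≈ sum (h ∘ k)
  listSum-tabulate {zero}  h k = refl
  listSum-tabulate {suc m} h k = +-congˡ (listSum-tabulate h (k ∘ suc))

  listSum-funs : ∀ {n} m (h : (Fin m → Fin n) → Carrier) → listSum h (funs m) ≈ ∑F m h
  listSum-funs zero h = +-identityʳ _
  listSum-funs {n} (suc m) h = trans (listSum-concatMap h (λ a → map (consF a) (funs m)) (allFin n))
    (trans (listSum-tabulate (λ a → listSum h (map (consF a) (funs m))) id)
      (sum-cong-≋ {n} (λ a → trans (listSum-map h (consF a) (funs m)) (listSum-funs m (h ∘ consF a)))))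

module Coefficients where
  open RationalNaturals

  ℚ-ring : CommutativeRing 0ℓ 0ℓ
  ℚ-ring = ℚ.+-*-commutativeRing

  module Pq = PowerSeries ℚ-ring

  Rq : CommutativeRing 0ℓ 0ℓ
  Rq = Pq.series

  module Px = PowerSeries Rq

  R₀ : CommutativeRing 0ℓ 0ℓ
  R₀ = Px.series

  module R₀ where
    open CommutativeRing R₀ public
    open FunctionSums R₀ public
    open ListSums R₀ public
    open import Algebra.Properties.Semiring.Sum semiring public using (sum; sum-cong-≋)
    open import Algebra.Properties.CommutativeMonoid.Sum *-commutativeMonoid public using ()
      renaming (sum to ∏; sum-cong-≋ to ∏-cong)
    open import Algebra.Properties.Semiring.Mult semiring public using () renaming (_×_ to _∙_)

  -- The outer index is the exponent of x, the inner one that of q. In terms of coefficients, lists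
  -- that differ by trailing zeros become equal, and the laws of a commutative ring hold.
  ⟦_⟧ : XPoly → R₀.Carrier
  ⟦ p ⟧ a b = coeffQ (coeffX p a) b

  coeffQ-add : ∀ p q k → coeffQ (addQ p q) k ≡ coeffQ p k ℚ.+ coeffQ q k
  coeffQ-add []      q       k       = ≡.sym (ℚ.+-identityˡ _)
  coeffQ-add (a ∷ p) []      k       = ≡.sym (ℚ.+-identityʳ _)
  coeffQ-add (a ∷ p) (b ∷ q) zero    = ≡.refl
  coeffQ-add (a ∷ p) (b ∷ q) (suc k) = coeffQ-add p q k

  coeffQ-scale : ∀ a p k → coeffQ (scaleQ a p) k ≡ a ℚ.* coeffQ p k
  coeffQ-scale a []      k       = ≡.sym (ℚ.*-zeroʳ a)
  coeffQ-scale a (b ∷ p) zero    = ≡.refl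
  coeffQ-scale a (b ∷ p) (suc k) = coeffQ-scale a p k

  coeffQ-mul : ∀ p q k → coeffQ (mulQ p q) k ≡ (coeffQ p Pq.⊛ coeffQ q) k
  coeffQ-mul []      q k       = ≡.sym (Pq.zero-⊛ (coeffQ q) (λ _ → ≡.refl) k)
  coeffQ-mul (a ∷ p) q zero    = ≡.trans (coeffQ-add (scaleQ a q) (0ℚ ∷ mulQ p q) 0)
    (≡.trans (≡.cong (ℚ._+ 0ℚ) (coeffQ-scale a q 0)) (ℚ.+-identityʳ _))
  coeffQ-mul (a ∷ p) q (suc k) = ≡.trans (coeffQ-add (scaleQ a q) (0ℚ ∷ mulQ p q) (suc k))
    (≡.cong₂ ℚ._+_ (coeffQ-scale a q (suc k)) (coeffQ-mul p q k))

  coeffQ-neg : ∀ p k → coeffQ (negQ p) k ≡ ℚ.- coeffQ p k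
  coeffQ-neg []      k       = ≡.refl
  coeffQ-neg (a ∷ p) zero    = ≡.refl
  coeffQ-neg (a ∷ p) (suc k) = coeffQ-neg p k

  ⟦⟧-add : ∀ p q → ⟦ addX p q ⟧ R₀.≈ ⟦ p ⟧ R₀.+ ⟦ q ⟧
  ⟦⟧-add []      q       k       b = ≡.sym (ℚ.+-identityˡ _)
  ⟦⟧-add (a ∷ p) []      k       b = ≡.sym (ℚ.+-identityʳ _)
  ⟦⟧-add (a ∷ p) (c ∷ q) zero    b = coeffQ-add a c b
  ⟦⟧-add (a ∷ p) (c ∷ q) (suc k) b = ⟦⟧-add p q k b

  ⟦⟧-scale : ∀ a p k b → ⟦ scaleX a p ⟧ k b ≡ (coeffQ a Pq.⊛ ⟦ p ⟧ k) b
  ⟦⟧-scale a []      k       b = ≡.sym (≡.trans (Pq.⊛-comm (coeffQ a) (λ _ → 0ℚ) b) (Pq.zero-⊛ (coeffQ a) (λ _ → ≡.refl) b))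
  ⟦⟧-scale a (c ∷ p) zero    b = coeffQ-mul a c b
  ⟦⟧-scale a (c ∷ p) (suc k) b = ⟦⟧-scale a p k b

  ⟦⟧-mul : ∀ p q → ⟦ mulX p q ⟧ R₀.≈ ⟦ p ⟧ R₀.* ⟦ q ⟧
  ⟦⟧-mul []      q k       b = ≡.sym (Px.zero-⊛ {λ _ _ → 0ℚ} ⟦ q ⟧ (λ _ _ → ≡.refl) k b)
  ⟦⟧-mul (a ∷ p) q zero    b = ≡.trans (⟦⟧-add (scaleX a q) ([] ∷ mulX p q) 0 b)
    (≡.trans (≡.cong (ℚ._+ 0ℚ) (⟦⟧-scale a q 0 b)) (ℚ.+-identityʳ _))
  ⟦⟧-mul (a ∷ p) q (suc k) b = ≡.trans (⟦⟧-add (scaleX a q) ([] ∷ mulX p q) (suc k) b)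
    (≡.cong₂ ℚ._+_ (⟦⟧-scale a q (suc k) b) (⟦⟧-mul p q k b))

  scalar : ℚ → R₀.Carrier
  scalar a = Px.constant (Pq.constant a)

  ⟦⟧-scalar : ∀ a → ⟦ (a ∷ []) ∷ [] ⟧ R₀.≈ scalar a
  ⟦⟧-scalar a zero    zero    = ≡.refl
  ⟦⟧-scalar a zero    (suc b) = ≡.refl
  ⟦⟧-scalar a (suc k) b       = ≡.refl

  ⟦⟧-product : ∀ {m} {A : Set} (g : A → XPoly) (k : Fin m → A) →
    ⟦ foldr (λ i acc → mulX (g i) acc) ((1ℚ ∷ []) ∷ []) (tabulate k) ⟧ R₀.≈ R₀.∏ (λ i → ⟦ g (k i) ⟧)
  ⟦⟧-product {zero}  g k = ⟦⟧-scalar 1ℚ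
  ⟦⟧-product {suc m} g k = R₀.trans (⟦⟧-mul (g (k zero)) _) (R₀.*-congˡ {⟦ g (k zero) ⟧} (⟦⟧-product g (k ∘ suc)))

  ⟦⟧-filter-sum : ∀ {A : Set} (p : A → Bool) (g : A → XPoly) l →
    ⟦ foldr addX [] (map g (filterB p l)) ⟧ R₀.≈ R₀.listSum (λ a → R₀.ι (p a) R₀.* ⟦ g a ⟧) l
  ⟦⟧-filter-sum p g []      = R₀.refl
  ⟦⟧-filter-sum p g (a ∷ l) = cases (p a)
    where
    ih = ⟦⟧-filter-sum p g l
    cases : ∀ b → ⟦ foldr addX [] (map g (if b then a ∷ filterB p l else filterB p l)) ⟧
      R₀.≈ R₀.ι b R₀.* ⟦ g a ⟧ R₀.+ R₀.listSum (λ a → R₀.ι (p a) R₀.* ⟦ g a ⟧) l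
    cases true  = R₀.trans (⟦⟧-add (g a) (foldr addX [] (map g (filterB p l))))
      (R₀.+-cong (R₀.sym (R₀.*-identityˡ ⟦ g a ⟧)) ih)
    cases false = R₀.trans ih (R₀.trans (R₀.sym (R₀.+-identityˡ _)) (R₀.+-congʳ (R₀.sym (R₀.zeroˡ ⟦ g a ⟧))))

  ⟦⟧-dfun : ∀ {n} (Γ : List ℕ → ℚ) (M : Fin n → Fin n → XPoly) →
    ⟦ dfun Γ M ⟧ R₀.≈ R₀.∑F n (λ ψ → R₀.ι (isInj ψ) R₀.* (scalar (Γ (cycleType ψ)) R₀.* R₀.∏ (λ i → ⟦ M i (ψ i) ⟧)))
  ⟦⟧-dfun {n} Γ M = R₀.trans (⟦⟧-filter-sum isInj term (funs n))
    (R₀.trans (R₀.listSum-funs n (λ ψ → R₀.ι (isInj ψ) R₀.* ⟦ term ψ ⟧))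
      (R₀.∑F-cong n (λ ψ → R₀.*-congˡ {R₀.ι (isInj ψ)} (R₀.trans (⟦⟧-mul ((Γ (cycleType ψ) ∷ []) ∷ []) (inner ψ))
        (R₀.*-cong (⟦⟧-scalar (Γ (cycleType ψ))) (⟦⟧-product (λ i → M i (ψ i)) id))))))
    where
    inner : (Fin n → Fin n) → XPoly
    inner ψ = foldr (λ i acc → mulX (M i (ψ i)) acc) ((1ℚ ∷ []) ∷ []) (allFin n)
    term : (Fin n → Fin n) → XPoly
    term ψ = mulX ((Γ (cycleType ψ) ∷ []) ∷ []) (inner ψ)

  Q y₀ : R₀.Carrier
  Q  = Px.constant Pq.X
  y₀ = R₀.- Px.X

  square : ℕ → ℚ
  square 2 = 1ℚ
  square _ = 0ℚ

  Q²-square : Q R₀.* Q R₀.≈ Px.constant square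
  Q²-square = R₀.trans (R₀.sym (Px.constant-* Pq.X Pq.X)) (Px.constant-cong same)
    where
    same : ∀ k → (Pq.X Pq.⊛ Pq.X) k ≡ square k
    same zero          = Pq.X-⊛-zero Pq.X
    same (suc zero)    = Pq.X-⊛-suc Pq.X 0
    same (suc (suc zero)) = Pq.X-⊛-suc Pq.X 1
    same (suc (suc (suc k))) = Pq.X-⊛-suc Pq.X (suc (suc k))

  multiple-square : ∀ d → d R₀.∙ (Q R₀.* Q) R₀.≈ Px.constant (λ k → ℕtoℚ d ℚ.* square k)
  multiple-square zero    zero    b = ≡.sym (ℚ.*-zeroˡ (square b))
  multiple-square zero    (suc a) b = ≡.refl
  multiple-square (suc d) a b = ≡.trans (≡.cong₂ ℚ._+_ (Q²-square a b) (multiple-square d a b)) (add a)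
    where
    add : ∀ a → Px.constant square a b ℚ.+ Px.constant (λ k → ℕtoℚ d ℚ.* square k) a b ≡ Px.constant (λ k → ℕtoℚ (suc d) ℚ.* square k) a b
    add zero    = ≡.sym (≡.trans (≡.cong (ℚ._* square b) (ℕtoℚ-+ 1 d)) (≡.trans (ℚ.*-distribʳ-+ (square b) (ℕtoℚ 1) (ℕtoℚ d))
      (≡.cong (ℚ._+ ℕtoℚ d ℚ.* square b) (ℚ.*-identityˡ (square b)))))
    add (suc a) = ≡.refl

  module _ {n : ℕ} (G : Graph n) where

    diagonal : (∀ i → G i i ≡ false) → ∀ i → R₀.- ⟦ xIminus G i i ⟧ R₀.≈ y₀ R₀.+ R₀.1# R₀.- Q R₀.* Q R₀.+ size (G i) R₀.∙ (Q R₀.* Q)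
    diagonal loopless i a b rewrite ==F-refl i | loopless i | Counting.deg-size G i =
      ≡.trans (go a b) (≡.sym (≡.cong₂ (λ u v → (y₀ R₀.+ R₀.1#) a b ℚ.+ ℚ.- u ℚ.+ v) (Q²-square a b) (multiple-square d a b)))
      where
      d : ℕ
      d = size (G i)
      open DifferenceSolver ℚ-ring using (solve; _:+_; _:-_; :-_; _:=_)
      go : ∀ a b → ℚ.- coeffQ (coeffX (((ℚ.- 1ℚ) ∷ (ℚ.- (ℚ.- 0ℚ)) ∷ (ℚ.- (ℕtoℚ d ℚ.- 1ℚ)) ∷ []) ∷ (1ℚ ∷ []) ∷ []) a) b
        ≡ (y₀ R₀.+ R₀.1#) a b ℚ.+ ℚ.- Px.constant square a b ℚ.+ Px.constant (λ k → ℕtoℚ d ℚ.* square k) a b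
      go zero zero                = ≡.sym (≡.trans (≡.cong (1ℚ ℚ.+_) (ℚ.*-zeroʳ (ℕtoℚ d))) ≡.refl)
      go zero (suc zero)          = ≡.sym (≡.trans (≡.cong (0ℚ ℚ.+_) (ℚ.*-zeroʳ (ℕtoℚ d))) ≡.refl)
      go zero (suc (suc zero))    = ≡.trans (solve 2 (λ d o → :- (:- (d :- o)) := (:- o) :+ d) ≡.refl (ℕtoℚ d) 1ℚ)
        (≡.cong (ℚ.- 1ℚ ℚ.+_) (≡.sym (ℚ.*-identityʳ (ℕtoℚ d))))
      go zero (suc (suc (suc b))) = ≡.sym (≡.trans (≡.cong (0ℚ ℚ.+_) (ℚ.*-zeroʳ (ℕtoℚ d))) ≡.refl)
      go (suc zero) zero          = ≡.refl
      go (suc zero) (suc b)       = ≡.refl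
      go (suc (suc a)) b          = ≡.refl

    off-diagonal : ∀ i j → i ≢ j → R₀.- ⟦ xIminus G i j ⟧ R₀.≈ R₀.ι (G i j) R₀.* (R₀.- Q)
    off-diagonal i j i≢j a b rewrite ≢⇒==F i≢j = go (G i j) a b
      where
      go : ∀ g a b → ℚ.- coeffQ (coeffX (negQ (0ℚ ∷ ℚ.- (if g then 1ℚ else 0ℚ) ∷ (0ℚ ℚ.- 0ℚ) ∷ []) ∷ []) a) b ≡ (R₀.ι g R₀.* (R₀.- Q)) a b
      go false a b = ≡.trans (zeros a b) (≡.sym (R₀.zeroˡ (R₀.- Q) a b))
        where
        zeros : ∀ a b → ℚ.- coeffQ (coeffX (negQ (0ℚ ∷ ℚ.- 0ℚ ∷ (0ℚ ℚ.- 0ℚ) ∷ []) ∷ []) a) b ≡ 0ℚ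
        zeros zero zero                = ≡.refl
        zeros zero (suc zero)          = ≡.refl
        zeros zero (suc (suc zero))    = ≡.refl
        zeros zero (suc (suc (suc b))) = ≡.refl
        zeros (suc a) b                = ≡.refl
      go true a b = ≡.trans (minus a b) (≡.sym (R₀.*-identityˡ (R₀.- Q) a b))
        where
        minus : ∀ a b → ℚ.- coeffQ (coeffX (negQ (0ℚ ∷ ℚ.- 1ℚ ∷ (0ℚ ℚ.- 0ℚ) ∷ []) ∷ []) a) b ≡ (R₀.- Q) a b
        minus zero zero                = ≡.refl
        minus zero (suc zero)          = ≡.refl
        minus zero (suc (suc zero))    = ≡.refl
        minus zero (suc (suc (suc b))) = ≡.refl
        minus (suc a) b                = ≡.refl

  cone-ℚ : Cone ℚ-ring 0ℓ
  cone-ℚ = record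
    { Pos = 0ℚ ℚ.≤_
    ; Pos-resp = λ e p → ≡.subst (0ℚ ℚ.≤_) e p
    ; Pos-0 = ℚ.≤-refl
    ; Pos-1 = ℚ.nonNegative⁻¹ 1ℚ
    ; Pos-+ = λ p q → ℚ.+-mono-≤ p q
    ; Pos-* = λ {a} {b} p q → ℚ.nonNegative⁻¹ (a ℚ.* b) {{ℚ.nonNeg*nonNeg⇒nonNeg a {{ℚ.nonNegative p}} b {{ℚ.nonNegative q}}}}
    }

  cone-q : Cone Rq 0ℓ
  cone-q = SeriesCone.seriesCone (evenGrading cone-ℚ)

  -- Positive here means: as a series in `- x`, with coefficients that are nonnegative and even in
  -- q.
  cone₀ : Cone R₀ 0ℓ
  cone₀ = SeriesCone.seriesCone (alternatingGrading cone-q)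

  Pos-y₀ : Cone.Pos cone₀ y₀
  Pos-y₀ zero = Cone.Pos-0 cone-q
  Pos-y₀ (suc zero) = Cone.Pos-resp cone-q {Rq.1#} (λ { zero → ≡.refl ; (suc k) → ≡.refl }) (Cone.Pos-1 cone-q)
    where module Rq = CommutativeRing Rq
  Pos-y₀ (suc (suc k)) = Grading.K-resp (alternatingGrading cone-q) k {λ _ → 0ℚ} (λ _ → ≡.refl) (Grading.K-0 (alternatingGrading cone-q) k)

  Pos-scalar : ∀ {a} → 0ℚ ℚ.≤ a → Cone.Pos cone₀ (scalar a)
  Pos-scalar {a} p zero zero    = p
  Pos-scalar {a} p zero (suc k) = Grading.K-0 (evenGrading cone-ℚ) (suc k)
  Pos-scalar {a} p (suc k)      = Grading.K-0 (alternatingGrading cone-q) (suc k)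

  Pos-Q² : Cone.Pos cone₀ (Q R₀.* Q)
  Pos-Q² = Cone.Pos-resp cone₀ (R₀.sym Q²-square) pos
    where
    pos : Cone.Pos cone₀ (Px.constant square)
    pos zero zero             = ℚ.≤-refl
    pos zero (suc zero)       = ≡.refl
    pos zero (suc (suc zero)) = ℚ.nonNegative⁻¹ 1ℚ
    pos zero (suc (suc (suc k))) = Grading.K-0 (evenGrading cone-ℚ) (suc k)
    pos (suc k)               = Grading.K-0 (alternatingGrading cone-q) (suc k)

-- Cancellation of signs, and the conclusion.

module Signs where
  open import Data.Nat.Base using (_∸_; _≤_)
  open import Algebra.Properties.Ring ℚ.+-*-ring using (-‿distribˡ-*; -‿involutive)

  -- Repeated negation of the argument, because `alternatingGrading` unfolds in exactly this way.
  negate : ℕ → ℚ → ℚ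
  negate zero    v = v
  negate (suc k) v = negate k (ℚ.- v)

  negate-suc : ∀ k v → negate k (ℚ.- v) ≡ ℚ.- negate k v
  negate-suc zero    v = ≡.refl
  negate-suc (suc k) v = negate-suc k (ℚ.- v)

  negate-+ : ∀ k l v → negate k (negate l v) ≡ negate (k ℕ.+ l) v
  negate-+ zero    l v = ≡.refl
  negate-+ (suc k) l v = ≡.trans (≡.cong (negate k) (≡.sym (negate-suc l v))) (negate-+ k l (ℚ.- v))

  negate-involutive : ∀ k v → negate k (negate k v) ≡ v
  negate-involutive zero    v = ≡.refl
  negate-involutive (suc k) v = ≡.trans (≡.cong (negate k) (≡.trans (≡.sym (negate-suc k (ℚ.- v)))
    (≡.cong (negate k) (-‿involutive v)))) (negate-involutive k v)

  negate-zero : ∀ k → negate k 0ℚ ≡ 0ℚ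
  negate-zero zero    = ≡.refl
  negate-zero (suc k) = negate-zero k

  -- Three signs meet at the coefficient of x^(n-r): (-1)^(n-r) from `y = - x`, (-1)^n from negating
  -- all matrix entries, and the (-1)^r in the definition of c_r. The first two multiply to the
  -- third.
  negate-∸ : ∀ n r v → r ≤ n → negate (n ∸ r) (negate n v) ≡ negate r v
  negate-∸ n r v r≤n = ≡.trans (≡.cong (λ m → negate (n ∸ r) (negate m v)) (≡.sym (ℕ.m∸n+n≡m r≤n)))
    (≡.trans (≡.cong (negate (n ∸ r)) (≡.sym (negate-+ (n ∸ r) r v))) (negate-involutive (n ∸ r) (negate r v)))

  signQ-negate : ∀ r v → signQ r ℚ.* v ≡ negate r v
  signQ-negate zero    v = ℚ.*-identityˡ v
  signQ-negate (suc r) v = ≡.trans (≡.sym (-‿distribˡ-* (signQ r) v)) (≡.trans (≡.cong ℚ.-_ (signQ-negate r v)) (≡.sym (negate-suc r v)))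

module Conclusion (n : ℕ) (1≤n : 1 ℕ.≤ n) (λ' : List ℕ) (Γ : List ℕ → ℚ) (inverse : IsChInvMono n λ' Γ) where
  open import Data.Nat.Base using (_∸_; _≤_)
  open Differences using (double-suc)
  open Coefficients
  open Signs

  open ClassFunction using (ν)
  open RingSign Coefficients.R₀ using (sign)

  scalar-0 : scalar 0ℚ R₀.≈ R₀.0#
  scalar-0 zero    zero    = ≡.refl
  scalar-0 zero    (suc l) = ≡.refl
  scalar-0 (suc k) l       = ≡.refl

  scalar-minus : ∀ a b → scalar (a ℚ.- b) R₀.≈ scalar a R₀.- scalar b
  scalar-minus a b zero    zero    = ≡.refl
  scalar-minus a b zero    (suc l) = ≡.refl
  scalar-minus a b (suc k) l       = ≡.refl

  polynomial : Graph n → R₀.Carrier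
  polynomial G = ⟦ dfun Γ (xIminus G) ⟧

  module B = Bounds.Positive.Expanded Coefficients.R₀ cone₀ Q y₀ Pos-y₀ Pos-Q² scalar scalar-0 scalar-minus Pos-scalar
    n 1≤n λ' Γ inverse (λ G i j → ⟦ xIminus G i j ⟧) diagonal off-diagonal polynomial (λ G → ⟦⟧-dfun Γ (xIminus G))

  sign-negate : ∀ k F a b → (sign k R₀.* F) a b ≡ negate k (F a b)
  sign-negate zero    F a b = R₀.*-identityˡ F a b
  sign-negate (suc k) F a b = ≡.trans (≡.sym (-‿distribˡ-* (sign k) F a b))
    (≡.trans (≡.cong ℚ.-_ (sign-negate k F a b)) (≡.sym (negate-suc k (F a b))))
    where open import Algebra.Properties.Ring (CommutativeRing.ring Coefficients.R₀) using (-‿distribˡ-*)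

  module Kx = Grading (alternatingGrading cone-q)
  module Kq = Grading (evenGrading cone-ℚ)

  alternating : ∀ b {f} → Kx.K b f → ∀ k → Kq.K k (negate b (f k))
  alternating zero    h k = h k
  alternating (suc b) h k = alternating b h k

  difference-polynomial : ∀ {T₁ T₂} → Trees.Tree T₁ → Trees.Tree T₂ → T₁ ≤GTS T₂ → ∀ r → r ≤ n → ∀ k →
    Kq.K k (coeffQ (subQ (cCoef Γ T₁ r) (cCoef Γ T₂ r)) k)
  difference-polynomial {T₁} {T₂} tree₁ tree₂ T₁≤T₂ r r≤n k = Kq.K-resp k value
    (alternating b (positive b) k)
    where
    b : ℕ
    b = n ∸ r
    d₁ d₂ : R₀.Carrier
    d₁ = polynomial T₁
    d₂ = polynomial T₂
    positive : Cone.Pos cone₀ (sign n R₀.* d₁ R₀.- sign n R₀.* d₂)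
    positive = B.polynomial-monotone {T₁} {T₂} tree₁ tree₂ T₁≤T₂
    negate-minus : ∀ m u v → negate m (u ℚ.- v) ≡ negate m u ℚ.- negate m v
    negate-minus m u v = ≡.trans (≡.sym (signQ-negate m (u ℚ.- v))) (≡.trans (ℚ.*-distribˡ-+ (signQ m) u (ℚ.- v))
      (≡.cong₂ ℚ._+_ (signQ-negate m u) (≡.trans (signQ-negate m (ℚ.- v)) (negate-suc m v))))
    coefficient : ∀ T → negate r (polynomial T b k) ≡ coeffQ (cCoef Γ T r) k
    coefficient T = ≡.sym (≡.trans (coeffQ-scale (signQ r) (coeffX (dfun Γ (xIminus T)) b) k) (signQ-negate r (polynomial T b k)))
    value : negate b ((sign n R₀.* d₁) b k ℚ.- (sign n R₀.* d₂) b k) ≡ coeffQ (subQ (cCoef Γ T₁ r) (cCoef Γ T₂ r)) k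
    value = ≡.trans (≡.cong₂ (λ u v → negate b (u ℚ.- v)) (sign-negate n d₁ b k) (sign-negate n d₂ b k))
      (≡.trans (negate-minus b (negate n (d₁ b k)) (negate n (d₂ b k)))
        (≡.trans (≡.cong₂ ℚ._-_ (≡.trans (negate-∸ n r (d₁ b k) r≤n) (coefficient T₁)) (≡.trans (negate-∸ n r (d₂ b k) r≤n) (coefficient T₂)))
          (≡.sym (≡.trans (coeffQ-add (cCoef Γ T₁ r) (negQ (cCoef Γ T₂ r)) k)
            (≡.cong (coeffQ (cCoef Γ T₁ r) k ℚ.+_) (coeffQ-neg (cCoef Γ T₂ r) k))))))

  even-part : ∀ k {v} → Kq.K (2 ℕ.* k) v → 0ℚ ℚ.≤ v
  even-part zero    h = h
  even-part (suc k) {v} h = even-part k (≡.subst (λ m → Kq.K m v) (double-suc k) h)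

  odd-part : ∀ k {v} → Kq.K (suc (2 ℕ.* k)) v → v ≡ 0ℚ
  odd-part zero    h = h
  odd-part (suc k) {v} h = odd-part k (≡.subst (λ m → Kq.K (suc m) v) (double-suc k) h)

  coefficients-monotone : ∀ {T₁ T₂} → Trees.Tree T₁ → Trees.Tree T₂ → T₁ ≤GTS T₂ → ∀ r → r ≤ n →
    InRplusQ2 (subQ (cCoef Γ T₁ r) (cCoef Γ T₂ r))
  coefficients-monotone {T₁} {T₂} tree₁ tree₂ T₁≤T₂ r r≤n k =
    even-part k (difference-polynomial {T₁} {T₂} tree₁ tree₂ T₁≤T₂ r r≤n (2 ℕ.* k)) ,
    odd-part k (difference-polynomial {T₁} {T₂} tree₁ tree₂ T₁≤T₂ r r≤n (suc (2 ℕ.* k)))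

  vanishing : (∀ k → λ' ≢ ν n 1≤n λ' Γ inverse k) → ∀ T → Trees.Tree T → IsZeroX (dfun Γ (xIminus T))
  vanishing other T tree a b = ≡.trans (≡.sym (negate-involutive n (polynomial T a b)))
    (≡.trans (≡.cong (negate n) (≡.trans (≡.sym (sign-negate n (polynomial T) a b)) (B.polynomial-zero other T tree a b))) (negate-zero n))

open import Defs
open import Data.Nat using (ℕ; _≤_; _∸_; _*_)
open import Data.List using (List; _++_; replicate)
open import Data.Rational using (ℚ)
open import Data.Product using (_×_)
open import Relation.Binary.PropositionalEquality using (_≢_)

theorem1 : (n : ℕ) → 1 ≤ n → (T₁ T₂ : Graph n) → IsTree T₁ → IsTree T₂ →
    Covers T₁ T₂ →
    (λ' : List ℕ) → IsPartition n λ' →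
    (Γ : List ℕ → ℚ) → IsChInvMono n λ' Γ →
    ((r : ℕ) → r ≤ n → InRplusQ2 (subQ (cCoef Γ T₁ r) (cCoef Γ T₂ r)))
    × (((k : ℕ) → λ' ≢ replicate k 2 ++ replicate (n ∸ 2 * k) 1) →
    IsZeroX (dfun Γ (xIminus T₁)) × IsZeroX (dfun Γ (xIminus T₂)))
theorem1 n 1≤n T₁ T₂ isTree₁ isTree₂ ((T₁≤T₂ , _) , _) λ' _ Γ inverse =
  coefficients-monotone {T₁} {T₂} tree₁ tree₂ T₁≤T₂ , λ other → vanishing other T₁ tree₁ , vanishing other T₂ tree₂
  where
  open Conclusion n 1≤n λ' Γ inverse
  tree₁ : Tree T₁
  tree₁ = Trees.isTree⇒Tree isTree₁
  tree₂ : Tree T₂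
  tree₂ = Trees.isTree⇒Tree isTree₂
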